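{- Let $p$ be a prime, let $n\ge 1$ be an integer, and let $t\in\{ -\infty,0,1,\dots,n-1\}$. Then there exist a field $F$ with $\operatorname{char}F\neq p$ containing a primitive $p$th root of unity $\xi_p$ and a cyclic Galois extension $K/F$ of degree $p^n$ such that $m(K/F)=t$.
   Context: Let $p$ be a prime and $K/F$ a cyclic Galois extension of degree $p^n$, $n\ge 1$, with $\operatorname{char}F\ne p$ and $F$ containing a primitive $p$th root of unity $\xi_p$. For $0\le i\le n$ let $K_i$ be the unique intermediate field $F\subseteq K_i\subseteq K$ with $[K_i:F]=p^i$. Define $$m(K/F)=\begin{cases}-\infty, & \xi_p\in N_{K/F}(K^\times),\\ \min\{s\in\{0,\dots,n\} : \xi_p\in N_{K/K_s}(K^\times)\}-1, & \xi_p\notin N_{K/F}(K^\times).\end{cases}$$ Here $N_{K/K_s}$ denotes the field norm. -}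

module Defs where

open import Algebra.Apartness.Bundles
  using (HeytingField; module HeytingCommutativeRing)
open import Algebra.Bundles using (CommutativeRing; Group)
open import Algebra.Morphism.Structures
  using (IsRingHomomorphism; IsRingIsomorphism)
import Algebra.Morphism.Construct.Composition as Composition
import Algebra.Morphism.Construct.Identity as Identity
import Algebra.Properties.CommutativeMonoid.Sum as Sum
import Algebra.Properties.Monoid.Mult as Mult
import Algebra.Properties.Semiring.Exp as Exp
open import Data.Fin.Base using (Fin; toℕ)
open import Data.Integer.Base as ℤ using (ℤ; +_; -[1+_])
open import Data.Nat.Base as ℕ using (ℕ; suc)
open import Data.Nat.Divisibility using (_∣_)
open import Data.Product.Base using (Σ-syntax; ∃-syntax; _×_; _,_; proj₁; proj₂)
open import Function.Bundles using (_⇔_; Inverse)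
open import Level using (0ℓ)
open import Relation.Binary.Bundles using (Setoid)
open import Relation.Binary.PropositionalEquality using (_≡_; setoid)
open import Relation.Nullary.Construct.Add.Infimum using (_₋; ⊥₋; [_])
open import Relation.Nullary.Negation using (¬_)
open import Relation.Unary using (Pred; _∈_; U)

Field : Set₁
Field = HeytingField 0ℓ 0ℓ 0ℓ

module FieldOps (F : Field) where
  open HeytingField F public

  commutativeRing : CommutativeRing 0ℓ 0ℓ
  commutativeRing = HeytingCommutativeRing.commutativeRing heytingCommutativeRing

  open CommutativeRing commutativeRing public
    using (semiring; rawRing; +-monoid; +-commutativeMonoid; *-commutativeMonoid)
  open Exp semiring public using (_^_)
  open Mult +-monoid public using () renaming (_×_ to _·_)
  open Sum +-commutativeMonoid public using (sum)
  open Sum *-commutativeMonoid public using () renaming (sum to product)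

-- c is the nonnegative generator of the kernel of ℤ → F.
HasCharacteristic : Field → ℕ → Set
HasCharacteristic F c = ∀ m → (m · 1# ≈ 0#) ⇔ (c ∣ m)
  where open FieldOps F

IsPrimitiveRootOfUnity : (F : Field) → ℕ → FieldOps.Carrier F → Set
IsPrimitiveRootOfUnity F d ξ =
  (ξ ^ d ≈ 1#) × (∀ k → 0 ℕ.< k → k ℕ.< d → ¬ (ξ ^ k ≈ 1#))
  where open FieldOps F

module _ (G : Group 0ℓ 0ℓ) where
  open Group G
  open Mult monoid using () renaming (_×_ to _·_)

  infixl 8 _^ᶻ_

  _^ᶻ_ : Carrier → ℤ → Carrier
  g ^ᶻ (+ k)    = k · g
  g ^ᶻ -[1+ k ] = (suc k · g) ⁻¹

  IsCyclic : Set
  IsCyclic = ∃[ g ] ∀ h → ∃[ k ] h ≈ g ^ᶻ k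

record Finite (S : Setoid 0ℓ 0ℓ) : Set where
  field
    size        : ℕ
    enumeration : Inverse (setoid (Fin size)) S

record Extension (F : Field) : Set₁ where
  private module F = FieldOps F
  field
    K : Field
  private module K = FieldOps K
  field
    ι                  : F.Carrier → K.Carrier
    isRingHomomorphism : IsRingHomomorphism F.rawRing K.rawRing ι

module _ (K : Field) where
  open FieldOps K
  open import Relation.Binary.Reasoning.Setoid (CommutativeRing.setoid commutativeRing)

  record Automorphism (L : Pred Carrier 0ℓ) : Set where
    field
      to                : Carrier → Carrier
      isRingIsomorphism : IsRingIsomorphism rawRing rawRing to
      fixes             : ∀ x → x ∈ L → to x ≈ x

    open IsRingIsomorphism isRingIsomorphism public

  module _ {L : Pred Carrier 0ℓ} where
    open Automorphism

    private
      infix 4 _≋_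

      _≋_ : Automorphism L → Automorphism L → Set
      τ ≋ τ′ = ∀ x → to τ x ≈ to τ′ x

    identity : Automorphism L
    identity = record
      { to                = λ x → x
      ; isRingIsomorphism = Identity.isRingIsomorphism rawRing refl
      ; fixes             = λ _ _ → refl
      }

    compose : Automorphism L → Automorphism L → Automorphism L
    compose τ τ′ = record
      { to                = λ x → to τ (to τ′ x)
      ; isRingIsomorphism =
          Composition.isRingIsomorphism trans
            (isRingIsomorphism τ′) (isRingIsomorphism τ)
      ; fixes             = λ x x∈L →
          trans (⟦⟧-cong τ (fixes τ′ x x∈L)) (fixes τ x x∈L)
      }

    module _ (τ : Automorphism L) where
      private
        from : Carrier → Carrier
        from y = proj₁ (surjective τ y)

        to-from : ∀ y → to τ (from y) ≈ y
        to-from y = proj₂ (surjective τ y) refl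

        via : ∀ {x y} → to τ x ≈ y → from y ≈ x
        via {x} {y} eq = injective τ (trans (to-from y) (sym eq))

        from-cong : ∀ {x y} → x ≈ y → from x ≈ from y
        from-cong {x} {y} x≈y = via (trans (to-from y) (sym x≈y))

      invert : Automorphism L
      invert = record
        { to                = from
        ; isRingIsomorphism = record
          { isRingMonomorphism = record
            { isRingHomomorphism = record
              { isSemiringHomomorphism = record
                { isNearSemiringHomomorphism = record
                  { +-isMonoidHomomorphism = record
                    { isMagmaHomomorphism = record
                      { isRelHomomorphism = record { cong = from-cong }
                      ; homo = λ x y → via (trans (+-homo τ _ _) (+-cong (to-from x) (to-from y)))
                      }
                    ; ε-homo = via (0#-homo τ)
                    }
                  ; *-homo = λ x y → via (trans (*-homo τ _ _) (*-cong (to-from x) (to-from y)))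
                  }
                ; 1#-homo = via (1#-homo τ)
                }
              ; -‿homo = λ x → via (trans (-‿homo τ _) (-‿cong (to-from x)))
              }
            ; injective = λ {x} {y} eq → begin
                x               ≈⟨ to-from x ⟨
                to τ (from x)   ≈⟨ ⟦⟧-cong τ eq ⟩
                to τ (from y)   ≈⟨ to-from y ⟩
                y               ∎
            }
          ; surjective = λ y → to τ y , λ eq → via (sym eq)
          }
        ; fixes = λ x x∈L → via (fixes τ x x∈L)
        }

      invertˡ : compose invert τ ≋ identity
      invertˡ x = via refl

      invertʳ : compose τ invert ≋ identity
      invertʳ = to-from

    invert-cong : ∀ τ τ′ → τ ≋ τ′ → invert τ ≋ invert τ′
    invert-cong τ τ′ τ≋τ′ x = injective τ (begin
      to τ (to (invert τ) x)    ≈⟨ invertʳ τ x ⟩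
      x                         ≈⟨ invertʳ τ′ x ⟨
      to τ′ (to (invert τ′) x)  ≈⟨ τ≋τ′ _ ⟨
      to τ (to (invert τ′) x)   ∎)

  Gal : Pred Carrier 0ℓ → Group 0ℓ 0ℓ
  Gal L = record
    { Carrier = Automorphism L
    ; _≈_     = λ τ τ′ → ∀ x → Automorphism.to τ x ≈ Automorphism.to τ′ x
    ; _∙_     = compose
    ; ε       = identity
    ; _⁻¹     = invert
    ; isGroup = record
      { isMonoid = record
        { isSemigroup = record
          { isMagma = record
            { isEquivalence = record
              { refl  = λ _ → refl
              ; sym   = λ eq x → sym (eq x)
              ; trans = λ eq eq′ x → trans (eq x) (eq′ x)
              }
            ; ∙-cong = λ {τ} eq eq′ x →
                trans (Automorphism.⟦⟧-cong τ (eq′ x)) (eq _)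
            }
          ; assoc = λ _ _ _ _ → refl
          }
        ; identity = (λ _ _ → refl) , (λ _ _ → refl)
        }
      ; inverse = invertˡ , invertʳ
      ; ⁻¹-cong = λ {τ} {τ′} → invert-cong τ τ′
      }
    }

  -- The norm from K to L, for K/L finite Galois, as the product of the
  -- conjugates.  Commutativity makes it independent of the enumeration.
  norm : (L : Pred Carrier 0ℓ) → Finite (Group.setoid (Gal L)) → Carrier → Carrier
  norm L fin x = product (λ i → Automorphism.to (Inverse.to enumeration i) x)
    where open Finite fin

module _ {F : Field} (E : Extension F) where
  open Extension E
  open FieldOps K
  private module F = FieldOps F

  Base : Pred Carrier 0ℓ
  Base x = ∃[ a ] ι a ≈ x

  -- d is the F-dimension of the subspace L of K.
  HasDegree : Pred Carrier 0ℓ → ℕ → Set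
  HasDegree L d =
    Σ[ b ∈ (Fin d → Carrier) ]
      (∀ i → b i ∈ L) ×
      (∀ x → x ∈ L → ∃[ a ] combination a b ≈ x) ×
      (∀ a → combination a b ≈ 0# → ∀ i → a i F.≈ F.0#)
    where
    combination : (Fin d → F.Carrier) → (Fin d → Carrier) → Carrier
    combination a b = sum (λ i → ι (a i) * b i)

  record IsCyclicGalois (d : ℕ) : Set where
    field
      degree     : HasDegree U d
      fixedField : ∀ x → (∀ (τ : Automorphism K Base) → Automorphism.to τ x ≈ x) → x ∈ Base
      finite     : Finite (Group.setoid (Gal K Base))
      cyclic     : IsCyclic (Gal K Base)

  record IntermediateField : Set₁ where
    field
      L         : Pred Carrier 0ℓ
      resp      : ∀ {x y} → x ≈ y → x ∈ L → y ∈ L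
      base⊆     : ∀ a → ι a ∈ L
      +-closed  : ∀ {x y} → x ∈ L → y ∈ L → x + y ∈ L
      -‿closed  : ∀ {x} → x ∈ L → - x ∈ L
      *-closed  : ∀ {x y} → x ∈ L → y ∈ L → x * y ∈ L
      ⁻¹-closed : ∀ {x y} → x ∈ L → x * y ≈ 1# → y ∈ L

  -- The fields K₀, …, Kₙ.  When E is cyclic Galois of degree pⁿ, the Galois
  -- correspondence makes each of them the only intermediate field of its degree.
  record Tower (p n : ℕ) : Set₁ where
    field
      intermediate : Fin (suc n) → IntermediateField

    ⟦_⟧ : Fin (suc n) → Pred Carrier 0ℓ
    ⟦ i ⟧ = IntermediateField.L (intermediate i)

    field
      degree : ∀ i → HasDegree ⟦ i ⟧ (p ℕ.^ toℕ i)
      finite : ∀ i → Finite (Group.setoid (Gal K ⟦ i ⟧))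

  IsNormTo : (L : Pred Carrier 0ℓ) → Finite (Group.setoid (Gal K L)) → F.Carrier → Set
  IsNormTo L fin a = ∃[ x ] (x # 0#) × (norm K L fin x ≈ ι a)

IsMinimum : ∀ {k} → Pred (Fin k) 0ℓ → Fin k → Set
IsMinimum P s = (s ∈ P) × (∀ s′ → s′ ∈ P → toℕ s ℕ.≤ toℕ s′)

-- The graph of m: InvariantIs E galois tower ξ v says m(K/F) = v.
module _ {F : Field} (E : Extension F) {p n : ℕ}
         (galois : IsCyclicGalois E (p ℕ.^ n)) (tower : Tower E p n)
         (ξ : FieldOps.Carrier F) where

  NormToBase : Set
  NormToBase = IsNormTo E (Base E) (IsCyclicGalois.finite galois) ξ

  NormToLevel : Pred (Fin (suc n)) 0ℓ
  NormToLevel s = IsNormTo E (Tower.⟦_⟧ tower s) (Tower.finite tower s) ξ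

  InvariantIs : ℤ ₋ → Set
  InvariantIs ⊥₋    = NormToBase
  InvariantIs [ v ] =
    (¬ NormToBase) ×
    (∃[ s ] IsMinimum NormToLevel s × v ≡ + toℕ s ℤ.- + 1)

{-# OPTIONS --safe #-}

-- Let A = R[Y₀, …, Y_{q−1}] with q = pᵗ, R = ℤ[ζ], ζ a primitive p^(n−t)-th root
-- of unity, let σ permute the variables cyclically except that one of them also
-- picks up the factor ζ, and let K = Frac A, F = K^σ.  Then σ^q multiplies each
-- variable by ζ, so σ has order pⁿ, and K_s is the field fixed by σ^(pˢ).  The
-- norm of ζ from K to K_{t+1} is ζ^(p^(n−t−1)) = ξ.  If ξ were the norm of f/g
-- from K to K_t, comparing leading coefficients would give c^(p^(n−t)) =
-- ξ c′^(p^(n−t)) with c, c′ ≠ 0 in R, which ramification at p excludes.  Hence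
-- m(K/F) = t.  The value −∞ occurs for K over K_1 in the case t = 0.

module Submission where

open import Defs
open import Algebra.Bundles using (CommutativeMonoid; CommutativeRing; Group)
import Algebra.Morphism.Construct.Composition as Composition
import Algebra.Morphism.Construct.Identity as Identity
open import Algebra.Morphism.Structures using (IsRingHomomorphism)
import Algebra.Properties.CommutativeMonoid.Sum
import Algebra.Properties.CommutativeSemiring.Binomial
import Algebra.Properties.Monoid.Mult
import Algebra.Properties.Semiring.Exp
import Algebra.Properties.Semiring.Mult
import Algebra.Properties.Semiring.Sum
import Algebra.Solver.Ring
open import Algebra.Solver.Ring.AlmostCommutativeRing
  using (fromCommutativeRing; _-Raw-AlmostCommutative⟶_)
open import Data.Bool.Base using (if_then_else_)
open import Data.Empty using (⊥)
open import Data.Fin.Base as Fin using (Fin; fromℕ; inject₁; suc; toℕ; zero)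
import Data.Fin.Properties as Fin
open import Data.Integer.Base as ℤ using (ℤ; +_; -[1+_])
import Data.Integer.Divisibility.Signed as ℤ
import Data.Integer.Properties as ℤ
open import Data.List.Base as List using (List; []; _∷_; _++_; length)
open import Data.List.Relation.Unary.All as All using (All; []; _∷_)
import Data.List.Relation.Unary.All.Properties as All
open import Data.Maybe.Base using (Maybe; just; map; nothing)
open import Data.Nat.Base as ℕ using (ℕ; suc; zero; _%_; _/_; _!; _∸_)
open import Data.Nat.Combinatorics using (_C_; k![n∸k]!∣n!; nCk≡n!/k![n-k]!; nCn≡1)
open import Data.Nat.Coprimality using (Coprime; coprime-divisor)
open import Data.Nat.Divisibility
  using (_∣_; _∣?_; _∣0; %-presˡ-∣; divides; m∣m*n; ∣-refl; ∣1⇒≡1; ∣m+n∣m⇒∣n; ∣m∣n⇒∣m+n; ∣n∣m%n⇒∣m; ∣⇒≤)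
open import Data.Nat.DivMod as ℕ
  using (%-distribˡ-+; [m+kn]%n≡m%n; m%[n*o]/o≡m/o%n; m%n%n≡m%n; m%n<n; m*n%n≡0; m/n*n≡m; m<n⇒m%n≡m; m≡m%n+[m/n]*n; n%n≡0)
open import Data.Nat.GCD using (gcd; gcd-GCD; gcd[m,n]∣m; gcd[m,n]∣n; module Bézout)
open import Data.Nat.GeneralisedArithmetic using (fold; fold-+)
open import Data.Nat.Primality
  using (Prime; euclidsLemma; prime⇒irreducible; prime⇒nonTrivial; prime⇒nonZero; ¬prime[0]; ¬prime[1])
import Data.Nat.Properties as ℕ
open import Data.Product.Base using (Σ-syntax; _×_; _,_; proj₁; proj₂; ∃-syntax)
open import Data.Sum.Base as Sum using (_⊎_; inj₁; inj₂)
open import Data.Unit.Base using (tt)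
open import Function.Base using (const; id; _on_; _∘_)
open import Function.Bundles using (Equivalence; Inverse)
open import Level using (0ℓ)
open import Relation.Binary.Core using (Rel)
import Relation.Binary.Construct.On as On
open import Relation.Binary.Definitions using (Transitive; Tri; Trichotomous; tri<; tri≈; tri>)
open import Relation.Binary.PropositionalEquality as ≡ using (_≡_; module ≡-Reasoning)
import Relation.Binary.Reasoning.Setoid
open import Relation.Binary.Structures using (IsEquivalence; IsStrictTotalOrder)
open import Relation.Binary.Structures.Biased using (isStrictTotalOrderᶜ)
open import Relation.Nullary.Construct.Add.Infimum using (_₋; [_]; ⊥₋)
open import Relation.Nullary.Decidable using (Dec; decidable-stable; map′; no; yes; ⌊_⌋)
open import Relation.Nullary.Negation using (contradiction; ¬_)
open import Relation.Unary using (Pred; _∈_)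

-- The arithmetic of ℤ[ζ] is obtained without irreducibility of the cyclotomic polynomial. In
-- ℤ[x]/(xᴸ - 1), L = p^(n-t), two elements are identified when x^(L/p) - 1 multiplies them to the
-- same element, and divisibility by ζ - 1 is read off from the sum of the coefficients modulo p.
-- That the quotient is a domain then follows from the (ζ - 1)-adic valuation. Equality stays
-- decidable at every stage: apartness in the fields is denial of equality, and the Galois groups
-- have to be enumerated. Galois theory rests on one element per level whose orbit under σ has
-- exactly pˢ elements; interpolation at its conjugates yields both a basis of K_s over F and the
-- fact that automorphisms are powers of σ. The comparison of leading coefficients works because
-- σ^(iq) only rescales monomials, by a power of ζ that depends on the total degree. An equation
-- N(f) = ξ N(g) forces equal leading exponents in f and g, so these powers are the same on both
-- sides and cancel.

-- Ring solver with integer coefficients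

module IntegerCoefficients (R : CommutativeRing 0ℓ 0ℓ) where
  open CommutativeRing R
  open import Algebra.Properties.Ring ring
  open import Algebra.Properties.AbelianGroup +-abelianGroup using (⁻¹-∙-comm)
  open import Algebra.Properties.Semiring.Mult semiring renaming (_×_ to _·_)
  open import Relation.Binary.Reasoning.Setoid setoid

  -- `fromℤ (+ 1)` is `1# + 0#` rather than `1#`, so solver calls treat `1#` as a variable or
  -- convert it first.
  fromℤ : ℤ → Carrier
  fromℤ (+ n)    = n · 1#
  fromℤ -[1+ n ] = - (suc n · 1#)

  fromℤ-⊖ : ∀ m n → fromℤ (m ℤ.⊖ n) ≈ m · 1# - n · 1#
  fromℤ-⊖ m       zero    = sym (trans (+-congˡ -0#≈0#) (+-identityʳ _))
  fromℤ-⊖ zero    (suc n) = sym (+-identityˡ _)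
  fromℤ-⊖ (suc m) (suc n) = begin
    fromℤ (suc m ℤ.⊖ suc n)            ≡⟨ ≡.cong fromℤ (ℤ.[1+m]⊖[1+n]≡m⊖n m n) ⟩
    fromℤ (m ℤ.⊖ n)                    ≈⟨ fromℤ-⊖ m n ⟩
    m · 1# - n · 1#                    ≈⟨ +-identityˡ _ ⟨
    0# + (m · 1# - n · 1#)             ≈⟨ +-congʳ (-‿inverseʳ 1#) ⟨
    (1# - 1#) + (m · 1# - n · 1#)      ≈⟨ +-assoc _ _ _ ⟩
    1# + (- 1# + (m · 1# - n · 1#))    ≈⟨ +-congˡ (+-assoc _ _ _) ⟨
    1# + ((- 1# + m · 1#) - n · 1#)    ≈⟨ +-congˡ (+-congʳ (+-comm _ _)) ⟩
    1# + ((m · 1# - 1#) - n · 1#)      ≈⟨ +-congˡ (+-assoc _ _ _) ⟩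
    1# + (m · 1# + (- 1# - n · 1#))    ≈⟨ +-assoc _ _ _ ⟨
    (1# + m · 1#) + (- 1# - n · 1#)    ≈⟨ +-congˡ (⁻¹-∙-comm _ _) ⟩
    (1# + m · 1#) - (1# + n · 1#)      ∎

  fromℤ-‿ : ∀ i → fromℤ (ℤ.- i) ≈ - fromℤ i
  fromℤ-‿ (+ zero)  = sym -0#≈0#
  fromℤ-‿ (+ suc n) = refl
  fromℤ-‿ -[1+ n ]  = sym (-‿involutive _)

  fromℤ-+ : ∀ i j → fromℤ (i ℤ.+ j) ≈ fromℤ i + fromℤ j
  fromℤ-+ (+ m)    (+ n)    = ×-homo-+ 1# m n
  fromℤ-+ (+ m)    -[1+ n ] = fromℤ-⊖ m (suc n)
  fromℤ-+ -[1+ m ] (+ n)    = trans (fromℤ-⊖ n (suc m)) (+-comm _ _)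
  fromℤ-+ -[1+ m ] -[1+ n ] = begin
    - (suc (suc (m ℕ.+ n)) · 1#)     ≡⟨ ≡.cong (λ k → - (k · 1#)) (ℕ.+-suc (suc m) n) ⟨
    - ((suc m ℕ.+ suc n) · 1#)       ≈⟨ -‿cong (×-homo-+ 1# (suc m) (suc n)) ⟩
    - (suc m · 1# + suc n · 1#)      ≈⟨ ⁻¹-∙-comm _ _ ⟨
    - (suc m · 1#) - suc n · 1#      ∎

  fromℤ-pos-* : ∀ m j → fromℤ (+ m ℤ.* j) ≈ m · 1# * fromℤ j
  fromℤ-pos-* m (+ n)    = trans (reflexive (≡.cong fromℤ (≡.sym (ℤ.pos-* m n)))) (×1-homo-* m n)
  fromℤ-pos-* m -[1+ n ] = begin
    fromℤ (+ m ℤ.* -[1+ n ])        ≡⟨ ≡.cong fromℤ (ℤ.neg-distribʳ-* (+ m) (+ suc n)) ⟨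
    fromℤ (ℤ.- (+ m ℤ.* + suc n))   ≈⟨ fromℤ-‿ (+ m ℤ.* + suc n) ⟩
    - fromℤ (+ m ℤ.* + suc n)       ≈⟨ -‿cong (fromℤ-pos-* m (+ suc n)) ⟩
    - (m · 1# * suc n · 1#)         ≈⟨ -‿distribʳ-* _ _ ⟩
    m · 1# * - (suc n · 1#)         ∎

  fromℤ-* : ∀ i j → fromℤ (i ℤ.* j) ≈ fromℤ i * fromℤ j
  fromℤ-* (+ m)    j = fromℤ-pos-* m j
  fromℤ-* -[1+ m ] j = begin
    fromℤ (-[1+ m ] ℤ.* j)         ≡⟨ ≡.cong fromℤ (ℤ.neg-distribˡ-* (+ suc m) j) ⟨
    fromℤ (ℤ.- (+ suc m ℤ.* j))    ≈⟨ fromℤ-‿ (+ suc m ℤ.* j) ⟩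
    - fromℤ (+ suc m ℤ.* j)        ≈⟨ -‿cong (fromℤ-pos-* (suc m) j) ⟩
    - (suc m · 1# * fromℤ j)       ≈⟨ -‿distribˡ-* _ _ ⟩
    - (suc m · 1#) * fromℤ j       ∎

  private
    morphism : ℤ.+-*-rawRing -Raw-AlmostCommutative⟶ fromCommutativeRing R
    morphism = record
      { ⟦_⟧    = fromℤ
      ; +-homo = fromℤ-+
      ; *-homo = fromℤ-*
      ; -‿homo = fromℤ-‿
      ; 0-homo = refl
      ; 1-homo = +-identityʳ 1#
      }

    -- Distinct integers may have equal images in R, so a negative answer carries no information and
    -- becomes `nothing`.
    _coeff≟_ : ∀ i j → Maybe (fromℤ i ≈ fromℤ j)
    i coeff≟ j with i ℤ.≟ j
    ... | yes eq = just (reflexive (≡.cong fromℤ eq))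
    ... | no  _  = nothing

  open Algebra.Solver.Ring ℤ.+-*-rawRing (fromCommutativeRing R) morphism _coeff≟_ public
    using (solve; _:=_; _:+_; _:*_; _:-_; :-_; con)

-- Monoid algebras

-- Finite formal sums ∑ cᵢ gᵢ are lists of pairs (cᵢ , gᵢ).  Two of them are
-- equal when every functional g ↦ φ(g), extended linearly, agrees on them:
-- with this equality the ring laws reduce to exchanging two finite sums.
module MonoidAlgebra (R : CommutativeRing 0ℓ 0ℓ) (G : CommutativeMonoid 0ℓ 0ℓ) where
  open CommutativeRing R
  private module G = CommutativeMonoid G
  open import Algebra.Properties.Ring ring using (-‿distribˡ-*; -0#≈0#)
  open import Algebra.Properties.AbelianGroup +-abelianGroup using (⁻¹-∙-comm)
  open import Relation.Binary.Reasoning.Setoid setoid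
  open IntegerCoefficients R

  FormalSum : Set
  FormalSum = List (Carrier × G.Carrier)

  Respects : (G.Carrier → Carrier) → Set
  Respects φ = ∀ {x y} → x G.≈ y → φ x ≈ φ y

  ⟨_,_⟩ : FormalSum → (G.Carrier → Carrier) → Carrier
  ⟨ []          , φ ⟩ = 0#
  ⟨ (c , g) ∷ f , φ ⟩ = c * φ g + ⟨ f , φ ⟩

  infix 4 _≋_

  record _≋_ (f g : FormalSum) : Set where
    constructor mk≋
    field
      pairing : ∀ φ → Respects φ → ⟨ f , φ ⟩ ≈ ⟨ g , φ ⟩

  open _≋_ public

  infixl 7 _⊛_
  infixr 8 _⋆_

  negate : FormalSum → FormalSum
  negate = List.map λ (c , g) → - c , g

  _⋆_ : Carrier × G.Carrier → FormalSum → FormalSum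
  (c , g) ⋆ f = List.map (λ (d , h) → c * d , g G.∙ h) f

  _⊛_ : FormalSum → FormalSum → FormalSum
  []      ⊛ g = []
  (m ∷ f) ⊛ g = m ⋆ g ++ f ⊛ g

  one : FormalSum
  one = (1# , G.ε) ∷ []

  pairing-cong : ∀ f {φ ψ} → (∀ g → φ g ≈ ψ g) → ⟨ f , φ ⟩ ≈ ⟨ f , ψ ⟩
  pairing-cong []            φ≈ψ = refl
  pairing-cong ((c , g) ∷ f) φ≈ψ = +-cong (*-congˡ (φ≈ψ g)) (pairing-cong f φ≈ψ)

  pairing-++ : ∀ f g {φ} → ⟨ f ++ g , φ ⟩ ≈ ⟨ f , φ ⟩ + ⟨ g , φ ⟩
  pairing-++ []      g = sym (+-identityˡ _)
  pairing-++ (_ ∷ f) g = trans (+-congˡ (pairing-++ f g)) (sym (+-assoc _ _ _))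

  pairing-negate : ∀ f {φ} → ⟨ negate f , φ ⟩ ≈ - ⟨ f , φ ⟩
  pairing-negate []            = sym -0#≈0#
  pairing-negate ((c , g) ∷ f) =
    trans (+-cong (sym (-‿distribˡ-* _ _)) (pairing-negate f)) (⁻¹-∙-comm _ _)

  pairing-⋆ : ∀ c g f {φ} → ⟨ (c , g) ⋆ f , φ ⟩ ≈ c * ⟨ f , (λ h → φ (g G.∙ h)) ⟩
  pairing-⋆ c g []            = sym (zeroʳ c)
  pairing-⋆ c g ((d , h) ∷ f) =
    trans (+-cong (*-assoc _ _ _) (pairing-⋆ c g f)) (sym (distribˡ _ _ _))

  pairing-⊛ : ∀ f g {φ} → ⟨ f ⊛ g , φ ⟩ ≈ ⟨ f , (λ x → ⟨ g , (λ y → φ (x G.∙ y)) ⟩) ⟩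
  pairing-⊛ []            g = refl
  pairing-⊛ ((c , x) ∷ f) g =
    trans (pairing-++ ((c , x) ⋆ g) (f ⊛ g)) (+-cong (pairing-⋆ c x g) (pairing-⊛ f g))

  pairing-zero : ∀ f → ⟨ f , const 0# ⟩ ≈ 0#
  pairing-zero []            = refl
  pairing-zero ((c , g) ∷ f) = trans (+-cong (zeroʳ c) (pairing-zero f)) (+-identityʳ 0#)

  pairing-+ : ∀ f {φ ψ} → ⟨ f , (λ g → φ g + ψ g) ⟩ ≈ ⟨ f , φ ⟩ + ⟨ f , ψ ⟩
  pairing-+ []            = sym (+-identityʳ 0#)
  pairing-+ ((c , g) ∷ f) {φ} {ψ} = begin
    c * (φ g + ψ g) + ⟨ f , (λ g → φ g + ψ g) ⟩    ≈⟨ +-congˡ (pairing-+ f) ⟩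
    c * (φ g + ψ g) + (⟨ f , φ ⟩ + ⟨ f , ψ ⟩)      ≈⟨ solve 5 (λ c x y u v → c :* (x :+ y) :+ (u :+ v) := (c :* x :+ u) :+ (c :* y :+ v)) refl c (φ g) (ψ g) ⟨ f , φ ⟩ ⟨ f , ψ ⟩ ⟩
    (c * φ g + ⟨ f , φ ⟩) + (c * ψ g + ⟨ f , ψ ⟩)  ∎

  pairing-* : ∀ f {φ} c → ⟨ f , (λ g → c * φ g) ⟩ ≈ c * ⟨ f , φ ⟩
  pairing-* []            c = sym (zeroʳ c)
  pairing-* ((d , g) ∷ f) {φ} c = begin
    d * (c * φ g) + ⟨ f , (λ g → c * φ g) ⟩  ≈⟨ +-congˡ (pairing-* f c) ⟩
    d * (c * φ g) + c * ⟨ f , φ ⟩            ≈⟨ solve 4 (λ c d x u → d :* (c :* x) :+ c :* u := c :* (d :* x :+ u)) refl c d (φ g) ⟨ f , φ ⟩ ⟩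
    c * (d * φ g + ⟨ f , φ ⟩)                ∎

  pairing-swap : ∀ f g {Φ : G.Carrier → G.Carrier → Carrier} →
    ⟨ f , (λ x → ⟨ g , Φ x ⟩) ⟩ ≈ ⟨ g , (λ y → ⟨ f , (λ x → Φ x y) ⟩) ⟩
  pairing-swap []            g = sym (pairing-zero g)
  pairing-swap ((c , x) ∷ f) g = begin
    c * ⟨ g , _ ⟩ + ⟨ f , _ ⟩  ≈⟨ +-cong (pairing-* g c) (sym (pairing-swap f g)) ⟨
    ⟨ g , _ ⟩ + ⟨ g , _ ⟩      ≈⟨ pairing-+ g ⟨
    ⟨ g , _ ⟩                  ∎

  ≋-refl : ∀ {f} → f ≋ f
  ≋-refl = mk≋ λ _ _ → refl

  ≋-sym : ∀ {f g} → f ≋ g → g ≋ f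
  ≋-sym f≋g = mk≋ λ φ resp → sym (pairing f≋g φ resp)

  ≋-trans : ∀ {f g h} → f ≋ g → g ≋ h → f ≋ h
  ≋-trans f≋g g≋h = mk≋ λ φ resp → trans (pairing f≋g φ resp) (pairing g≋h φ resp)

  ++-cong : ∀ {f f′ g g′} → f ≋ f′ → g ≋ g′ → f ++ g ≋ f′ ++ g′
  ++-cong {f} {f′} {g} {g′} f≋f′ g≋g′ = mk≋ λ φ resp → begin
    ⟨ f ++ g , φ ⟩            ≈⟨ pairing-++ f g ⟩
    ⟨ f , φ ⟩ + ⟨ g , φ ⟩     ≈⟨ +-cong (pairing f≋f′ φ resp) (pairing g≋g′ φ resp) ⟩
    ⟨ f′ , φ ⟩ + ⟨ g′ , φ ⟩   ≈⟨ pairing-++ f′ g′ ⟨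
    ⟨ f′ ++ g′ , φ ⟩          ∎

  ++-comm : ∀ f g → f ++ g ≋ g ++ f
  ++-comm f g = mk≋ λ φ resp →
    trans (pairing-++ f g) (trans (+-comm _ _) (sym (pairing-++ g f)))

  negate-cong : ∀ {f g} → f ≋ g → negate f ≋ negate g
  negate-cong {f} {g} f≋g = mk≋ λ φ resp →
    trans (pairing-negate f) (trans (-‿cong (pairing f≋g φ resp)) (sym (pairing-negate g)))

  ++-inverseˡ : ∀ f → negate f ++ f ≋ []
  ++-inverseˡ f = mk≋ λ φ _ →
    trans (pairing-++ (negate f) f) (trans (+-congʳ (pairing-negate f)) (-‿inverseˡ _))

  ⊛-comm : ∀ f g → f ⊛ g ≋ g ⊛ f
  ⊛-comm f g = mk≋ λ φ resp → begin
    ⟨ f ⊛ g , φ ⟩                                 ≈⟨ pairing-⊛ f g ⟩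
    ⟨ f , (λ x → ⟨ g , (λ y → φ (x G.∙ y)) ⟩) ⟩   ≈⟨ pairing-swap f g ⟩
    ⟨ g , (λ y → ⟨ f , (λ x → φ (x G.∙ y)) ⟩) ⟩   ≈⟨ pairing-cong g (λ y → pairing-cong f λ x → resp (G.comm x y)) ⟩
    ⟨ g , (λ y → ⟨ f , (λ x → φ (y G.∙ x)) ⟩) ⟩   ≈⟨ pairing-⊛ g f ⟨
    ⟨ g ⊛ f , φ ⟩                                 ∎

  -- Pairing `f ⊛ h` with φ is pairing f with x ↦ ⟨ h , y ↦ φ (x ∙ y) ⟩, again an admissible
  -- functional, so f ≋ g applies to it. Congruence in the other factor follows by commutativity.
  ⊛-congʳ : ∀ h {f g} → f ≋ g → f ⊛ h ≋ g ⊛ h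
  ⊛-congʳ h {f} {g} f≋g = mk≋ λ φ resp →
    trans (pairing-⊛ f h)
      (trans (pairing f≋g _ λ x≈y → pairing-cong h λ z → resp (G.∙-congʳ x≈y))
        (sym (pairing-⊛ g h)))

  ⊛-cong : ∀ {f f′ g g′} → f ≋ f′ → g ≋ g′ → f ⊛ g ≋ f′ ⊛ g′
  ⊛-cong {f} {f′} {g} {g′} f≋f′ g≋g′ =
    ≋-trans (⊛-congʳ g f≋f′) (≋-trans (⊛-comm f′ g) (≋-trans (⊛-congʳ f′ g≋g′) (⊛-comm g′ f′)))

  ⊛-assoc : ∀ f g h → (f ⊛ g) ⊛ h ≋ f ⊛ (g ⊛ h)
  ⊛-assoc f g h = mk≋ λ φ resp → begin
    ⟨ (f ⊛ g) ⊛ h , φ ⟩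
      ≈⟨ trans (pairing-⊛ (f ⊛ g) h) (pairing-⊛ f g) ⟩
    ⟨ f , (λ x → ⟨ g , (λ y → ⟨ h , (λ z → φ ((x G.∙ y) G.∙ z)) ⟩) ⟩) ⟩
      ≈⟨ pairing-cong f (λ x → pairing-cong g λ y → pairing-cong h λ z → resp (G.assoc x y z)) ⟩
    ⟨ f , (λ x → ⟨ g , (λ y → ⟨ h , (λ z → φ (x G.∙ (y G.∙ z))) ⟩) ⟩) ⟩
      ≈⟨ trans (pairing-⊛ f (g ⊛ h)) (pairing-cong f λ x → pairing-⊛ g h) ⟨
    ⟨ f ⊛ (g ⊛ h) , φ ⟩ ∎

  one-⊛ : ∀ f → one ⊛ f ≋ f
  one-⊛ f = mk≋ λ φ resp → begin
    ⟨ one ⊛ f , φ ⟩                           ≈⟨ pairing-⊛ one f ⟩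
    1# * ⟨ f , (λ y → φ (G.ε G.∙ y)) ⟩ + 0#   ≈⟨ trans (+-identityʳ _) (*-identityˡ _) ⟩
    ⟨ f , (λ y → φ (G.ε G.∙ y)) ⟩             ≈⟨ pairing-cong f (λ y → resp (G.identityˡ y)) ⟩
    ⟨ f , φ ⟩                                 ∎

  ⊛-distribʳ : ∀ h f g → (f ++ g) ⊛ h ≋ f ⊛ h ++ g ⊛ h
  ⊛-distribʳ h f g = mk≋ λ φ resp → begin
    ⟨ (f ++ g) ⊛ h , φ ⟩         ≈⟨ pairing-⊛ (f ++ g) h ⟩
    ⟨ f ++ g , _ ⟩               ≈⟨ pairing-++ f g ⟩
    ⟨ f , _ ⟩ + ⟨ g , _ ⟩        ≈⟨ +-cong (pairing-⊛ f h) (pairing-⊛ g h) ⟨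
    ⟨ f ⊛ h , φ ⟩ + ⟨ g ⊛ h , φ ⟩ ≈⟨ pairing-++ (f ⊛ h) (g ⊛ h) ⟨
    ⟨ f ⊛ h ++ g ⊛ h , φ ⟩       ∎

  algebra : CommutativeRing 0ℓ 0ℓ
  algebra = record
    { Carrier = FormalSum
    ; _≈_ = _≋_
    ; _+_ = _++_
    ; _*_ = _⊛_
    ; -_  = negate
    ; 0#  = []
    ; 1#  = one
    ; isCommutativeRing = record
      { isRing = record
        { +-isAbelianGroup = record
          { isGroup = record
            { isMonoid = record
              { isSemigroup = record
                { isMagma = record
                  { isEquivalence = record { refl = ≋-refl ; sym = ≋-sym ; trans = ≋-trans }
                  ; ∙-cong = ++-cong
                  }
                ; assoc = λ f g h → mk≋ λ φ resp → begin
                    ⟨ (f ++ g) ++ h , φ ⟩                  ≈⟨ trans (pairing-++ (f ++ g) h) (+-congʳ (pairing-++ f g)) ⟩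
                    (⟨ f , φ ⟩ + ⟨ g , φ ⟩) + ⟨ h , φ ⟩    ≈⟨ +-assoc _ _ _ ⟩
                    ⟨ f , φ ⟩ + (⟨ g , φ ⟩ + ⟨ h , φ ⟩)    ≈⟨ trans (pairing-++ f (g ++ h)) (+-congˡ (pairing-++ g h)) ⟨
                    ⟨ f ++ (g ++ h) , φ ⟩                  ∎
                }
              ; identity = (λ _ → ≋-refl) , (λ f → ++-comm f [])
              }
            ; inverse = ++-inverseˡ , (λ f → ≋-trans (++-comm f (negate f)) (++-inverseˡ f))
            ; ⁻¹-cong = negate-cong
            }
          ; comm = ++-comm
          }
        ; *-cong = ⊛-cong
        ; *-assoc = ⊛-assoc
        ; *-identity = one-⊛ , (λ f → ≋-trans (⊛-comm f one) (one-⊛ f))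
        ; distrib =
            (λ h f g → ≋-trans (⊛-comm h (f ++ g))
              (≋-trans (⊛-distribʳ h f g) (++-cong (⊛-comm f h) (⊛-comm g h))))
          , ⊛-distribʳ
        }
      ; *-comm = ⊛-comm
      }
    }

-- Integral domains with a zero test; leading terms in monoid algebras

record IntegralDomain : Set₁ where
  field
    commutativeRing : CommutativeRing 0ℓ 0ℓ
  open CommutativeRing commutativeRing public
  field
    zero?    : ∀ x → Dec (x ≈ 0#)
    1≉0      : ¬ (1# ≈ 0#)
    integral : ∀ {x y} → x * y ≈ 0# → x ≈ 0# ⊎ y ≈ 0#

  open import Algebra.Properties.Ring ring public
    using (x∙y⁻¹≈ε⇒x≈y; x≈y⇒x∙y⁻¹≈ε; -‿distribˡ-*; -‿distribʳ-*)
  open import Algebra.Properties.Semiring.Exp semiring public using (_^_)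

  *-nonzero : ∀ {x y} → ¬ (x ≈ 0#) → ¬ (y ≈ 0#) → ¬ (x * y ≈ 0#)
  *-nonzero x≉0 y≉0 xy≈0 with integral xy≈0
  ... | inj₁ x≈0 = x≉0 x≈0
  ... | inj₂ y≈0 = y≉0 y≈0

  ^-nonzero : ∀ {x} n → ¬ (x ≈ 0#) → ¬ (x ^ n ≈ 0#)
  ^-nonzero zero    x≉0 = 1≉0
  ^-nonzero (suc n) x≉0 = *-nonzero x≉0 (^-nonzero n x≉0)

  *-cancelˡ : ∀ {x y z} → ¬ (x ≈ 0#) → x * y ≈ x * z → y ≈ z
  *-cancelˡ {x} {y} {z} x≉0 xy≈xz with integral x[y-z]≈0
    where
    x[y-z]≈0 : x * (y - z) ≈ 0#
    x[y-z]≈0 = trans (distribˡ x y (- z))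
      (trans (+-congˡ (sym (-‿distribʳ-* x z))) (x≈y⇒x∙y⁻¹≈ε xy≈xz))
  ... | inj₁ x≈0   = contradiction x≈0 x≉0
  ... | inj₂ y-z≈0 = x∙y⁻¹≈ε⇒x≈y y z y-z≈0

  *-cancelʳ : ∀ {x y z} → ¬ (x ≈ 0#) → y * x ≈ z * x → y ≈ z
  *-cancelʳ x≉0 yx≈zx = *-cancelˡ x≉0 (trans (*-comm _ _) (trans yx≈zx (*-comm _ _)))

  _≟_ : ∀ x y → Dec (x ≈ y)
  x ≟ y with zero? (x - y)
  ... | yes x-y≈0 = yes (x∙y⁻¹≈ε⇒x≈y x y x-y≈0)
  ... | no  x-y≉0 = no (x-y≉0 ∘ x≈y⇒x∙y⁻¹≈ε)

module LeadingTerms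
  (D : IntegralDomain) (G : CommutativeMonoid 0ℓ 0ℓ)
  (_<_ : Rel (CommutativeMonoid.Carrier G) 0ℓ)
  (isStrictTotalOrder : IsStrictTotalOrder (CommutativeMonoid._≈_ G) _<_)
  where

  open CommutativeMonoid G using (_∙_) renaming (Carrier to Index; _≈_ to _≈ᴳ_)

  open IntegralDomain D hiding (zero; _≟_)
  private module G = CommutativeMonoid G
  open IsStrictTotalOrder isStrictTotalOrder
    using (compare; _≟_; <-respˡ-≈; <-respʳ-≈; irrefl) renaming (trans to <-trans)
  open MonoidAlgebra commutativeRing G
  open IntegerCoefficients commutativeRing
  open import Relation.Binary.Reasoning.Setoid setoid

  -- Pairing with `δ e` reads off the coefficient of e. As `≋` is tested on all functionals,
  -- coefficients are thereby invariant under `≋`.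
  δ : Index → Index → Carrier
  δ e g = if ⌊ e ≟ g ⌋ then 1# else 0#

  δ-≈ : ∀ {e g} → e ≈ᴳ g → δ e g ≈ 1#
  δ-≈ {e} {g} e≈g with e ≟ g
  ... | yes _   = refl
  ... | no  e≉g = contradiction e≈g e≉g

  δ-≉ : ∀ {e g} → ¬ (e ≈ᴳ g) → δ e g ≈ 0#
  δ-≉ {e} {g} e≉g with e ≟ g
  ... | yes e≈g = contradiction e≈g e≉g
  ... | no  _   = refl

  δ-resp : ∀ e → Respects (δ e)
  δ-resp e {x} {y} x≈y with e ≟ x
  ... | yes e≈x = sym (δ-≈ (G.trans e≈x x≈y))
  ... | no  e≉x = sym (δ-≉ λ e≈y → e≉x (G.trans e≈y (G.sym x≈y)))

  Below : Index → FormalSum → Set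
  Below e = All (λ (_ , g) → g < e)

  pairing-δ-below : ∀ {e f} → Below e f → ⟨ f , δ e ⟩ ≈ 0#
  pairing-δ-below []            = refl
  pairing-δ-below {e} {(c , g) ∷ f} (g<e ∷ below) = begin
    c * δ e g + ⟨ f , δ e ⟩  ≈⟨ +-cong (*-congˡ (δ-≉ λ e≈g → irrefl (G.sym e≈g) g<e)) (pairing-δ-below below) ⟩
    c * 0# + 0#              ≈⟨ trans (+-identityʳ _) (zeroʳ c) ⟩
    0#                       ∎

  -- `rest` may still contain repeated or cancelling monomials; only the bound on its exponents
  -- matters.
  record Leading (f : FormalSum) (e : Index) (c : Carrier) : Set where
    field
      rest        : FormalSum
      expand      : f ≋ (c , e) ∷ rest
      below       : Below e rest
      nonzero     : ¬ (c ≈ 0#)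

    coefficient : ⟨ f , δ e ⟩ ≈ c
    coefficient = begin
      ⟨ f , δ e ⟩                    ≈⟨ pairing expand (δ e) (δ-resp e) ⟩
      c * δ e e + ⟨ rest , δ e ⟩     ≈⟨ +-cong (*-congˡ (δ-≈ G.refl)) (pairing-δ-below below) ⟩
      c * 1# + 0#                    ≈⟨ trans (+-identityʳ _) (*-identityʳ c) ⟩
      c                              ∎

    coefficient-above : ∀ {e′} → e < e′ → ⟨ f , δ e′ ⟩ ≈ 0#
    coefficient-above {e′} e<e′ = begin
      ⟨ f , δ e′ ⟩                   ≈⟨ pairing expand (δ e′) (δ-resp e′) ⟩
      ⟨ (c , e) ∷ rest , δ e′ ⟩      ≈⟨ pairing-δ-below (e<e′ ∷ All.map (λ g<e → <-trans g<e e<e′) below) ⟩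
      0#                             ∎

  open Leading

  leading-≉0 : ∀ {f e c} → Leading f e c → ¬ (f ≋ [])
  leading-≉0 {e = e} ℓ f≋0 = nonzero ℓ (trans (sym (coefficient ℓ)) (pairing f≋0 (δ e) (δ-resp e)))

  -- If the exponents differed, the coefficient at the larger one would be nonzero in one sum and
  -- zero in the other.
  leading-unique : ∀ {f g e e′ c c′} → Leading f e c → Leading g e′ c′ → f ≋ g → e ≈ᴳ e′ × c ≈ c′
  leading-unique {f} {g} {e} {e′} ℓ ℓ′ f≋g with compare e e′
  ... | tri< e<e′ _ _ = contradiction
    (trans (sym (coefficient ℓ′)) (trans (sym (pairing f≋g (δ e′) (δ-resp e′))) (coefficient-above ℓ e<e′)))
    (nonzero ℓ′)
  ... | tri> _ _ e′<e = contradiction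
    (trans (sym (coefficient ℓ)) (trans (pairing f≋g (δ e) (δ-resp e)) (coefficient-above ℓ′ e′<e)))
    (nonzero ℓ)
  ... | tri≈ _ e≈e′ _ = e≈e′ , (begin
    _             ≈⟨ coefficient ℓ ⟨
    ⟨ f , δ e ⟩   ≈⟨ pairing f≋g (δ e) (δ-resp e) ⟩
    ⟨ g , δ e ⟩   ≈⟨ pairing-cong g (λ x → δ-sym e≈e′ x) ⟩
    ⟨ g , δ e′ ⟩  ≈⟨ coefficient ℓ′ ⟩
    _             ∎)
    where
    δ-sym : ∀ {e e′} → e ≈ᴳ e′ → ∀ x → δ e x ≈ δ e′ x
    δ-sym {e} {e′} e≈e′ x with e ≟ x
    ... | yes e≈x = sym (δ-≈ (G.trans (G.sym e≈e′) e≈x))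
    ... | no  e≉x = sym (δ-≉ λ e′≈x → e≉x (G.trans e≈e′ e′≈x))

  leading-resp : ∀ {f g e c} → f ≋ g → Leading f e c → Leading g e c
  leading-resp f≋g ℓ = record
    { rest = rest ℓ ; expand = ≋-trans (≋-sym f≋g) (expand ℓ) ; below = below ℓ ; nonzero = nonzero ℓ }

  leading-singleton : ∀ {c e} → ¬ (c ≈ 0#) → Leading ((c , e) ∷ []) e c
  leading-singleton c≉0 = record { rest = [] ; expand = ≋-refl ; below = [] ; nonzero = c≉0 }

  -- Merging equal leading monomials may cancel them, after which the search
  -- continues in the remainder; the bounds on lengths make it terminate.
  zero-or-leading-within : ∀ k f → length f ℕ.≤ k →
    f ≋ [] ⊎ (∃[ e ] ∃[ c ] Σ[ ℓ ∈ Leading f e c ] length (rest ℓ) ℕ.< length f)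
  zero-or-leading-within _       []            _ = inj₁ ≋-refl
  zero-or-leading-within (suc k) ((c , g) ∷ f) (ℕ.s≤s |f|≤k) with zero? c
  ... | yes c≈0 = dropHead (zero-or-leading-within k f |f|≤k)
    where
    f≋cf : f ≋ (c , g) ∷ f
    f≋cf = mk≋ λ φ _ → sym (trans (+-congʳ (trans (*-congʳ c≈0) (zeroˡ _))) (+-identityˡ _))
    dropHead : f ≋ [] ⊎ (∃[ e ] ∃[ d ] Σ[ ℓ ∈ Leading f e d ] length (rest ℓ) ℕ.< length f) →
      (c , g) ∷ f ≋ [] ⊎ (∃[ e ] ∃[ d ] Σ[ ℓ ∈ Leading ((c , g) ∷ f) e d ] length (rest ℓ) ℕ.< suc (length f))
    dropHead (inj₁ f≋0)             = inj₁ (≋-trans (≋-sym f≋cf) f≋0)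
    dropHead (inj₂ (e , d , ℓ , b)) = inj₂ (e , d , leading-resp f≋cf ℓ , ℕ.m<n⇒m<1+n b)
  ... | no c≉0 = merge (zero-or-leading-within k f |f|≤k)
    where
    cf = (c , g) ∷ f
    Result = cf ≋ [] ⊎ (∃[ e ] ∃[ d ] Σ[ ℓ ∈ Leading cf e d ] length (rest ℓ) ℕ.< length cf)

    merge : f ≋ [] ⊎ (∃[ e ] ∃[ d ] Σ[ ℓ ∈ Leading f e d ] length (rest ℓ) ℕ.< length f) → Result
    merge (inj₁ f≋0) = inj₂ (g , c ,
      record { rest = [] ; expand = ++-cong (≋-refl {(c , g) ∷ []}) f≋0 ; below = [] ; nonzero = c≉0 } , ℕ.z<s)
    merge (inj₂ (e , d , ℓ , b)) with compare g e
    ... | tri< g<e _ _ = inj₂ (e , d ,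
      record
        { rest    = (c , g) ∷ rest ℓ
        ; expand  = ≋-trans (++-cong (≋-refl {(c , g) ∷ []}) (expand ℓ)) (mk≋ λ φ _ →
            solve 3 (λ u v w → u :+ (v :+ w) := v :+ (u :+ w)) refl (c * φ g) (d * φ e) ⟨ rest ℓ , φ ⟩)
        ; below   = g<e ∷ below ℓ
        ; nonzero = nonzero ℓ
        } , ℕ.s≤s b)
    ... | tri> _ _ e<g = inj₂ (g , c ,
      record
        { rest    = (d , e) ∷ rest ℓ
        ; expand  = ++-cong (≋-refl {(c , g) ∷ []}) (expand ℓ)
        ; below   = e<g ∷ All.map (λ h<e → <-trans h<e e<g) (below ℓ)
        ; nonzero = c≉0
        } , ℕ.s≤s b)
    ... | tri≈ _ g≈e _ = cancel (zero? (c + d))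
      where
      merged : cf ≋ (c + d , e) ∷ rest ℓ
      merged = ≋-trans (++-cong (≋-refl {(c , g) ∷ []}) (expand ℓ)) (mk≋ λ φ resp → begin
        c * φ g + (d * φ e + ⟨ rest ℓ , φ ⟩)  ≈⟨ +-congʳ (*-congˡ (resp g≈e)) ⟩
        c * φ e + (d * φ e + ⟨ rest ℓ , φ ⟩)  ≈⟨ solve 4 (λ c d x u → c :* x :+ (d :* x :+ u) := (c :+ d) :* x :+ u) refl c d (φ e) ⟨ rest ℓ , φ ⟩ ⟩
        (c + d) * φ e + ⟨ rest ℓ , φ ⟩        ∎)

      cancel : Dec (c + d ≈ 0#) → Result
      cancel (no c+d≉0) = inj₂ (e , c + d ,
        record { rest = rest ℓ ; expand = merged ; below = below ℓ ; nonzero = c+d≉0 } , ℕ.m<n⇒m<1+n b)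
      cancel (yes c+d≈0) = recurse (zero-or-leading-within k (rest ℓ) (ℕ.≤-trans (ℕ.<⇒≤ b) |f|≤k))
        where
        cf≋rest : cf ≋ rest ℓ
        cf≋rest = ≋-trans merged (mk≋ λ φ _ →
          trans (+-congʳ (trans (*-congʳ c+d≈0) (zeroˡ _))) (+-identityˡ _))

        recurse : rest ℓ ≋ [] ⊎ (∃[ e′ ] ∃[ d′ ] Σ[ ℓ′ ∈ Leading (rest ℓ) e′ d′ ] length (rest ℓ′) ℕ.< length (rest ℓ)) → Result
        recurse (inj₁ rest≋0) = inj₁ (≋-trans cf≋rest rest≋0)
        recurse (inj₂ (e′ , d′ , ℓ′ , b′)) =
          inj₂ (e′ , d′ , leading-resp (≋-sym cf≋rest) ℓ′ , ℕ.m<n⇒m<1+n (ℕ.<-trans b′ b))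

  zero-or-leading : ∀ f → f ≋ [] ⊎ (∃[ e ] ∃[ c ] Leading f e c)
  zero-or-leading f with zero-or-leading-within (length f) f ℕ.≤-refl
  ... | inj₁ f≋0             = inj₁ f≋0
  ... | inj₂ (e , c , ℓ , _) = inj₂ (e , c , ℓ)

  zero?ᴬ : ∀ f → Dec (f ≋ [])
  zero?ᴬ f with zero-or-leading f
  ... | inj₁ f≋0         = yes f≋0
  ... | inj₂ (_ , _ , ℓ) = no (leading-≉0 ℓ)

  module Ordered (∙-monoʳ-< : ∀ x {y z} → y < z → (x ∙ y) < (x ∙ z)) where

    private
      ∙-monoˡ-< : ∀ x {y z} → y < z → (y ∙ x) < (z ∙ x)
      ∙-monoˡ-< x {y} {z} y<z = <-respˡ-≈ (G.comm x y) (<-respʳ-≈ (G.comm x z) (∙-monoʳ-< x y<z))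

      ⋆-below : ∀ {c g e f} → Below e f → Below (g ∙ e) ((c , g) ⋆ f)
      ⋆-below []            = []
      ⋆-below (h<e ∷ below) = ∙-monoʳ-< _ h<e ∷ ⋆-below below

      ⊛-below : ∀ {e e′ f g} → Below e f → All (λ (_ , h) → ∀ x → x < e → (x ∙ h) < (e ∙ e′)) g → Below (e ∙ e′) (f ⊛ g)
      ⊛-below []              _      = []
      ⊛-below (x<e ∷ below) bounds =
        All.++⁺ (All.map⁺ (All.map (λ bound → bound _ x<e) bounds)) (⊛-below below bounds)

    -- Monotonicity puts every product other than that of the two leading terms strictly below
    -- `e ∙ e′`, and in a domain nonzero coefficients have a nonzero product. The algebra is
    -- therefore a domain again.
    leading-* : ∀ {f g e e′ c c′} → Leading f e c → Leading g e′ c′ → Leading (f ⊛ g) (e ∙ e′) (c * c′)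
    leading-* {f} {g} {e} {e′} {c} {c′} ℓ ℓ′ = record
      { rest    = (c , e) ⋆ rest ℓ′ ++ rest ℓ ⊛ ((c′ , e′) ∷ rest ℓ′)
      ; expand  = ⊛-cong (expand ℓ) (expand ℓ′)
      ; below   = All.++⁺ (⋆-below (below ℓ′)) (⊛-below (below ℓ)
          ((λ _ → ∙-monoˡ-< e′) ∷
            All.map (λ h<e′ _ x<e → <-trans (∙-monoˡ-< _ x<e) (∙-monoʳ-< e h<e′)) (below ℓ′)))
      ; nonzero = *-nonzero (nonzero ℓ) (nonzero ℓ′)
      }

    algebraDomain : IntegralDomain
    algebraDomain = record
      { commutativeRing = algebra
      ; zero?           = zero?ᴬ
      ; 1≉0             = leading-≉0 (leading-singleton 1≉0)
      ; integral        = integralᴬ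
      }
      where
      integralᴬ : ∀ {f g} → f ⊛ g ≋ [] → f ≋ [] ⊎ g ≋ []
      integralᴬ {f} {g} fg≋0 with zero-or-leading f | zero-or-leading g
      ... | inj₁ f≋0         | _                 = inj₁ f≋0
      ... | inj₂ _           | inj₁ g≋0          = inj₂ g≋0
      ... | inj₂ (_ , _ , ℓ) | inj₂ (_ , _ , ℓ′) = contradiction fg≋0 (leading-≉0 (leading-* ℓ ℓ′))

-- Binomial coefficients and the Frobenius map

prime∣!⇒≤ : ∀ {p} → Prime p → ∀ k → p ∣ k ! → p ℕ.≤ k
prime∣!⇒≤ {p} pr zero    p∣1 = contradiction (∣⇒≤ p∣1) (ℕ.<⇒≱ (ℕ.nonTrivial⇒n>1 p {{prime⇒nonTrivial pr}}))
prime∣!⇒≤ {p} pr (suc k) p∣k! with euclidsLemma (suc k) (k !) pr p∣k!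
... | inj₁ p∣1+k = ∣⇒≤ p∣1+k
... | inj₂ p∣k!′ = ℕ.m≤n⇒m≤1+n (prime∣!⇒≤ pr k p∣k!′)

-- p divides p! = (p C k) k! (p - k)!, but neither of the two factorials, whose arguments are
-- smaller than p.
prime∣C : ∀ {p} → Prime p → ∀ {k} → 0 ℕ.< k → k ℕ.< p → p ∣ (p C k)
prime∣C {p@(suc m)} pr {k@(suc _)} 0<k k<p with euclidsLemma (p C k) (k ! ℕ.* (p ∸ k) !) pr p∣product
  where
  instance _ = k ℕ.!* (p ∸ k) !≢0
  p∣product : p ∣ (p C k) ℕ.* (k ! ℕ.* (p ∸ k) !)
  p∣product = ≡.subst (p ∣_)
    (≡.sym (≡.trans (≡.cong (ℕ._* (k ! ℕ.* (p ∸ k) !)) (nCk≡n!/k![n-k]! (ℕ.<⇒≤ k<p)))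
      (m/n*n≡m (k![n∸k]!∣n! (ℕ.<⇒≤ k<p)))))
    (m∣m*n (m !))
... | inj₁ p∣C = p∣C
... | inj₂ p∣k![p-k]! with euclidsLemma (k !) ((p ∸ k) !) pr p∣k![p-k]!
...   | inj₁ p∣k!     = contradiction (prime∣!⇒≤ pr k p∣k!) (ℕ.<⇒≱ k<p)
...   | inj₂ p∣[p-k]! = contradiction (prime∣!⇒≤ pr (p ∸ k) p∣[p-k]!) (ℕ.<⇒≱ (ℕ.∸-monoʳ-< 0<k (ℕ.<⇒≤ k<p)))

module Frobenius (R : CommutativeRing 0ℓ 0ℓ) {p : ℕ} (pr : Prime p) where
  open CommutativeRing R hiding (zero)
  open import Algebra.Properties.Semiring.Exp semiring
  open import Algebra.Properties.Semiring.Mult semiring renaming (_×_ to _·_)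
  open import Algebra.Properties.Semiring.Sum semiring
  open import Relation.Binary.Reasoning.Setoid setoid
  private module Binomial = Algebra.Properties.CommutativeSemiring.Binomial commutativeSemiring

  module _ (p·≈0 : ∀ x → p · x ≈ 0#) where

    ∣-·≈0 : ∀ {n} x → p ∣ n → n · x ≈ 0#
    ∣-·≈0 {n} x (divides q eq) = begin
      n · x          ≡⟨ ≡.cong (_· x) eq ⟩
      (q ℕ.* p) · x  ≈⟨ ×-assocˡ x q p ⟨
      q · (p · x)    ≈⟨ ×-congʳ q (p·≈0 x) ⟩
      q · 0#         ≈⟨ ·-zeroʳ q ⟩
      0#             ∎
      where
      ·-zeroʳ : ∀ n → n · 0# ≈ 0#
      ·-zeroʳ zero    = refl
      ·-zeroʳ (suc n) = trans (+-identityˡ _) (·-zeroʳ n)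

    -- The inner binomial coefficients are multiples of p, so only the two end terms of the binomial
    -- sum survive.
    frobenius-+ : ∀ x y → (x + y) ^ p ≈ x ^ p + y ^ p
    frobenius-+ x y = go p ≡.refl
      where
      -- Writing p as a successor lets the sum of p + 1 terms split off its first and its last.
      go : ∀ m → m ≡ p → (x + y) ^ m ≈ x ^ m + y ^ m
      go zero    ≡.refl = contradiction pr ¬prime[0]
      go (suc m) ≡.refl = begin
        (x + y) ^ suc m
          ≈⟨ Binomial.theorem (suc m) x y ⟩
        term zero + ∑[ i < suc m ] term (suc i)
          ≈⟨ +-congˡ (sum-init-last (term ∘ suc)) ⟩
        term zero + (∑[ i < m ] term (suc (inject₁ i)) + term (suc (fromℕ m)))
          ≈⟨ +-cong first (+-cong middle last′) ⟩
        y ^ suc m + (0# + x ^ suc m)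
          ≈⟨ trans (+-congˡ (+-identityˡ _)) (+-comm _ _) ⟩
        x ^ suc m + y ^ suc m ∎
        where
        term : Fin (suc (suc m)) → Carrier
        term = Binomial.binomialTerm x y (suc m)

        first : term zero ≈ y ^ suc m
        first = trans (+-identityʳ _) (*-identityˡ _)

        middle : ∑[ i < m ] term (suc (inject₁ i)) ≈ 0#
        middle = trans (sum-cong-≋ {m} λ i → ∣-·≈0 _ (prime∣C pr ℕ.z<s
          (ℕ.s<s (≡.subst (ℕ._< m) (≡.sym (Fin.toℕ-inject₁ i)) (Fin.toℕ<n i)))))
          (sum-replicate-zero m)

        last′ : term (suc (fromℕ m)) ≈ x ^ suc m
        last′ = begin
          (suc m C suc (toℕ (fromℕ m))) · (x ^ suc (toℕ (fromℕ m)) * y ^ (m ∸ toℕ (fromℕ m)))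
            ≡⟨ ≡.cong (λ k → (suc m C suc k) · (x ^ suc k * y ^ (m ∸ k))) (Fin.toℕ-fromℕ m) ⟩
          (suc m C suc m) · (x ^ suc m * y ^ (m ∸ m))
            ≡⟨ ≡.cong₂ (λ c k → c · (x ^ suc m * y ^ k)) (nCn≡1 (suc m)) (ℕ.n∸n≡0 m) ⟩
          1 · (x ^ suc m * 1#)
            ≈⟨ trans (+-identityʳ _) (*-identityʳ _) ⟩
          x ^ suc m ∎

    frobenius-^-+ : ∀ k x y → (x + y) ^ (p ℕ.^ k) ≈ x ^ (p ℕ.^ k) + y ^ (p ℕ.^ k)
    frobenius-^-+ zero    x y = trans (*-identityʳ _) (sym (+-cong (*-identityʳ x) (*-identityʳ y)))
    frobenius-^-+ (suc k) x y = begin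
      (x + y) ^ (p ℕ.* p ℕ.^ k)                        ≈⟨ ^-assocʳ (x + y) p (p ℕ.^ k) ⟨
      ((x + y) ^ p) ^ (p ℕ.^ k)                        ≈⟨ ^-congˡ (p ℕ.^ k) (frobenius-+ x y) ⟩
      (x ^ p + y ^ p) ^ (p ℕ.^ k)                      ≈⟨ frobenius-^-+ k (x ^ p) (y ^ p) ⟩
      (x ^ p) ^ (p ℕ.^ k) + (y ^ p) ^ (p ℕ.^ k)        ≈⟨ +-cong (^-assocʳ x p (p ℕ.^ k)) (^-assocʳ y p (p ℕ.^ k)) ⟩
      x ^ (p ℕ.* p ℕ.^ k) + y ^ (p ℕ.* p ℕ.^ k)        ∎

-- Quotients by a principal ideal and by an annihilator

module _ (R : CommutativeRing 0ℓ 0ℓ) where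
  open CommutativeRing R

  quotientRing : (_~_ : Rel Carrier 0ℓ) → IsEquivalence _~_ → (∀ {x y} → x ≈ y → x ~ y) →
    (∀ {x y u v} → x ~ y → u ~ v → (x + u) ~ (y + v)) →
    (∀ {x y u v} → x ~ y → u ~ v → (x * u) ~ (y * v)) →
    (∀ {x y} → x ~ y → (- x) ~ (- y)) → CommutativeRing 0ℓ 0ℓ
  quotientRing _~_ isEq inc +-cong~ *-cong~ neg-cong~ = record
    { Carrier = Carrier
    ; _≈_ = _~_
    ; _+_ = _+_
    ; _*_ = _*_
    ; -_  = -_
    ; 0#  = 0#
    ; 1#  = 1#
    ; isCommutativeRing = record
      { isRing = record
        { +-isAbelianGroup = record
          { isGroup = record
            { isMonoid = record
              { isSemigroup = record
                { isMagma = record { isEquivalence = isEq ; ∙-cong = +-cong~ }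
                ; assoc = λ x y z → inc (+-assoc x y z)
                }
              ; identity = (λ x → inc (+-identityˡ x)) , (λ x → inc (+-identityʳ x))
              }
            ; inverse = (λ x → inc (-‿inverseˡ x)) , (λ x → inc (-‿inverseʳ x))
            ; ⁻¹-cong = neg-cong~
            }
          ; comm = λ x y → inc (+-comm x y)
          }
        ; *-cong = *-cong~
        ; *-assoc = λ x y z → inc (*-assoc x y z)
        ; *-identity = (λ x → inc (*-identityˡ x)) , (λ x → inc (*-identityʳ x))
        ; distrib = (λ x y z → inc (distribˡ x y z)) , (λ x y z → inc (distribʳ x y z))
        }
      ; *-comm = λ x y → inc (*-comm x y)
      }
    }

module ModuloPrincipal (R : CommutativeRing 0ℓ 0ℓ) (s : CommutativeRing.Carrier R) where
  open CommutativeRing R hiding (zero)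
  open IntegerCoefficients R
  open import Relation.Binary.Reasoning.Setoid setoid

  infix  4 _≈ₘ_
  infixr 3 _,ₘ_

  record _≈ₘ_ (x y : Carrier) : Set where
    constructor _,ₘ_
    field
      quotient : Carrier
      equality : x ≈ y + s * quotient

  open _≈ₘ_ public

  ring/s : CommutativeRing 0ℓ 0ℓ
  ring/s = quotientRing R _≈ₘ_
    (record
      { refl  = 0# ,ₘ sym (trans (+-congˡ (zeroʳ s)) (+-identityʳ _))
      ; sym   = λ {x} {y} (q ,ₘ eq) → - q ,ₘ sym (begin
          x + s * - q              ≈⟨ +-congʳ eq ⟩
          (y + s * q) + s * - q    ≈⟨ solve 3 (λ y s q → (y :+ s :* q) :+ s :* :- q := y) refl y s q ⟩
          y                        ∎)
      ; trans = λ {x} {y} {z} (q ,ₘ eq) (r ,ₘ eq′) → r + q ,ₘ (begin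
          x                        ≈⟨ trans eq (+-congʳ eq′) ⟩
          (z + s * r) + s * q      ≈⟨ solve 4 (λ z s r q → (z :+ s :* r) :+ s :* q := z :+ s :* (r :+ q)) refl z s r q ⟩
          z + s * (r + q)          ∎)
      })
    (λ x≈y → 0# ,ₘ trans x≈y (sym (trans (+-congˡ (zeroʳ s)) (+-identityʳ _))))
    (λ {x} {y} {u} {v} (q ,ₘ eq) (r ,ₘ eq′) → q + r ,ₘ (begin
      x + u                        ≈⟨ +-cong eq eq′ ⟩
      (y + s * q) + (v + s * r)    ≈⟨ solve 5 (λ y v s q r → (y :+ s :* q) :+ (v :+ s :* r) := (y :+ v) :+ s :* (q :+ r)) refl y v s q r ⟩
      (y + v) + s * (q + r)        ∎))
    (λ {x} {y} {u} {v} (q ,ₘ eq) (r ,ₘ eq′) → y * r + q * v + s * (q * r) ,ₘ (begin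
      x * u                        ≈⟨ *-cong eq eq′ ⟩
      (y + s * q) * (v + s * r)    ≈⟨ solve 5 (λ y v s q r → (y :+ s :* q) :* (v :+ s :* r) := y :* v :+ s :* (y :* r :+ q :* v :+ s :* (q :* r))) refl y v s q r ⟩
      y * v + s * (y * r + q * v + s * (q * r)) ∎))
    (λ {x} {y} (q ,ₘ eq) → - q ,ₘ (begin
      - x                          ≈⟨ -‿cong eq ⟩
      - (y + s * q)                ≈⟨ solve 3 (λ y s q → :- (y :+ s :* q) := :- y :+ s :* :- q) refl y s q ⟩
      - y + s * - q                ∎))

  open CommutativeRing ring/s public using () renaming (trans to transₘ)

  -- The library defines ^ and × relative to a ring, so those of the quotient
  -- agree with those of R only propositionally.
  private
    module E = Algebra.Properties.Semiring.Exp semiring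
    module E/s = Algebra.Properties.Semiring.Exp (CommutativeRing.semiring ring/s)
    module M = Algebra.Properties.Semiring.Mult semiring
    module M/s = Algebra.Properties.Semiring.Mult (CommutativeRing.semiring ring/s)

  ^ₘ≡^ : ∀ x n → x E/s.^ n ≡ x E.^ n
  ^ₘ≡^ x zero    = ≡.refl
  ^ₘ≡^ x (suc n) = ≡.cong (x *_) (^ₘ≡^ x n)

  ×ₘ≡× : ∀ n x → n M/s.× x ≡ n M.× x
  ×ₘ≡× zero    x = ≡.refl
  ×ₘ≡× (suc n) x = ≡.cong (λ u → x + u) (×ₘ≡× n x)

module ModuloAnnihilator (R : CommutativeRing 0ℓ 0ℓ) (s : CommutativeRing.Carrier R) where
  open CommutativeRing R hiding (zero)
  open IntegerCoefficients R
  open import Relation.Binary.Reasoning.Setoid setoid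

  infix 4 _≈ₐ_

  -- x - y annihilates s. Stated as an equation in R, so that a zero test of R yields one of the
  -- quotient, which is the ideal sR as a module.
  record _≈ₐ_ (x y : Carrier) : Set where
    constructor mkₐ
    field
      multiple : s * x ≈ s * y

  open _≈ₐ_ public

  ring/ann : CommutativeRing 0ℓ 0ℓ
  ring/ann = quotientRing R _≈ₐ_
    (record
      { refl  = mkₐ refl
      ; sym   = λ (mkₐ eq) → mkₐ (sym eq)
      ; trans = λ (mkₐ eq) (mkₐ eq′) → mkₐ (trans eq eq′)
      })
    (λ x≈y → mkₐ (*-congˡ x≈y))
    (λ (mkₐ eq) (mkₐ eq′) → mkₐ (trans (distribˡ _ _ _) (trans (+-cong eq eq′) (sym (distribˡ _ _ _)))))
    (λ {x} {y} {u} {v} (mkₐ eq) (mkₐ eq′) → mkₐ (begin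
      s * (x * u)   ≈⟨ *-assoc _ _ _ ⟨
      s * x * u     ≈⟨ *-congʳ eq ⟩
      s * y * u     ≈⟨ solve 3 (λ s y u → s :* y :* u := s :* u :* y) refl s y u ⟩
      s * u * y     ≈⟨ *-congʳ eq′ ⟩
      s * v * y     ≈⟨ solve 3 (λ s y v → s :* v :* y := s :* (y :* v)) refl s y v ⟩
      s * (y * v)   ∎))
    (λ {x} {y} (mkₐ eq) → mkₐ (begin
      s * - x       ≈⟨ solve 2 (λ s x → s :* :- x := :- (s :* x)) refl s x ⟩
      - (s * x)     ≈⟨ -‿cong eq ⟩
      - (s * y)     ≈⟨ solve 2 (λ s x → s :* :- x := :- (s :* x)) refl s y ⟨
      s * - y       ∎))

  private
    module E = Algebra.Properties.Semiring.Exp semiring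
    module E/ann = Algebra.Properties.Semiring.Exp (CommutativeRing.semiring ring/ann)
    module M = Algebra.Properties.Semiring.Mult semiring
    module M/ann = Algebra.Properties.Semiring.Mult (CommutativeRing.semiring ring/ann)

  ^ₐ≡^ : ∀ x n → x E/ann.^ n ≡ x E.^ n
  ^ₐ≡^ x zero    = ≡.refl
  ^ₐ≡^ x (suc n) = ≡.cong (x *_) (^ₐ≡^ x n)

  ×ₐ≡× : ∀ n x → n M/ann.× x ≡ n M.× x
  ×ₐ≡× zero    x = ≡.refl
  ×ₐ≡× (suc n) x = ≡.cong (λ u → x + u) (×ₐ≡× n x)

-- The valuation of ℤ[ζ] at ζ - 1 and ramification at p

module _ (R : CommutativeRing 0ℓ 0ℓ) where
  open CommutativeRing R hiding (zero)
  open import Algebra.Properties.Semiring.Exp semiring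
  open import Algebra.Properties.Semiring.Mult semiring renaming (_×_ to _·_)
  open import Relation.Binary.Reasoning.Setoid setoid
  open IntegerCoefficients R

  1^n≈1 : ∀ n → 1# ^ n ≈ 1#
  1^n≈1 zero    = refl
  1^n≈1 (suc n) = trans (*-identityˡ _) (1^n≈1 n)

  -- The binomial theorem up to second order. For exponent p, b a multiple of η and η ∣ p, the
  -- linear term is a multiple of η² as well as the remainder.
  +-^-expand : ∀ m a b → ∃[ d ] (a + b) ^ suc m ≈ a ^ suc m + (suc m · 1#) * (a ^ m * b) + b * b * d
  +-^-expand zero    a b = 0# , (begin
    (a + b) * 1#                                       ≈⟨ *-congˡ (+-identityʳ 1#) ⟨
    (a + b) * (1 · 1#)                                 ≈⟨ solve 2 (λ a b → (a :+ b) :* con (+ 1) := a :* con (+ 1) :+ con (+ 1) :* (con (+ 1) :* b) :+ b :* b :* con (+ 0)) refl a b ⟩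
    a * (1 · 1#) + (1 · 1#) * ((1 · 1#) * b) + b * b * 0#   ≈⟨ +-congʳ (+-cong (*-congˡ (+-identityʳ 1#)) (*-congˡ (*-congʳ (+-identityʳ 1#)))) ⟩
    a * 1# + (1 · 1#) * (1# * b) + b * b * 0#          ∎)
  +-^-expand (suc m) a b with +-^-expand m a b
  ... | d , eq = (suc m · 1#) * a ^ m + a * d + b * d , (begin
    (a + b) * (a + b) ^ suc m
      ≈⟨ *-congˡ eq ⟩
    (a + b) * (a * a ^ m + M * (a ^ m * b) + b * b * d)
      ≈⟨ solve 5 (λ a b am M d → (a :+ b) :* (a :* am :+ M :* (am :* b) :+ b :* b :* d)
           := a :* (a :* am) :+ (con (+ 1) :+ M) :* ((a :* am) :* b) :+ b :* b :* (M :* am :+ a :* d :+ b :* d)) refl a b (a ^ m) M d ⟩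
    a * (a * a ^ m) + (1 · 1# + M) * ((a * a ^ m) * b) + b * b * (M * a ^ m + a * d + b * d)
      ≈⟨ +-congʳ (+-congˡ (*-congʳ (+-congʳ (+-identityʳ 1#)))) ⟩
    a * (a * a ^ m) + (1# + M) * ((a * a ^ m) * b) + b * b * (M * a ^ m + a * d + b * d) ∎)
    where M = suc m · 1#

module CyclotomicElements (R : CommutativeRing 0ℓ 0ℓ) (p k : ℕ) (ζ : CommutativeRing.Carrier R) where
  open CommutativeRing R
  open import Algebra.Properties.Semiring.Exp semiring

  -- In ℤ[ζ], `ξ` is a primitive p-th root of unity, `π` generates the prime over p, and `η`
  -- generates the prime over p of the subring ℤ[ξ].
  ξ π η : Carrier
  ξ = ζ ^ (p ℕ.^ k)
  π = ζ - 1#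
  η = ξ - 1#

  infix 4 π∣_

  π∣_ : Carrier → Set
  π∣ x = ∃[ y ] x ≈ π * y

-- The properties of ℤ[ζ], ζ a primitive pᵏ⁺¹-th root of unity, behind its
-- (ζ − 1)-adic valuation, which is totally ramified over p.
record CyclotomicRing (p k : ℕ) : Set₁ where
  field
    commutativeRing : CommutativeRing 0ℓ 0ℓ
  open CommutativeRing commutativeRing public
  open Algebra.Properties.Semiring.Exp semiring public
  open Algebra.Properties.Semiring.Mult semiring public renaming (_×_ to _·_)
  field
    ζ : Carrier
  open CyclotomicElements commutativeRing p k ζ public
  field
    ζ^pᵏ⁺¹≈1  : ζ ^ (p ℕ.^ suc k) ≈ 1#
    zero?     : ∀ x → Dec (x ≈ 0#)
    π∣?       : ∀ x → Dec (π∣ x)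
    π-prime   : ∀ {x y} → π∣ x * y → (π∣ x) ⊎ (π∣ y)
    π∤1       : ¬ (π∣ 1#)
    π-cancel  : ∀ {x} → π * x ≈ 0# → x ≈ 0#
    π∣η       : π∣ η
    η∣p       : ∃[ q ] p · 1# ≈ η * q
    p≉0       : ¬ (p · 1# ≈ 0#)
    separated : ∀ {x} → ¬ (x ≈ 0#) → ∃[ j ] ∀ y → ¬ (x ≈ (p · 1#) ^ j * y)

module CyclotomicRingProperties {p : ℕ} (pr : Prime p) {k : ℕ} (C : CyclotomicRing p k) where
  open CyclotomicRing C hiding (zero)
  open import Algebra.Properties.CommutativeSemiring.Exp commutativeSemiring using (^-distrib-*)
  open import Algebra.Properties.Ring ring using (x∙y⁻¹≈ε⇒x≈y)
  open IntegerCoefficients commutativeRing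
  open ModuloPrincipal commutativeRing (p · 1#)
  open import Relation.Binary.Reasoning.Setoid setoid
  private
    module F = Frobenius ring/s pr
    P = p ℕ.^ k
    L = p ℕ.^ suc k
    L≢0 : ℕ.NonZero L
    L≢0 = ℕ.m^n≢0 p (suc k) {{prime⇒nonZero pr}}

  p·≈0ₘ : ∀ x → p · x ≈ₘ 0#
  p·≈0ₘ x = x ,ₘ (begin
    p · x              ≈⟨ ×-congʳ p (*-identityˡ x) ⟨
    p · (1# * x)       ≈⟨ ×-assoc-* p 1# x ⟨
    (p · 1#) * x       ≈⟨ +-identityˡ _ ⟨
    0# + (p · 1#) * x  ∎)

  ≈⇒≈ₘ : ∀ {x y} → x ≈ y → x ≈ₘ y
  ≈⇒≈ₘ {x} {y} x≈y = 0# ,ₘ trans x≈y (sym (trans (+-congˡ (zeroʳ _)) (+-identityʳ y)))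

  frobenius : ∀ j x y → (x + y) ^ (p ℕ.^ j) ≈ₘ x ^ (p ℕ.^ j) + y ^ (p ℕ.^ j)
  frobenius j x y = ≡.subst₂ _≈ₘ_ (^ₘ≡^ (x + y) (p ℕ.^ j))
    (≡.cong₂ _+_ (^ₘ≡^ x (p ℕ.^ j)) (^ₘ≡^ y (p ℕ.^ j)))
    (F.frobenius-^-+ (λ z → ≡.subst (_≈ₘ 0#) (≡.sym (×ₘ≡× p z)) (p·≈0ₘ z)) j x y)

  private
    ≈ₘ-shift : ∀ {x y z} → x ≈ₘ y + z → y ≈ₘ x - z
    ≈ₘ-shift {x} {y} {z} (q ,ₘ eq) = - q ,ₘ sym (begin
      x - z + (p · 1#) * - q                    ≈⟨ +-congʳ (+-congʳ eq) ⟩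
      y + z + (p · 1#) * q - z + (p · 1#) * - q ≈⟨ solve 4 (λ y z s q → y :+ z :+ s :* q :- z :+ s :* :- q := y) refl y z (p · 1#) q ⟩
      y                                         ∎)

    ζ≈π+1 : ζ ≈ π + 1#
    ζ≈π+1 = sym (trans (+-assoc _ _ _) (trans (+-congˡ (-‿inverseˡ 1#)) (+-identityʳ ζ)))

    -- The Frobenius map applied to ζ = π + 1.
    π^≈ₘ : ∀ j → π ^ (p ℕ.^ j) ≈ₘ ζ ^ (p ℕ.^ j) - 1#
    π^≈ₘ j = ≈ₘ-shift (transₘ (≈⇒≈ₘ (^-congˡ (p ℕ.^ j) ζ≈π+1))
      (transₘ (frobenius j π 1#) (≈⇒≈ₘ (+-congˡ (1^n≈1 commutativeRing (p ℕ.^ j))))))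

  abstract
    π^pᵏ≈ₘη : π ^ P ≈ₘ η
    π^pᵏ≈ₘη = π^≈ₘ k

    -- At exponent L the right side ζᴸ - 1 of `π^≈ₘ` vanishes. Thus powers of π are bounded by
    -- powers of p.
    π^pᵏ⁺¹∈p : ∃[ r ] π ^ L ≈ (p · 1#) * r
    π^pᵏ⁺¹∈p = multiple (π^≈ₘ (suc k)) (trans (+-congʳ ζ^pᵏ⁺¹≈1) (-‿inverseʳ 1#))
      where
      multiple : ∀ {x y} → x ≈ₘ y → y ≈ 0# → ∃[ r ] x ≈ (p · 1#) * r
      multiple (r ,ₘ eq) y≈0 = r , trans eq (trans (+-congʳ y≈0) (+-identityˡ _))

  π∣-resp : ∀ {x y} → x ≈ y → π∣ x → π∣ y
  π∣-resp x≈y (z , eq) = z , trans (sym x≈y) eq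

  π∣-*ˡ : ∀ {x} y → π∣ x → π∣ x * y
  π∣-*ˡ y (z , eq) = z * y , trans (*-congʳ eq) (*-assoc _ _ _)

  π∣-+ : ∀ {x y} → π∣ x → π∣ y → π∣ x + y
  π∣-+ (z , eq) (w , eq′) = z + w , trans (+-cong eq eq′) (sym (distribˡ _ _ _))

  π∣p : π∣ (p · 1#)
  π∣p = π∣-resp (sym (proj₂ η∣p)) (π∣-*ˡ _ π∣η)

  π∤-* : ∀ {x y} → ¬ (π∣ x) → ¬ (π∣ y) → ¬ (π∣ x * y)
  π∤-* π∤x π∤y π∣xy with π-prime π∣xy
  ... | inj₁ π∣x = π∤x π∣x
  ... | inj₂ π∣y = π∤y π∣y

  π∤-^ : ∀ {x} n → ¬ (π∣ x) → ¬ (π∣ x ^ n)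
  π∤-^ zero    π∤x = π∤1
  π∤-^ (suc n) π∤x = π∤-* π∤x (π∤-^ n π∤x)

  π^-cancel : ∀ n {x} → π ^ n * x ≈ 0# → x ≈ 0#
  π^-cancel zero    eq = trans (sym (*-identityˡ _)) eq
  π^-cancel (suc n) eq = π^-cancel n (π-cancel (trans (sym (*-assoc _ _ _)) eq))

  private
    -‿zero⇒≈ : ∀ {x y} → x - y ≈ 0# → x ≈ y
    -‿zero⇒≈ {x} {y} = x∙y⁻¹≈ε⇒x≈y x y

    π^-cancel-≈ : ∀ n {x y} → π ^ n * x ≈ π ^ n * y → x ≈ y
    π^-cancel-≈ n {x} {y} eq = -‿zero⇒≈ (π^-cancel n (begin
      π ^ n * (x - y)           ≈⟨ solve 3 (λ u x y → u :* (x :- y) := u :* x :- u :* y) refl (π ^ n) x y ⟩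
      π ^ n * x - π ^ n * y     ≈⟨ +-congʳ eq ⟩
      π ^ n * y - π ^ n * y     ≈⟨ -‿inverseʳ _ ⟩
      0#                        ∎))

  -- The factor u is prime to π; it is a unit only after localising at π.
  Unit-part : Carrier → Set
  Unit-part x = ∃[ n ] ∃[ u ] x ≈ π ^ n * u × ¬ (π∣ u)

  abstract
    -- π is divided out repeatedly. This stops within L j steps, where j comes from `separated`:
    -- π^(L j) is a multiple of pʲ, and pʲ does not divide x.
    unit-part : ∀ x → ¬ (x ≈ 0#) → Unit-part x
    unit-part x x≉0 = bounded (proj₁ (separated x≉0)) (proj₂ (separated x≉0))
      where
      r : Carrier
      r = proj₁ π^pᵏ⁺¹∈p

      extract : ∀ n x → (∀ y → ¬ (x ≈ π ^ n * y)) → Unit-part x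
      divide  : ∀ n x → (∀ y → ¬ (x ≈ π ^ suc n * y)) → Dec (π∣ x) → Unit-part x

      extract zero    x ¬π^n∣x = contradiction (sym (*-identityˡ x)) (¬π^n∣x x)
      extract (suc n) x ¬π^n∣x = divide n x ¬π^n∣x (π∣? x)

      divide n x ¬π^n∣x (no  π∤x)      = 0 , x , sym (*-identityˡ x) , π∤x
      divide n x ¬π^n∣x (yes (y , eq)) = times-π
        (extract n y λ z eq′ → ¬π^n∣x z (trans eq (trans (*-congˡ eq′) (sym (*-assoc _ _ _)))))
        where
        times-π : Unit-part y → Unit-part x
        times-π (m , u , eq′ , π∤u) = suc m , u , trans eq (trans (*-congˡ eq′) (sym (*-assoc _ _ _))) , π∤u

      bounded : ∀ j → (∀ y → ¬ (x ≈ (p · 1#) ^ j * y)) → Unit-part x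
      bounded j ¬p^j∣x = extract (L ℕ.* j) x λ y eq → ¬p^j∣x (r ^ j * y) (begin
        x                             ≈⟨ eq ⟩
        π ^ (L ℕ.* j) * y             ≈⟨ *-congʳ (^-assocʳ π L j) ⟨
        (π ^ L) ^ j * y               ≈⟨ *-congʳ (^-congˡ j (proj₂ π^pᵏ⁺¹∈p)) ⟩
        ((p · 1#) * r) ^ j * y        ≈⟨ *-congʳ (^-distrib-* (p · 1#) r j) ⟩
        (p · 1#) ^ j * r ^ j * y      ≈⟨ *-assoc _ _ _ ⟩
        (p · 1#) ^ j * (r ^ j * y)    ∎)

  private
    -- Cancelling the powers of π from xy = 0 leaves uv = 0, which is divisible by π although π is
    -- prime and divides neither factor. So the valuation yields integrality.
    π^-integral : ∀ {x y} → Unit-part x → Unit-part y → ¬ (x * y ≈ 0#)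
    π^-integral {x} {y} (m , u , x≈ , π∤u) (n , v , y≈ , π∤v) xy≈0 =
      π∤-* π∤u π∤v (0# , trans (π^-cancel m (π^-cancel n (begin
        π ^ n * (π ^ m * (u * v))   ≈⟨ solve 4 (λ s t u v → s :* (t :* (u :* v)) := t :* u :* (s :* v)) refl (π ^ n) (π ^ m) u v ⟩
        π ^ m * u * (π ^ n * v)     ≈⟨ *-cong x≈ y≈ ⟨
        x * y                       ≈⟨ xy≈0 ⟩
        0#                          ∎))) (sym (zeroʳ π)))

    integral : ∀ {x y} → Dec (x ≈ 0#) → Dec (y ≈ 0#) → x * y ≈ 0# → x ≈ 0# ⊎ y ≈ 0#
    integral (yes x≈0) _         _    = inj₁ x≈0
    integral (no  _)   (yes y≈0) _    = inj₂ y≈0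
    integral (no  x≉0) (no  y≉0) xy≈0 =
      contradiction xy≈0 (π^-integral (unit-part _ x≉0) (unit-part _ y≉0))

  domain : IntegralDomain
  domain = record
    { commutativeRing = commutativeRing
    ; zero?           = zero?
    ; 1≉0             = λ 1≈0 → π∤1 (0# , trans 1≈0 (sym (zeroʳ π)))
    ; integral        = integral (zero? _) (zero? _)
    }

  private module D = IntegralDomain domain

  η≉0 : ¬ (η ≈ 0#)
  η≉0 η≈0 = p≉0 (trans (proj₂ η∣p) (trans (*-congʳ η≈0) (zeroˡ _)))

  ξ≉1 : ¬ (ξ ≈ 1#)
  ξ≉1 ξ≈1 = η≉0 (trans (+-congʳ ξ≈1) (-‿inverseʳ 1#))

  ζ≉0 : ¬ (ζ ≈ 0#)
  ζ≉0 ζ≈0 = D.1≉0 (trans (sym ζ^pᵏ⁺¹≈1) (go L {{L≢0}}))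
    where
    go : ∀ n → .{{ℕ.NonZero n}} → ζ ^ n ≈ 0#
    go (suc n) = trans (*-congʳ ζ≈0) (zeroˡ _)

  ξ≉0 : ¬ (ξ ≈ 0#)
  ξ≉0 = D.^-nonzero P ζ≉0

  private
    -- ξ = 1 + η is 1 modulo π.
    π∤ξ : ¬ (π∣ ξ)
    π∤ξ (y , eq) = π∤1 (y - proj₁ π∣η , (begin
      1#                                ≈⟨ solve 2 (λ x o → o := x :- (x :- o)) refl ξ 1# ⟩
      ξ - η                             ≈⟨ +-cong eq (-‿cong (proj₂ π∣η)) ⟩
      π * y - π * proj₁ π∣η             ≈⟨ solve 3 (λ p y z → p :* y :- p :* z := p :* (y :- z)) refl π y (proj₁ π∣η) ⟩
      π * (y - proj₁ π∣η)               ∎))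

    -- π is cancelled on both sides until one exponent is 0. The other is then 0 too, since π
    -- divides neither u nor v.
    valuation-unique : ∀ m n {u v} → ¬ (π∣ u) → ¬ (π∣ v) → π ^ m * u ≈ π ^ n * v → u ≈ v
    valuation-unique zero    zero    π∤u π∤v eq = trans (sym (*-identityˡ _)) (trans eq (*-identityˡ _))
    valuation-unique zero    (suc n) π∤u π∤v eq = contradiction (π ^ n * _ , trans (sym (*-identityˡ _)) (trans eq (*-assoc _ _ _))) π∤u
    valuation-unique (suc m) zero    π∤u π∤v eq = contradiction (π ^ m * _ , trans (sym (*-identityˡ _)) (trans (sym eq) (*-assoc _ _ _))) π∤v
    valuation-unique (suc m) (suc n) π∤u π∤v eq = valuation-unique m n π∤u π∤v
      (π^-cancel-≈ 1 (trans (step m) (trans eq (sym (step n)))))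
      where
      step : ∀ m {x} → π ^ 1 * (π ^ m * x) ≈ π ^ suc m * x
      step m = trans (*-congʳ (*-identityʳ π)) (sym (*-assoc _ _ _))

  -- If uᴸ = ξ vᴸ with L = pᵏ⁺¹ then u ≡ v modulo π, so u^(pᵏ) ≡ v^(pᵏ) modulo η, so
  -- uᴸ ≡ vᴸ modulo η²; but uᴸ − vᴸ = η vᴸ is divisible by η only once.
  private
    no-unit-root : ∀ {u v} → ¬ (π∣ u) → ¬ (π∣ v) → ¬ (u ^ L ≈ ξ * v ^ L)
    no-unit-root {u} {v} π∤u π∤v uᴸ≈ξvᴸ =
      π∤-^ L π∤v (π∣-resp (sym vᴸ≈ηz′) (π∣-*ˡ z′ π∣η))
      where
      q = proj₁ η∣p

      -- Modulo p, (u - v)ᴸ is uᴸ - vᴸ = η vᴸ, and both η and p are multiples of π. Primality enters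
      -- through the contrapositive `π∤-^`, hence the appeal to decidability.
      π∣u-v : π∣ u - v
      π∣u-v = decidable-stable (π∣? (u - v)) λ π∤u-v → π∤-^ L π∤u-v π∣[u-v]ᴸ
        where
        [u-v]ᴸ : (u - v) ^ L ≈ₘ η * v ^ L
        [u-v]ᴸ = transₘ
          (≈ₘ-shift (transₘ
            (≈⇒≈ₘ (^-congˡ L (solve 2 (λ u v → u := u :- v :+ v) refl u v)))
            (frobenius (suc k) (u - v) v)))
          (≈⇒≈ₘ (begin
            u ^ L - v ^ L                  ≈⟨ +-congʳ uᴸ≈ξvᴸ ⟩
            ξ * v ^ L - v ^ L              ≈⟨ +-congˡ (-‿cong (*-identityˡ _)) ⟨
            ξ * v ^ L - 1# * v ^ L         ≈⟨ solve 3 (λ x w o → x :* w :- o :* w := (x :- o) :* w) refl ξ (v ^ L) 1# ⟩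
            η * v ^ L                      ∎))
        π∣[u-v]ᴸ : π∣ (u - v) ^ L
        π∣[u-v]ᴸ = π∣-resp (sym (equality [u-v]ᴸ)) (π∣-+ (π∣-*ˡ _ π∣η) (π∣-*ˡ _ π∣p))

      w = proj₁ π∣u-v

      -- (π w)ᴾ = πᴾ wᴾ, where πᴾ is η up to a multiple of p. As η ∣ p, all correction terms are
      -- multiples of η.
      lift : ∀ {x y} → x ≈ₘ y + (π * w) ^ P → π ^ P ≈ₘ η → ∃[ z ] x ≈ y + η * z
      lift {x} {y} (s ,ₘ eq) (t ,ₘ eq′) = w ^ P + q * (t * w ^ P + s) , (begin
        x
          ≈⟨ eq ⟩
        y + (π * w) ^ P + (p · 1#) * s
          ≈⟨ +-cong (+-congˡ (trans (^-distrib-* π w P) (*-congʳ eq′))) refl ⟩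
        y + (η + (p · 1#) * t) * w ^ P + (p · 1#) * s
          ≈⟨ +-cong (+-congˡ (*-congʳ (+-congˡ (*-congʳ (proj₂ η∣p))))) (*-congʳ (proj₂ η∣p)) ⟩
        y + (η + η * q * t) * w ^ P + η * q * s
          ≈⟨ solve 6 (λ y η q t wP s → y :+ (η :+ η :* q :* t) :* wP :+ η :* q :* s
               := y :+ η :* (wP :+ q :* (t :* wP :+ s))) refl y η q t (w ^ P) s ⟩
        y + η * (w ^ P + q * (t * w ^ P + s)) ∎)

      uᴾ : ∃[ z ] u ^ P ≈ v ^ P + η * z
      uᴾ = lift
        (transₘ
          (≈⇒≈ₘ (^-congˡ P (trans (solve 2 (λ u v → u := v :+ (u :- v)) refl u v) (+-congˡ (proj₂ π∣u-v)))))
          (frobenius k v (π * w)))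
        π^pᵏ≈ₘη

      z = proj₁ uᴾ

      -- The linear term p (vᴾ)ᵐ η z has one factor η from p and one from η z; this is the gain from
      -- η to η².
      [vᴾ+ηz]^p : ∀ m → suc m ≡ p → ∃[ z′ ] (v ^ P + η * z) ^ suc m ≈ (v ^ P) ^ suc m + η * (η * z′)
      [vᴾ+ηz]^p m ≡.refl = q * ((v ^ P) ^ m * z) + z * z * d , (begin
        (v ^ P + η * z) ^ suc m
          ≈⟨ proj₂ (+-^-expand commutativeRing m (v ^ P) (η * z)) ⟩
        (v ^ P) ^ suc m + (suc m · 1#) * ((v ^ P) ^ m * (η * z)) + η * z * (η * z) * d
          ≈⟨ +-congʳ (+-congˡ (*-congʳ (proj₂ η∣p))) ⟩
        (v ^ P) ^ suc m + η * q * ((v ^ P) ^ m * (η * z)) + η * z * (η * z) * d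
          ≈⟨ solve 6 (λ a η q b z d → a :+ η :* q :* (b :* (η :* z)) :+ η :* z :* (η :* z) :* d
               := a :+ η :* (η :* (q :* (b :* z) :+ z :* z :* d))) refl ((v ^ P) ^ suc m) η q ((v ^ P) ^ m) z d ⟩
        (v ^ P) ^ suc m + η * (η * (q * ((v ^ P) ^ m * z) + z * z * d)) ∎)
        where
        d = proj₁ (+-^-expand commutativeRing m (v ^ P) (η * z))

      ^P^p : ∀ x → (x ^ P) ^ p ≈ x ^ L
      ^P^p x = trans (^-assocʳ x P p) (^-congʳ x (ℕ.*-comm P p))

      expanded : ∃[ z′ ] (v ^ P + η * z) ^ p ≈ (v ^ P) ^ p + η * (η * z′)
      expanded = ≡.subst (λ m → ∃[ z′ ] (v ^ P + η * z) ^ m ≈ (v ^ P) ^ m + η * (η * z′)) suc-pred-p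
        ([vᴾ+ηz]^p (ℕ.pred p) suc-pred-p)
        where
        suc-pred-p = ℕ.suc-pred p {{prime⇒nonZero pr}}

      z′ = proj₁ expanded

      vᴸ≈ηz′ : v ^ L ≈ η * z′
      vᴸ≈ηz′ = D.*-cancelˡ η≉0 (begin
        η * v ^ L                             ≈⟨ solve 3 (λ x o w → (x :- o) :* w := x :* w :- o :* w) refl ξ 1# (v ^ L) ⟩
        ξ * v ^ L - 1# * v ^ L                ≈⟨ +-cong (sym uᴸ≈ξvᴸ) (-‿cong (*-identityˡ _)) ⟩
        u ^ L - v ^ L                         ≈⟨ +-cong (^P^p u) (-‿cong (^P^p v)) ⟨
        (u ^ P) ^ p - (v ^ P) ^ p             ≈⟨ +-congʳ (^-congˡ p (proj₂ uᴾ)) ⟩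
        (v ^ P + η * z) ^ p - (v ^ P) ^ p     ≈⟨ +-congʳ (proj₂ expanded) ⟩
        (v ^ P) ^ p + η * (η * z′) - (v ^ P) ^ p  ≈⟨ solve 2 (λ a b → a :+ b :- a := b) refl ((v ^ P) ^ p) (η * (η * z′)) ⟩
        η * (η * z′)                          ∎)

    -- Since ξ is prime to π, `valuation-unique` strips the powers of π from both sides and leaves
    -- the equation for the parts prime to π.
    no-root-unit-part : ∀ {a b} → Unit-part a → Unit-part b → ¬ (a ^ L ≈ ξ * b ^ L)
    no-root-unit-part {a} {b} (m , u , a≈ , π∤u) (n , v , b≈ , π∤v) aᴸ≈ξbᴸ =
      no-unit-root π∤u π∤v (valuation-unique (m ℕ.* L) (n ℕ.* L) (π∤-^ L π∤u) (π∤-* π∤ξ (π∤-^ L π∤v)) (begin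
        π ^ (m ℕ.* L) * u ^ L          ≈⟨ power m u ⟨
        (π ^ m * u) ^ L                ≈⟨ ^-congˡ L a≈ ⟨
        a ^ L                          ≈⟨ aᴸ≈ξbᴸ ⟩
        ξ * b ^ L                      ≈⟨ *-congˡ (trans (^-congˡ L b≈) (power n v)) ⟩
        ξ * (π ^ (n ℕ.* L) * v ^ L)    ≈⟨ solve 3 (λ x y z → x :* (y :* z) := y :* (x :* z)) refl ξ (π ^ (n ℕ.* L)) (v ^ L) ⟩
        π ^ (n ℕ.* L) * (ξ * v ^ L)    ∎))
      where
      power : ∀ m u → (π ^ m * u) ^ L ≈ π ^ (m ℕ.* L) * u ^ L
      power m u = trans (^-distrib-* (π ^ m) u L) (*-congʳ (^-assocʳ π m L))

  no-root : ∀ {a b} → ¬ (b ≈ 0#) → ¬ (a ^ L ≈ ξ * b ^ L)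
  no-root {a} {b} b≉0 aᴸ≈ξbᴸ = no-root-unit-part (unit-part a a≉0) (unit-part b b≉0) aᴸ≈ξbᴸ
    where
    0^n≈0 : ∀ n → .{{ℕ.NonZero n}} → a ≈ 0# → a ^ n ≈ 0#
    0^n≈0 (suc n) a≈0 = trans (*-congʳ a≈0) (zeroˡ _)

    a≉0 : ¬ (a ≈ 0#)
    a≉0 a≈0 = D.*-nonzero ξ≉0 (D.^-nonzero L b≉0) (trans (sym aᴸ≈ξbᴸ) (0^n≈0 L {{L≢0}} a≈0))

-- Construction of ℤ[ζ] from the group ring of ℤ/pᵏ⁺¹

module GeometricSum (R : CommutativeRing 0ℓ 0ℓ) where
  open CommutativeRing R hiding (zero)
  open Algebra.Properties.Semiring.Exp semiring
  open Algebra.Properties.Semiring.Mult semiring renaming (_×_ to _·_)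
  open import Relation.Binary.Reasoning.Setoid setoid
  open IntegerCoefficients R

  geometric : Carrier → ℕ → Carrier
  geometric y zero    = 0#
  geometric y (suc n) = 1# + y * geometric y n

  geometric-telescopes : ∀ y n → (y - 1#) * geometric y n ≈ y ^ n - 1#
  geometric-telescopes y zero    = trans (zeroʳ _) (sym (-‿inverseʳ 1#))
  geometric-telescopes y (suc n) = begin
    (y - 1#) * (1# + y * geometric y n)
      ≈⟨ solve 3 (λ y o g → (y :- o) :* (o :+ y :* g) := (y :- o) :* o :+ y :* ((y :- o) :* g)) refl y 1# (geometric y n) ⟩
    (y - 1#) * 1# + y * ((y - 1#) * geometric y n)
      ≈⟨ +-cong (*-identityʳ _) (*-congˡ (geometric-telescopes y n)) ⟩
    (y - 1#) + y * (y ^ n - 1#)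
      ≈⟨ solve 3 (λ y o u → (y :- o) :+ y :* (u :- o) := y :* u :- o :+ (y :- y :* o)) refl y 1# (y ^ n) ⟩
    y * y ^ n - 1# + (y - y * 1#)
      ≈⟨ +-congˡ (trans (+-congˡ (-‿cong (*-identityʳ y))) (-‿inverseʳ y)) ⟩
    y * y ^ n - 1# + 0#
      ≈⟨ +-identityʳ _ ⟩
    y * y ^ n - 1# ∎

  -- Each of the n powers of y is 1 modulo y - 1.
  geometric-at-1 : ∀ y n → ∃[ h ] n · 1# ≈ geometric y n + (y - 1#) * h
  geometric-at-1 y zero    = 0# , sym (trans (+-identityˡ _) (zeroʳ _))
  geometric-at-1 y (suc n) = step (geometric-at-1 y n)
    where
    step : ∃[ h ] n · 1# ≈ geometric y n + (y - 1#) * h → ∃[ h ] 1# + n · 1# ≈ 1# + y * geometric y n + (y - 1#) * h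
    step (h , eq) = h - geometric y n , (begin
      1# + n · 1#
        ≈⟨ +-congˡ eq ⟩
      1# + (geometric y n + (y - 1#) * h)
        ≈⟨ solve 4 (λ o g y h → o :+ (g :+ (y :- o) :* h) := o :+ (y :* g :+ (g :- o :* g)) :+ (y :- o) :* (h :- g)) refl 1# (geometric y n) y h ⟩
      1# + (y * geometric y n + (geometric y n - 1# * geometric y n)) + (y - 1#) * (h - geometric y n)
        ≈⟨ +-congʳ (+-congˡ (trans (+-congˡ (trans (+-congˡ (-‿cong (*-identityˡ _))) (-‿inverseʳ _))) (+-identityʳ _))) ⟩
      1# + y * geometric y n + (y - 1#) * (h - geometric y n) ∎)

  geometric-fixed : ∀ {y b} n → y * b ≈ b → geometric y n * b ≈ n · b
  geometric-fixed         zero    yb≈b = zeroˡ _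
  geometric-fixed {y} {b} (suc n) yb≈b = begin
    (1# + y * geometric y n) * b        ≈⟨ solve 4 (λ o y g b → (o :+ y :* g) :* b := o :* b :+ g :* (y :* b)) refl 1# y (geometric y n) b ⟩
    1# * b + geometric y n * (y * b)    ≈⟨ +-cong (*-identityˡ b) (trans (*-congˡ yb≈b) (geometric-fixed n yb≈b)) ⟩
    b + n · b                           ∎

  ^-fixed : ∀ {y b} n → y * b ≈ b → y ^ n * b ≈ b
  ^-fixed zero    yb≈b = *-identityˡ _
  ^-fixed (suc n) yb≈b = trans (*-assoc _ _ _) (trans (*-congˡ (^-fixed n yb≈b)) yb≈b)

-- The situation of A = ℤ[x]/(xᴸ − 1), L = pᵏ⁺¹.  The cyclotomic polynomial is
-- (xᴸ − 1)/η with η = x^(pᵏ) − 1, so it generates the annihilator of η.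
record PrimePowerGroupRing (p k : ℕ) : Set₁ where
  field
    commutativeRing : CommutativeRing 0ℓ 0ℓ
  open CommutativeRing commutativeRing public
  open Algebra.Properties.Semiring.Exp semiring public
  open Algebra.Properties.Semiring.Mult semiring public renaming (_×_ to _·_)
  open IntegerCoefficients commutativeRing public
  field
    x             : Carrier
    xᴸ≈1          : x ^ (p ℕ.^ suc k) ≈ 1#
    η≉0           : ¬ (x ^ (p ℕ.^ k) - 1# ≈ 0#)
    zero?         : ∀ a → Dec (a ≈ 0#)
    torsion-free  : ∀ a → p · a ≈ 0# → a ≈ 0#
    separated     : ∀ a → ¬ (a ≈ 0#) → ∃[ j ] ∀ b → ¬ (a ≈ (p · 1#) ^ j * b)
    ε             : Carrier → ℤ
    ε--           : ∀ a b → ε (a - b) ≡ ε a ℤ.- ε b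
    ε-*           : ∀ a b → ε (a * b) ≡ ε a ℤ.* ε b
    ε-1           : ε 1# ≡ + 1
    ε-x           : ε x ≡ + 1
    ε-expand      : ∀ a → ∃[ b ] a ≈ fromℤ (ε a) + (x - 1#) * b
    ε-annihilator : ∀ a → (x ^ (p ℕ.^ k) - 1#) * a ≈ 0# → + p ℤ.∣ ε a

module CyclotomicQuotient {p : ℕ} (pr : Prime p) {k : ℕ} (groupRing : PrimePowerGroupRing p k) where
  open PrimePowerGroupRing groupRing hiding (zero) renaming (commutativeRing to A)
  open GeometricSum A
  open import Relation.Binary.Reasoning.Setoid setoid
  private
    P = p ℕ.^ k
    L = p ℕ.^ suc k

    y η π : Carrier
    y = x ^ P
    η = y - 1#
    π = x - 1#

  open ModuloAnnihilator A η
  private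
    module R = CommutativeRing ring/ann
    module RE = Algebra.Properties.Semiring.Exp R.semiring
    module RM = Algebra.Properties.Semiring.Mult R.semiring
    module C = CyclotomicElements ring/ann p k x

    ηR≡η : C.η ≡ η
    ηR≡η = ≡.cong (_- 1#) (^ₐ≡^ x P)

    inc : ∀ {a b} → a ≈ b → a ≈ₐ b
    inc a≈b = mkₐ (*-congˡ a≈b)

    annihilated : ∀ {a} → η * a ≈ 0# → a ≈ₐ 0#
    annihilated ηa≈0 = mkₐ (trans ηa≈0 (sym (zeroʳ η)))

    annihilated⁻ : ∀ {a} → a ≈ₐ 0# → η * a ≈ 0#
    annihilated⁻ (mkₐ eq) = trans eq (zeroʳ η)

    yᵖ≈1 : y ^ p ≈ 1#
    yᵖ≈1 = trans (^-assocʳ x P p) (trans (^-congʳ x (ℕ.*-comm P p)) xᴸ≈1)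

    η*Φ≈0 : η * geometric y p ≈ 0#
    η*Φ≈0 = trans (geometric-telescopes y p) (trans (+-congʳ yᵖ≈1) (-‿inverseʳ 1#))

    -- `geometric y p` is the cyclotomic polynomial at x; it vanishes in the quotient and differs
    -- from p by a multiple of η = y - 1.
    η∣p : ∃[ q ] p · 1# ≈ₐ η * q
    η∣p = proj₁ (geometric-at-1 y p) , mkₐ (begin
      η * (p · 1#)                                    ≈⟨ *-congˡ (proj₂ (geometric-at-1 y p)) ⟩
      η * (geometric y p + η * h)                     ≈⟨ distribˡ _ _ _ ⟩
      η * geometric y p + η * (η * h)                 ≈⟨ trans (+-congʳ η*Φ≈0) (+-identityˡ _) ⟩
      η * (η * h)                                     ∎)
      where h = proj₁ (geometric-at-1 y p)

    -- a = π b in the quotient means that η annihilates a - π b, whose augmentation is that of a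
    -- because ε π = 0. With the converse `π∣-ε`, ε identifies the quotient modulo π with ℤ/p, which
    -- makes π prime and divisibility by it decidable.
    ε-π∣ : ∀ {a} → C.π∣ a → + p ℤ.∣ ε a
    ε-π∣ {a} (b , mkₐ eq) = ≡.subst (+ p ℤ.∣_) επ-drops (ε-annihilator (a - π * b) (begin
      η * (a - π * b)         ≈⟨ solve 3 (λ η a c → η :* (a :- c) := η :* a :- η :* c) refl η a (π * b) ⟩
      η * a - η * (π * b)     ≈⟨ trans (+-congʳ eq) (-‿inverseʳ _) ⟩
      0#                      ∎))
      where
      επ≡0 : ε π ≡ + 0
      επ≡0 = ≡.trans (ε-- x 1#) (≡.cong₂ ℤ._-_ ε-x ε-1)

      επ-drops : ε (a - π * b) ≡ ε a
      επ-drops = ≡.trans (ε-- a (π * b)) (≡.trans (≡.cong (λ i → ε a ℤ.- i)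
        (≡.trans (ε-* π b) (≡.trans (≡.cong (ℤ._* ε b) επ≡0) (ℤ.*-zeroˡ (ε b))))) (ℤ.+-identityʳ (ε a)))

    -- a is ε a modulo π, and in the quotient p is a multiple of η, hence of π.
    π∣-ε : ∀ {a} → + p ℤ.∣ ε a → C.π∣ a
    π∣-ε {a} (ℤ.divides m εa≡mp) = g * proj₁ η∣p * fromℤ m + b , R.trans (inc (begin
      a                           ≈⟨ proj₂ (ε-expand a) ⟩
      fromℤ (ε a) + π * b         ≡⟨ ≡.cong (λ i → fromℤ i + π * b) εa≡mp ⟩
      fromℤ (m ℤ.* + p) + π * b   ≈⟨ +-congʳ (trans (fromℤ-* m (+ p)) (*-comm _ _)) ⟩
      (p · 1#) * fromℤ m + π * b  ∎))
      (R.trans (R.+-congʳ (R.*-congʳ (proj₂ η∣p))) (inc (begin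
        η * q * fromℤ m + π * b           ≈⟨ +-congʳ (*-congʳ (*-congʳ (geometric-telescopes x P))) ⟨
        π * g * q * fromℤ m + π * b       ≈⟨ solve 5 (λ π g q m b → π :* g :* q :* m :+ π :* b := π :* (g :* q :* m :+ b)) refl π g q (fromℤ m) b ⟩
        π * (g * q * fromℤ m + b)         ∎)))
      where
      b = proj₁ (ε-expand a)
      g = geometric x P
      q = proj₁ η∣p

    -- If π a vanishes in the quotient, then x, and so y, fixes η a. Hence Φ(y) = `geometric y p`
    -- multiplies η a by p; but Φ(y) η = 0, and the group ring has no p-torsion.
    π-cancel : ∀ {a} → π * a ≈ₐ 0# → a ≈ₐ 0#
    π-cancel {a} πa≈0 = annihilated (torsion-free (η * a) (begin
      p · (η * a)                   ≈⟨ geometric-fixed p (^-fixed P xηa≈ηa) ⟨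
      geometric y p * (η * a)       ≈⟨ solve 3 (λ g η a → g :* (η :* a) := η :* g :* a) refl (geometric y p) η a ⟩
      η * geometric y p * a         ≈⟨ trans (*-congʳ η*Φ≈0) (zeroˡ a) ⟩
      0#                            ∎))
      where
      xηa≈ηa : x * (η * a) ≈ η * a
      xηa≈ηa = begin
        x * (η * a)                    ≈⟨ solve 4 (λ x o η a → x :* (η :* a) := o :* (η :* a) :+ η :* ((x :- o) :* a)) refl x 1# η a ⟩
        1# * (η * a) + η * (π * a)     ≈⟨ +-cong (*-identityˡ _) (annihilated⁻ πa≈0) ⟩
        η * a + 0#                     ≈⟨ +-identityʳ _ ⟩
        η * a                          ∎

    p≉0 : ¬ (p · 1# ≈ₐ 0#)
    p≉0 p≈0 = η≉0 (torsion-free η (begin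
      p · η           ≈⟨ ×-congʳ p (*-identityʳ η) ⟨
      p · (η * 1#)    ≈⟨ ×-comm-* p η 1# ⟨
      η * (p · 1#)    ≈⟨ annihilated⁻ p≈0 ⟩
      0#              ∎))

    separatedₐ : ∀ {a} → ¬ (a ≈ₐ 0#) → ∃[ j ] ∀ b → ¬ (a ≈ₐ (p · 1#) ^ j * b)
    separatedₐ {a} a≉0 = proj₁ sep , λ b eq → proj₂ sep (η * b)
      (trans (multiple eq) (solve 3 (λ η u b → η :* (u :* b) := u :* (η :* b)) refl η ((p · 1#) ^ proj₁ sep) b))
      where
      sep = separated (η * a) (a≉0 ∘ annihilated)

    prime-∣ : ∀ i j → + p ℤ.∣ i ℤ.* j → (+ p ℤ.∣ i) ⊎ (+ p ℤ.∣ j)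
    prime-∣ i j p∣ij = Sum.map ℤ.∣ᵤ⇒∣ ℤ.∣ᵤ⇒∣
      (euclidsLemma ℤ.∣ i ∣ ℤ.∣ j ∣ pr (≡.subst (p ∣_) (ℤ.abs-* i j) (ℤ.∣⇒∣ᵤ p∣ij)))

  cyclotomicRing : CyclotomicRing p k
  cyclotomicRing = record
    { commutativeRing = ring/ann
    ; ζ         = x
    ; ζ^pᵏ⁺¹≈1  = ≡.subst (_≈ₐ 1#) (≡.sym (^ₐ≡^ x L)) (inc xᴸ≈1)
    ; zero?     = λ a → map′ annihilated annihilated⁻ (zero? (η * a))
    ; π∣?       = λ a → map′ π∣-ε ε-π∣ (+ p ℤ.∣? ε a)
    ; π-prime   = λ {a} {b} π∣ab → Sum.map π∣-ε π∣-ε (prime-∣ (ε a) (ε b) (≡.subst (+ p ℤ.∣_) (ε-* a b) (ε-π∣ π∣ab)))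
    ; π∤1       = λ π∣1 → ¬prime[1] (≡.subst Prime (∣1⇒≡1 (ℤ.∣⇒∣ᵤ (≡.subst (+ p ℤ.∣_) ε-1 (ε-π∣ π∣1)))) pr)
    ; π-cancel  = π-cancel
    ; π∣η       = ≡.subst C.π∣_ (≡.sym ηR≡η) (geometric x P , inc (sym (geometric-telescopes x P)))
    ; η∣p       = ≡.subst₂ (λ n e → ∃[ q ] n ≈ₐ e * q) (≡.sym (×ₐ≡× p 1#)) (≡.sym ηR≡η) η∣p
    ; p≉0       = λ p≈0 → p≉0 (≡.subst (_≈ₐ 0#) (×ₐ≡× p 1#) p≈0)
    ; separated = λ a≉0 → proj₁ (separatedₐ a≉0) , λ b eq → proj₂ (separatedₐ a≉0) b
        (≡.subst (λ u → _ ≈ₐ u * b) (≡.trans (^ₐ≡^ _ (proj₁ (separatedₐ a≉0))) (≡.cong (_^ proj₁ (separatedₐ a≉0)) (×ₐ≡× p 1#))) eq)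
    }

ℤ-domain : IntegralDomain
ℤ-domain = record
  { commutativeRing = ℤ.+-*-commutativeRing
  ; zero?           = ℤ._≟ (+ 0)
  ; 1≉0             = λ ()
  ; integral        = λ {i} {j} → ℤ.i*j≡0⇒i≡0∨j≡0 i
  }

-- Residues are arbitrary naturals compared modulo n, so exponents add as in ℕ.
+-%-commutativeMonoid : (n : ℕ) → .{{ℕ.NonZero n}} → CommutativeMonoid 0ℓ 0ℓ
+-%-commutativeMonoid n = record
  { Carrier = ℕ
  ; _≈_ = λ i j → i % n ≡ j % n
  ; _∙_ = ℕ._+_
  ; ε   = 0
  ; isCommutativeMonoid = record
    { isMonoid = record
      { isSemigroup = record
        { isMagma = record
          { isEquivalence = On.isEquivalence (_% n) ≡.isEquivalence
          ; ∙-cong = λ {i} {j} {k} {l} i≡j k≡l → ≡.trans (%-distribˡ-+ i k n)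
              (≡.trans (≡.cong₂ (λ a b → (a ℕ.+ b) % n) i≡j k≡l) (≡.sym (%-distribˡ-+ j l n)))
          }
        ; assoc = λ i j k → ≡.cong (_% n) (ℕ.+-assoc i j k)
        }
      ; identity = (λ _ → ≡.refl) , (λ i → ≡.cong (_% n) (ℕ.+-identityʳ i))
      }
    ; comm = λ i j → ≡.cong (_% n) (ℕ.+-comm i j)
    }
  }

module CyclicGroupRing {p : ℕ} (pr : Prime p) (k : ℕ) where
  private
    instance
      p≢0 : ℕ.NonZero p
      p≢0 = prime⇒nonZero pr

    P L : ℕ
    P = p ℕ.^ k
    L = p ℕ.^ suc k

    instance
      P≢0 : ℕ.NonZero P
      P≢0 = ℕ.m^n≢0 p k

      L≢0 : ℕ.NonZero L
      L≢0 = ℕ.m^n≢0 p (suc k)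

    1<p : 1 ℕ.< p
    1<p = ℕ.nonTrivial⇒n>1 p {{prime⇒nonTrivial pr}}

    G : CommutativeMonoid 0ℓ 0ℓ
    G = +-%-commutativeMonoid L

  open MonoidAlgebra ℤ.+-*-commutativeRing G
  -- Classes are ordered by least residue. This order is not compatible with addition modulo L; it
  -- serves for the zero test and for comparing coefficients only.
  open LeadingTerms ℤ-domain G (ℕ._<_ on (_% L)) (On.isStrictTotalOrder (_% L) ℕ.<-isStrictTotalOrder)
  open CommutativeRing algebra hiding (zero)
  open Algebra.Properties.Semiring.Exp semiring
  open Algebra.Properties.Semiring.Mult semiring renaming (_×_ to _·_)
  open IntegerCoefficients algebra
  open GeometricSum algebra
  open import Relation.Binary.Reasoning.Setoid setoid
  open Leading

  private
    monomial : ℕ → FormalSum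
    monomial n = (+ 1 , n) ∷ []

    x : FormalSum
    x = monomial 1

    monomial-cong : ∀ {m n} → m % L ≡ n % L → monomial m ≋ monomial n
    monomial-cong m≡n = mk≋ λ φ resp → ≡.cong (λ u → + 1 ℤ.* u ℤ.+ + 0) (resp m≡n)

    x^n≈monomial : ∀ n → x ^ n ≈ monomial n
    x^n≈monomial zero    = refl
    x^n≈monomial (suc n) = *-congˡ {x} (x^n≈monomial n)

    xᴸ≈1 : x ^ L ≈ 1#
    xᴸ≈1 = trans (x^n≈monomial L) (monomial-cong (≡.trans (n%n≡0 L) (≡.sym (m*n%n≡0 0 L))))

    P<L : P ℕ.< L
    P<L = ≡.subst (P ℕ.<_) (ℕ.*-comm P p) (ℕ.m<m*n P p 1<p)

    η≉0 : ¬ (x ^ P - 1# ≈ 0#)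
    η≉0 η≈0 = ℕ.≢-nonZero⁻¹ P (≡.trans (≡.sym (m<n⇒m%n≡m P<L))
      (≡.trans (proj₁ (leading-unique {monomial P} {monomial 0} (leading-singleton λ ()) (leading-singleton λ ()) (begin
        monomial P             ≈⟨ x^n≈monomial P ⟨
        x ^ P                  ≈⟨ +-identityʳ _ ⟨
        x ^ P + 0#             ≈⟨ +-congˡ {x ^ P} (-‿inverseˡ 1#) ⟨
        x ^ P + (- 1# + 1#)    ≈⟨ +-assoc (x ^ P) (- 1#) 1# ⟨
        x ^ P - 1# + 1#        ≈⟨ +-congʳ {1#} η≈0 ⟩
        0# + 1#                ≈⟨ +-identityˡ _ ⟩
        monomial 0             ∎))) (m*n%n≡0 0 L)))

    pairing-· : ∀ n f {φ} → ⟨ n · f , φ ⟩ ≡ + n ℤ.* ⟨ f , φ ⟩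
    pairing-· zero    f {φ} = ≡.sym (ℤ.*-zeroˡ ⟨ f , φ ⟩)
    pairing-· (suc n) f {φ} = ≡.trans (pairing-++ f (n · f))
      (≡.trans (≡.cong (λ u → ⟨ f , φ ⟩ ℤ.+ u) (pairing-· n f)) (≡.sym (ℤ.suc-* (+ n) ⟨ f , φ ⟩)))

    torsion-free : ∀ f → p · f ≈ 0# → f ≈ 0#
    torsion-free f pf≈0 = mk≋ λ φ resp → ℤ.*-cancelˡ-≡ (+ p) ⟨ f , φ ⟩ (+ 0)
      (≡.trans (≡.sym (pairing-· p f)) (≡.trans (pairing pf≈0 φ resp) (≡.sym (ℤ.*-zeroʳ (+ p)))))

    p·1*≈p· : ∀ f → (p · 1#) * f ≈ p · f
    p·1*≈p· f = trans (×-assoc-* p 1# f) (×-congʳ p (*-identityˡ f))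

    pairing-p^ : ∀ j f {φ} → Respects φ → ⟨ (p · 1#) ^ j * f , φ ⟩ ≡ + (p ℕ.^ j) ℤ.* ⟨ f , φ ⟩
    pairing-p^ zero    f {φ} resp = ≡.trans (pairing (*-identityˡ f) φ resp) (≡.sym (ℤ.*-identityˡ ⟨ f , φ ⟩))
    pairing-p^ (suc j) f {φ} resp =
      ≡.trans (pairing (trans (*-assoc (p · 1#) ((p · 1#) ^ j) f) (p·1*≈p· ((p · 1#) ^ j * f))) φ resp)
      (≡.trans (pairing-· p ((p · 1#) ^ j * f))
      (≡.trans (≡.cong (+ p ℤ.*_) (pairing-p^ j f resp))
      (≡.trans (≡.sym (ℤ.*-assoc (+ p) (+ (p ℕ.^ j)) ⟨ f , φ ⟩))
      (≡.cong (ℤ._* ⟨ f , φ ⟩) (≡.sym (ℤ.pos-* p (p ℕ.^ j)))))))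

    n<p^n : ∀ n → n ℕ.< p ℕ.^ n
    n<p^n zero    = ℕ.z<s
    n<p^n (suc n) = ℕ.≤-<-trans (n<p^n n)
      (≡.subst (p ℕ.^ n ℕ.<_) (ℕ.*-comm (p ℕ.^ n) p) (ℕ.m<m*n (p ℕ.^ n) p {{ℕ.m^n≢0 p n}} 1<p))

    p^-bound : ∀ c d → ¬ (c ≡ + 0) → ¬ (c ≡ + (p ℕ.^ ℤ.∣ c ∣) ℤ.* d)
    p^-bound c d c≢0 eq = ℕ.<⇒≱ (n<p^n ℤ.∣ c ∣) (≡.subst (p ℕ.^ ℤ.∣ c ∣ ℕ.≤_)
      (≡.sym (≡.trans (≡.cong ℤ.∣_∣ eq) (ℤ.abs-* (+ (p ℕ.^ ℤ.∣ c ∣)) d)))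
      (ℕ.m≤m*n (p ℕ.^ ℤ.∣ c ∣) ℤ.∣ d ∣ {{ℕ.≢-nonZero λ ∣d∣≡0 → c≢0
        (≡.trans eq (≡.trans (≡.cong (+ (p ℕ.^ ℤ.∣ c ∣) ℤ.*_) (ℤ.∣i∣≡0⇒i≡0 ∣d∣≡0)) (ℤ.*-zeroʳ (+ (p ℕ.^ ℤ.∣ c ∣)))))}}))

    -- For the leading coefficient c ≠ 0 the exponent j = |c| suffices, because |c| < p^|c|.
    separated : ∀ f → ¬ (f ≈ 0#) → ∃[ j ] ∀ g → ¬ (f ≈ (p · 1#) ^ j * g)
    separated f f≉0 = bounded (zero-or-leading f)
      where
      bounded : f ≋ [] ⊎ (∃[ e ] ∃[ c ] Leading f e c) → ∃[ j ] ∀ g → ¬ (f ≈ (p · 1#) ^ j * g)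
      bounded (inj₁ f≈0)         = contradiction f≈0 f≉0
      bounded (inj₂ (e , c , ℓ)) = ℤ.∣ c ∣ , λ g f≈ → p^-bound c ⟨ g , δ e ⟩ (nonzero ℓ)
        (≡.trans (≡.sym (coefficient ℓ)) (≡.trans (pairing f≈ (δ e) (λ {u} {v} → δ-resp e {u} {v}))
          (pairing-p^ ℤ.∣ c ∣ g (λ {u} {v} → δ-resp e {u} {v}))))

    -- The augmentation x ↦ 1.
    ε : FormalSum → ℤ
    ε f = ⟨ f , const (+ 1) ⟩

    ε-- : ∀ f g → ε (f - g) ≡ ε f ℤ.- ε g
    ε-- f g = ≡.trans (pairing-++ f (negate g)) (≡.cong (λ i → ε f ℤ.+ i) (pairing-negate g))

    ε-* : ∀ f g → ε (f * g) ≡ ε f ℤ.* ε g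
    ε-* f g = ≡.trans (pairing-⊛ f g)
      (≡.trans (pairing-cong f (λ _ → ≡.sym (ℤ.*-identityʳ (ε g))))
      (≡.trans (pairing-* f (ε g)) (ℤ.*-comm (ε g) (ε f))))

    pairing-fromℤ : ∀ i {φ} → ⟨ fromℤ i , φ ⟩ ≡ i ℤ.* φ 0
    pairing-fromℤ (+ n)    {φ} = ≡.trans (pairing-· n 1#)
      (≡.cong (+ n ℤ.*_) (≡.trans (ℤ.+-identityʳ _) (ℤ.*-identityˡ (φ 0))))
    pairing-fromℤ -[1+ n ] {φ} = ≡.trans (pairing-negate (suc n · 1#) {φ})
      (≡.trans (≡.cong ℤ.-_ (pairing-fromℤ (+ suc n) {φ})) (ℤ.neg-distribˡ-* (+ suc n) (φ 0)))

    singleton≈ : ∀ c n → (c , n) ∷ [] ≋ fromℤ c * x ^ n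
    singleton≈ c n = trans (mk≋ λ φ resp →
        ≡.sym (≡.trans (pairing-⊛ (fromℤ c) (monomial n))
          (≡.trans (pairing-fromℤ c) (≡.trans
            (≡.cong (c ℤ.*_) (≡.trans (ℤ.+-identityʳ _) (ℤ.*-identityˡ (φ n))))
            (≡.sym (ℤ.+-identityʳ _))))))
      (*-congˡ {fromℤ c} (sym (x^n≈monomial n)))

    ε-expand : ∀ f → ∃[ b ] f ≈ fromℤ (ε f) + (x - 1#) * b
    ε-expand []            = 0# , sym (zeroʳ (x - 1#))
    ε-expand ((c , n) ∷ f) = step (ε-expand f)
      where
      π = x - 1#
      step : ∃[ b ] f ≈ fromℤ (ε f) + π * b → ∃[ b ] (c , n) ∷ f ≈ fromℤ (ε ((c , n) ∷ f)) + π * b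
      step (b , eq) = fromℤ c * geometric x n + b , (begin
        (c , n) ∷ f
          ≈⟨ +-cong (singleton≈ c n) eq ⟩
        fromℤ c * x ^ n + (fromℤ (ε f) + π * b)
          ≈⟨ +-congʳ {fromℤ (ε f) + π * b} (*-congˡ {fromℤ c} xⁿ≈) ⟩
        fromℤ c * (1# + π * geometric x n) + (fromℤ (ε f) + π * b)
          ≈⟨ solve 6 (λ c o π g e b → c :* (o :+ π :* g) :+ (e :+ π :* b) := (c :* o :+ e) :+ π :* (c :* g :+ b)) refl (fromℤ c) 1# π (geometric x n) (fromℤ (ε f)) b ⟩
        (fromℤ c * 1# + fromℤ (ε f)) + π * (fromℤ c * geometric x n + b)
          ≈⟨ +-congʳ {π * (fromℤ c * geometric x n + b)} (+-congʳ {fromℤ (ε f)} (trans (*-identityʳ (fromℤ c)) (reflexive (≡.cong fromℤ (≡.sym (ℤ.*-identityʳ c)))))) ⟩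
        (fromℤ (c ℤ.* + 1) + fromℤ (ε f)) + π * (fromℤ c * geometric x n + b)
          ≈⟨ +-congʳ {π * (fromℤ c * geometric x n + b)} (fromℤ-+ (c ℤ.* + 1) (ε f)) ⟨
        fromℤ (c ℤ.* + 1 ℤ.+ ε f) + π * (fromℤ c * geometric x n + b) ∎)
        where
        xⁿ≈ : x ^ n ≈ 1# + π * geometric x n
        xⁿ≈ = sym (trans (+-congˡ {1#} (geometric-telescopes x n))
          (solve 2 (λ o u → o :+ (u :- o) := u) refl 1# (x ^ n)))

    -- ψ is periodic modulo L, and modulo p it increases by 1 under translation by P.
    -- Pairing η f = 0 with ψ therefore gives ε f = 0 modulo p.
    ψ χ : ℕ → ℤ
    ψ i = + (i % L / P)
    χ i = + (i / P / p) ℤ.- + ((P ℕ.+ i) / P / p)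

    ψ-translate : ∀ i → ψ (P ℕ.+ i) ≡ ψ i ℤ.+ (+ 1 ℤ.+ + p ℤ.* χ i)
    ψ-translate i = ≡.trans (digit (P ℕ.+ i)) (≡.trans
      (≡.cong (λ m → + m ℤ.- + ((P ℕ.+ i) / P / p) ℤ.* + p) [P+i]/P)
      (≡.trans (regroup (+ (i / P)) (+ (i / P / p)) (+ ((P ℕ.+ i) / P / p)) (+ p))
        (≡.cong (ℤ._+ (+ 1 ℤ.+ + p ℤ.* χ i)) (≡.sym (digit i)))))
      where
      [P+i]/P : (P ℕ.+ i) / P ≡ suc (i / P)
      [P+i]/P = ≡.trans (ℕ.+-distrib-/-∣ˡ {P} i {P} ∣-refl) (≡.cong (ℕ._+ i / P) (ℕ.n/n≡1 P))

      -- ψ i is (i / P) modulo p, written as a difference so that the carry caused by translation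
      -- becomes p times χ.
      digit : ∀ i → ψ i ≡ + (i / P) ℤ.- + (i / P / p) ℤ.* + p
      digit i = ≡.trans (≡.cong +_ (m%[n*o]/o≡m/o%n i p P)) (≡.sym (≡.trans
        (≡.cong₂ (λ u v → + u ℤ.- v) (m≡m%n+[m/n]*n (i / P) p) (≡.sym (ℤ.pos-* (i / P / p) p)))
        (≡.trans (≡.cong (λ u → u ℤ.- + (i / P / p ℕ.* p)) (ℤ.pos-+ (i / P % p) (i / P / p ℕ.* p)))
          (cancel (+ (i / P % p)) (+ (i / P / p ℕ.* p))))))
        where
        open IntegerCoefficients ℤ.+-*-commutativeRing using () renaming (solve to solveℤ; _:=_ to _≔_; _:+_ to _⊕_; _:-_ to _⊖_)
        cancel : ∀ a b → a ℤ.+ b ℤ.- b ≡ a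
        cancel = solveℤ 2 (λ a b → ((a ⊕ b) ⊖ b) ≔ a) ≡.refl

      regroup : ∀ m a b q → (+ 1 ℤ.+ m) ℤ.- b ℤ.* q ≡ (m ℤ.- a ℤ.* q) ℤ.+ (+ 1 ℤ.+ q ℤ.* (a ℤ.- b))
      regroup m a b q = solveℤ 5 (λ o m a b q → ((o ⊕ m) ⊖ (b ⊗ q)) ≔ ((m ⊖ (a ⊗ q)) ⊕ (o ⊕ (q ⊗ (a ⊖ b))))) ≡.refl (+ 1) m a b q
        where
        open IntegerCoefficients ℤ.+-*-commutativeRing using () renaming (solve to solveℤ; _:=_ to _≔_; _:+_ to _⊕_; _:-_ to _⊖_; _:*_ to _⊗_)

    ε-annihilator : ∀ f → (x ^ P - 1#) * f ≈ 0# → + p ℤ.∣ ε f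
    -- The witness comes from 0 = ⟨ η f , ψ ⟩ = ε f + p ⟨ f , χ ⟩.
    ε-annihilator f ηf≈0 = ℤ.divides (ℤ.- ⟨ f , χ ⟩) (≡-Reasoning.begin
      ε f                                               ≡-Reasoning.≡⟨ cancel ⟨ f , ψ ⟩ (ε f) (+ p) ⟨ f , χ ⟩ ⟩
      (⟨ f , ψ ⟩ ℤ.+ (ε f ℤ.+ + p ℤ.* ⟨ f , χ ⟩)) ℤ.- ⟨ f , ψ ⟩ ℤ.+ ℤ.- ⟨ f , χ ⟩ ℤ.* + p
        ≡-Reasoning.≡⟨ ≡.cong (λ u → u ℤ.- ⟨ f , ψ ⟩ ℤ.+ ℤ.- ⟨ f , χ ⟩ ℤ.* + p) translated ⟨
      ⟨ f , ψ ∘ (P ℕ.+_) ⟩ ℤ.- ⟨ f , ψ ⟩ ℤ.+ ℤ.- ⟨ f , χ ⟩ ℤ.* + p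
        ≡-Reasoning.≡⟨ ≡.cong (ℤ._+ ℤ.- ⟨ f , χ ⟩ ℤ.* + p) difference ⟩
      + 0 ℤ.+ ℤ.- ⟨ f , χ ⟩ ℤ.* + p                     ≡-Reasoning.≡⟨ ℤ.+-identityˡ _ ⟩
      ℤ.- ⟨ f , χ ⟩ ℤ.* + p                             ≡-Reasoning.∎)
      where
      open IntegerCoefficients ℤ.+-*-commutativeRing using () renaming (solve to solveℤ; _:=_ to _≔_; _:+_ to _⊕_; _:-_ to _⊖_; _:*_ to _⊗_; :-_ to ⊝_)
      cancel : ∀ a e q c → e ≡ (a ℤ.+ (e ℤ.+ q ℤ.* c)) ℤ.- a ℤ.+ ℤ.- c ℤ.* q
      cancel = solveℤ 4 (λ a e q c → e ≔ (((a ⊕ (e ⊕ (q ⊗ c))) ⊖ a) ⊕ ((⊝ c) ⊗ q))) ≡.refl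

      translated : ⟨ f , ψ ∘ (P ℕ.+_) ⟩ ≡ ⟨ f , ψ ⟩ ℤ.+ (ε f ℤ.+ + p ℤ.* ⟨ f , χ ⟩)
      translated = ≡.trans (pairing-cong f ψ-translate) (≡.trans (pairing-+ f)
        (≡.cong (λ u → ⟨ f , ψ ⟩ ℤ.+ u) (≡.trans (pairing-+ f) (≡.cong (λ u → ε f ℤ.+ u) (pairing-* f (+ p))))))

      difference : ⟨ f , ψ ∘ (P ℕ.+_) ⟩ ℤ.- ⟨ f , ψ ⟩ ≡ + 0
      difference = ≡.trans
        (≡.cong₂ ℤ._+_
          (≡.sym (≡.trans (pairing-⊛ (monomial P) f {ψ}) (≡.trans (ℤ.+-identityʳ _) (ℤ.*-identityˡ ⟨ f , ψ ∘ (P ℕ.+_) ⟩))))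
          (≡.sym (≡.trans (pairing-negate (1# * f) {ψ}) (≡.cong ℤ.-_ (pairing (*-identityˡ f) ψ λ i≡j → ≡.cong (λ i → + (i / P)) i≡j)))))
        (≡.trans (≡.sym (pairing-++ (monomial P * f) (- (1# * f))))
          (pairing
            (trans (+-congʳ { - (1# * f) } (*-congʳ {f} (sym (x^n≈monomial P))))
              (trans (solve 3 (λ y o f → y :* f :- o :* f := (y :- o) :* f) refl (x ^ P) 1# f) ηf≈0))
            ψ λ i≡j → ≡.cong (λ i → + (i / P)) i≡j))

  cyclotomicRing : CyclotomicRing p k
  cyclotomicRing = CyclotomicQuotient.cyclotomicRing pr record
    { commutativeRing = algebra
    ; x               = x
    ; xᴸ≈1            = xᴸ≈1
    ; η≉0             = η≉0
    ; zero?           = zero?ᴬ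
    ; torsion-free    = torsion-free
    ; separated       = separated
    ; ε               = ε
    ; ε--             = ε--
    ; ε-*             = ε-*
    ; ε-1             = ≡.refl
    ; ε-x             = ≡.refl
    ; ε-expand        = ε-expand
    ; ε-annihilator   = ε-annihilator
    }

-- Discrete fields and fields of fractions

record DiscreteField : Set₁ where
  field
    commutativeRing : CommutativeRing 0ℓ 0ℓ
  open CommutativeRing commutativeRing
  field
    zero?   : ∀ x → Dec (x ≈ 0#)
    1≉0     : ¬ (1# ≈ 0#)
    inverse : ∀ {x} → ¬ (x ≈ 0#) → ∃[ y ] x * y ≈ 1#

  domain : IntegralDomain
  domain = record
    { commutativeRing = commutativeRing
    ; zero?           = zero?
    ; 1≉0             = 1≉0
    ; integral        = λ {x} {y} xy≈0 → integral (zero? x) xy≈0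
    }
    where
    integral : ∀ {x y} → Dec (x ≈ 0#) → x * y ≈ 0# → x ≈ 0# ⊎ y ≈ 0#
    integral         (yes x≈0) _    = inj₁ x≈0
    integral {x} {y} (no x≉0)  xy≈0 = inj₂
      (trans (sym (*-identityˡ y))
      (trans (*-congʳ (trans (sym (proj₂ (inverse x≉0))) (*-comm x (proj₁ (inverse x≉0)))))
      (trans (*-assoc (proj₁ (inverse x≉0)) x y) (trans (*-congˡ xy≈0) (zeroʳ (proj₁ (inverse x≉0)))))))

  open IntegralDomain domain using (_≟_; x∙y⁻¹≈ε⇒x≈y; x≈y⇒x∙y⁻¹≈ε)

  -- Apartness is denial of equality; decidability provides cotransitivity and tightness.
  asField : Field
  asField = record
    { Carrier = Carrier
    ; _≈_     = _≈_
    ; _#_     = λ x y → ¬ (x ≈ y)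
    ; _+_     = _+_
    ; _*_     = _*_
    ; -_      = -_
    ; 0#      = 0#
    ; 1#      = 1#
    ; isHeytingField = record
      { isHeytingCommutativeRing = record
        { isCommutativeRing   = isCommutativeRing
        ; isApartnessRelation = record
          { irrefl  = λ x≈y x≉y → x≉y x≈y
          ; sym     = λ x≉y y≈x → x≉y (sym y≈x)
          ; cotrans = λ {x} x≉y z → separate x≉y (x ≟ z)
          }
        ; #⇒invertible = λ {x} {y} x≉y →
            let y⁻¹ , eq = inverse (λ x-y≈0 → x≉y (x∙y⁻¹≈ε⇒x≈y x y x-y≈0))
            in y⁻¹ , trans (*-comm _ _) eq , eq
        ; invertible⇒# = λ (z , _ , eq) x≈y →
            1≉0 (trans (sym eq) (trans (*-congʳ (x≈y⇒x∙y⁻¹≈ε x≈y)) (zeroˡ z)))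
        }
      ; tight = λ x y → decidable-stable (x ≟ y) , (λ x≈y x≉y → x≉y x≈y)
      }
    }
    where
    separate : ∀ {x y z} → ¬ (x ≈ y) → Dec (x ≈ z) → ¬ (x ≈ z) ⊎ ¬ (z ≈ y)
    separate x≉y (yes x≈z) = inj₂ λ z≈y → x≉y (trans x≈z z≈y)
    separate x≉y (no  x≉z) = inj₁ x≉z

module Fractions (D : IntegralDomain) where
  open IntegralDomain D hiding (zero)
  open IntegerCoefficients commutativeRing
  open import Relation.Binary.Reasoning.Setoid setoid

  infix 4 _≃_
  infix 5 _÷_

  record Fraction : Set where
    field
      numerator   : Carrier
      denominator : Carrier
      nonzero     : ¬ (denominator ≈ 0#)

  open Fraction public

  record _≃_ (x y : Fraction) : Set where
    constructor mk≃
    field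
      cross : numerator x * denominator y ≈ numerator y * denominator x

  open _≃_ public

  _÷_ : Carrier → Σ[ d ∈ Carrier ] ¬ (d ≈ 0#) → Fraction
  n ÷ (d , d≉0) = record { numerator = n ; denominator = d ; nonzero = d≉0 }

  private
    _⊕_ _⊛_ : Fraction → Fraction → Fraction
    x ⊕ y = (numerator x * denominator y + numerator y * denominator x)
          ÷ (denominator x * denominator y , *-nonzero (nonzero x) (nonzero y))
    x ⊛ y = (numerator x * numerator y)
          ÷ (denominator x * denominator y , *-nonzero (nonzero x) (nonzero y))

    ⊝_ : Fraction → Fraction
    ⊝ x = (- numerator x) ÷ (denominator x , nonzero x)

  embed : Carrier → Fraction
  embed a = a ÷ (1# , 1≉0)

  private
    ≃-trans : ∀ {x y z} → x ≃ y → y ≃ z → x ≃ z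
    ≃-trans {x} {y} {z} (mk≃ p) (mk≃ q) = mk≃ (*-cancelˡ (nonzero y) (begin
      dy * (nx * dz)    ≈⟨ solve 3 (λ a b c → a :* (b :* c) := b :* a :* c) refl dy nx dz ⟩
      nx * dy * dz      ≈⟨ *-congʳ p ⟩
      ny * dx * dz      ≈⟨ solve 3 (λ a b c → a :* b :* c := a :* c :* b) refl ny dx dz ⟩
      ny * dz * dx      ≈⟨ *-congʳ q ⟩
      nz * dy * dx      ≈⟨ solve 3 (λ a b c → a :* b :* c := b :* (a :* c)) refl nz dy dx ⟩
      dy * (nz * dx)    ∎))
      where
      nx = numerator x ; dx = denominator x
      ny = numerator y ; dy = denominator y
      nz = numerator z ; dz = denominator z

    ⊕-cong : ∀ {x y u v} → x ≃ y → u ≃ v → (x ⊕ u) ≃ (y ⊕ v)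
    ⊕-cong {x} {y} {u} {v} (mk≃ p) (mk≃ q) = mk≃ (begin
      (nx * du + nu * dx) * (dy * dv)
        ≈⟨ solve 6 (λ nx du nu dx dy dv → (nx :* du :+ nu :* dx) :* (dy :* dv) := (nx :* dy) :* (du :* dv) :+ (nu :* dv) :* (dx :* dy)) refl nx du nu dx dy dv ⟩
      (nx * dy) * (du * dv) + (nu * dv) * (dx * dy)
        ≈⟨ +-cong (*-congʳ p) (*-congʳ q) ⟩
      (ny * dx) * (du * dv) + (nv * du) * (dx * dy)
        ≈⟨ solve 6 (λ ny dx du dv nv dy → (ny :* dx) :* (du :* dv) :+ (nv :* du) :* (dx :* dy) := (ny :* dv :+ nv :* dy) :* (dx :* du)) refl ny dx du dv nv dy ⟩
      (ny * dv + nv * dy) * (dx * du) ∎)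
      where
      nx = numerator x ; dx = denominator x
      ny = numerator y ; dy = denominator y
      nu = numerator u ; du = denominator u
      nv = numerator v ; dv = denominator v

    ⊛-cong : ∀ {x y u v} → x ≃ y → u ≃ v → (x ⊛ u) ≃ (y ⊛ v)
    ⊛-cong {x} {y} {u} {v} (mk≃ p) (mk≃ q) = mk≃ (begin
      (nx * nu) * (dy * dv)   ≈⟨ solve 4 (λ a b c d → (a :* b) :* (c :* d) := (a :* c) :* (b :* d)) refl nx nu dy dv ⟩
      (nx * dy) * (nu * dv)   ≈⟨ *-cong p q ⟩
      (ny * dx) * (nv * du)   ≈⟨ solve 4 (λ a b c d → (a :* b) :* (c :* d) := (a :* c) :* (b :* d)) refl ny dx nv du ⟩
      (ny * nv) * (dx * du)   ∎)
      where
      nx = numerator x ; dx = denominator x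
      ny = numerator y ; dy = denominator y
      nu = numerator u ; du = denominator u
      nv = numerator v ; dv = denominator v

    ⊕-comm : ∀ x y → (x ⊕ y) ≃ (y ⊕ x)
    ⊕-comm x y = mk≃ (solve 4 (λ a b c d → (a :* d :+ c :* b) :* (d :* b) := (c :* b :+ a :* d) :* (b :* d)) refl
      (numerator x) (denominator x) (numerator y) (denominator y))

    ⊛-comm : ∀ x y → (x ⊛ y) ≃ (y ⊛ x)
    ⊛-comm x y = mk≃ (solve 4 (λ a b c d → (a :* c) :* (d :* b) := (c :* a) :* (b :* d)) refl
      (numerator x) (denominator x) (numerator y) (denominator y))

    ≃-from-≈ : ∀ {x y} → numerator x ≈ numerator y → denominator x ≈ denominator y → x ≃ y
    ≃-from-≈ n≈ d≈ = mk≃ (*-cong n≈ (sym d≈))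

    ⊕-identityˡ : ∀ x → (embed 0# ⊕ x) ≃ x
    ⊕-identityˡ x = ≃-from-≈
      (trans (+-cong (zeroˡ _) (*-identityʳ _)) (+-identityˡ _)) (*-identityˡ _)

    ⊛-identityˡ : ∀ x → (embed 1# ⊛ x) ≃ x
    ⊛-identityˡ x = ≃-from-≈ (*-identityˡ _) (*-identityˡ _)

    ⊕-inverseˡ : ∀ x → ((⊝ x) ⊕ x) ≃ embed 0#
    ⊕-inverseˡ x = mk≃ (trans
      (*-congʳ (solve 2 (λ a b → :- a :* b :+ a :* b := con (ℤ.+ 0)) refl (numerator x) (denominator x)))
      (trans (zeroˡ _) (sym (zeroˡ _))))

    ⊛-distribˡ : ∀ x y z → (x ⊛ (y ⊕ z)) ≃ ((x ⊛ y) ⊕ (x ⊛ z))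
    ⊛-distribˡ x y z = mk≃ (solve 6 (λ a b c d e f →
      (a :* (c :* f :+ e :* d)) :* ((b :* d) :* (b :* f)) := ((a :* c) :* (b :* f) :+ (a :* e) :* (b :* d)) :* (b :* (d :* f))) refl
      (numerator x) (denominator x) (numerator y) (denominator y) (numerator z) (denominator z))

  fractionRing : CommutativeRing 0ℓ 0ℓ
  fractionRing = record
    { Carrier = Fraction
    ; _≈_ = _≃_
    ; _+_ = _⊕_
    ; _*_ = _⊛_
    ; -_  = ⊝_
    ; 0#  = embed 0#
    ; 1#  = embed 1#
    ; isCommutativeRing = record
      { isRing = record
        { +-isAbelianGroup = record
          { isGroup = record
            { isMonoid = record
              { isSemigroup = record
                { isMagma = record
                  { isEquivalence = record
                    { refl  = mk≃ refl
                    ; sym   = λ (mk≃ p) → mk≃ (sym p)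
                    ; trans = ≃-trans
                    }
                  ; ∙-cong = ⊕-cong
                  }
                ; assoc = λ x y z → mk≃ (solve 6 (λ a b c d e f →
                    ((a :* d :+ c :* b) :* f :+ e :* (b :* d)) :* (b :* (d :* f)) := (a :* (d :* f) :+ (c :* f :+ e :* d) :* b) :* ((b :* d) :* f)) refl
                    (numerator x) (denominator x) (numerator y) (denominator y) (numerator z) (denominator z))
                }
              ; identity = ⊕-identityˡ , (λ x → ≃-trans (⊕-comm x (embed 0#)) (⊕-identityˡ x))
              }
            ; inverse = ⊕-inverseˡ , (λ x → ≃-trans (⊕-comm x (⊝ x)) (⊕-inverseˡ x))
            ; ⁻¹-cong = λ (mk≃ p) → mk≃ (trans (sym (-‿distribˡ-* _ _)) (trans (-‿cong p) (-‿distribˡ-* _ _)))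
            }
          ; comm = ⊕-comm
          }
        ; *-cong = ⊛-cong
        ; *-assoc = λ x y z → ≃-from-≈ (*-assoc _ _ _) (*-assoc _ _ _)
        ; *-identity = ⊛-identityˡ , (λ x → ≃-trans (⊛-comm x (embed 1#)) (⊛-identityˡ x))
        ; distrib = ⊛-distribˡ , (λ x y z → ≃-trans (⊛-comm (y ⊕ z) x)
            (≃-trans (⊛-distribˡ x y z) (⊕-cong (⊛-comm x y) (⊛-comm x z))))
        }
      ; *-comm = ⊛-comm
      }
    }

  ≃0⁺ : ∀ {x} → numerator x ≈ 0# → x ≃ embed 0#
  ≃0⁺ n≈0 = mk≃ (trans (*-identityʳ _) (trans n≈0 (sym (zeroˡ _))))

  ≃0⁻ : ∀ {x} → x ≃ embed 0# → numerator x ≈ 0#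
  ≃0⁻ (mk≃ p) = trans (sym (*-identityʳ _)) (trans p (zeroˡ _))

  fractionField : DiscreteField
  fractionField = record
    { commutativeRing = fractionRing
    ; zero?           = λ x → map′ ≃0⁺ ≃0⁻ (zero? (numerator x))
    ; 1≉0             = λ 1≃0 → 1≉0 (≃0⁻ 1≃0)
    ; inverse         = λ {x} x≄0 → denominator x ÷ (numerator x , x≄0 ∘ ≃0⁺) ,
        mk≃ (trans (*-identityʳ _) (trans (*-comm _ _) (sym (*-identityˡ _))))
    }

  embed-cong : ∀ {a b} → a ≈ b → embed a ≃ embed b
  embed-cong a≈b = mk≃ (*-congʳ a≈b)

  embed-injective : ∀ {a b} → embed a ≃ embed b → a ≈ b
  embed-injective (mk≃ p) = trans (sym (*-identityʳ _)) (trans p (*-identityʳ _))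

  private
    module F = CommutativeRing fractionRing
    module FE = Algebra.Properties.Semiring.Exp F.semiring
    module FM = Algebra.Properties.Semiring.Mult F.semiring
    module M = Algebra.Properties.Semiring.Mult semiring

  embed-^ : ∀ a n → embed (a ^ n) ≃ embed a FE.^ n
  embed-^ a zero    = F.refl
  embed-^ a (suc n) = F.trans (mk≃ (*-congˡ (*-identityʳ 1#))) (F.*-congˡ {embed a} (embed-^ a n))

  embed-× : ∀ n → embed (n M.× 1#) ≃ n FM.× F.1#
  embed-× zero    = F.refl
  embed-× (suc n) = F.trans
    (mk≃ (trans (*-congˡ (*-identityʳ 1#)) (*-congʳ (sym (+-cong (*-identityʳ 1#) (*-identityʳ _))))))
    (F.+-congˡ {F.1#} (embed-× n))

  module _ {σ : Carrier → Carrier} (σ-hom : IsRingHomomorphism rawRing rawRing σ)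
           (σ-injective : ∀ {a} → σ a ≈ 0# → a ≈ 0#) where
    open IsRingHomomorphism σ-hom

    mapFraction : Fraction → Fraction
    mapFraction x = σ (numerator x) ÷ (σ (denominator x) , nonzero x ∘ σ-injective)

    mapFraction-isRingHomomorphism : IsRingHomomorphism F.rawRing F.rawRing mapFraction
    mapFraction-isRingHomomorphism = record
      { isSemiringHomomorphism = record
        { isNearSemiringHomomorphism = record
          { +-isMonoidHomomorphism = record
            { isMagmaHomomorphism = record
              { isRelHomomorphism = record
                { cong = λ (mk≃ p) → mk≃ (trans (sym (*-homo _ _)) (trans (⟦⟧-cong p) (*-homo _ _))) }
              ; homo = λ x y → ≃-from-≈ (trans (+-homo _ _) (+-cong (*-homo _ _) (*-homo _ _))) (*-homo _ _)
              }
            ; ε-homo = ≃0⁺ 0#-homo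
            }
          ; *-homo = λ x y → ≃-from-≈ (*-homo _ _) (*-homo _ _)
          }
        ; 1#-homo = mk≃ (*-cong 1#-homo (sym 1#-homo))
        }
      ; -‿homo = λ x → ≃-from-≈ (-‿homo _) refl
      }

-- Polynomials over a field: roots and interpolation

-- A polynomial is its vector a₀, …, a_{d-1} of coefficients.
module Polynomials (K : DiscreteField) where
  open DiscreteField K
  open CommutativeRing commutativeRing hiding (zero)
  open IntegralDomain domain using (x∙y⁻¹≈ε⇒x≈y; *-cancelˡ)
  open Algebra.Properties.Semiring.Exp semiring
  open Algebra.Properties.Semiring.Sum semiring
  open IntegerCoefficients commutativeRing
  open import Relation.Binary.Reasoning.Setoid setoid

  eval : ∀ {d} → (Fin d → Carrier) → Carrier → Carrier
  eval a x = sum (λ i → a i * x ^ toℕ i)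

  eval-cong : ∀ {d} {a b : Fin d → Carrier} {x y} → (∀ i → a i ≈ b i) → x ≈ y → eval a x ≈ eval b y
  eval-cong a≈b x≈y = sum-cong-≋ λ i → *-cong (a≈b i) (^-congˡ (toℕ i) x≈y)

  eval-zero : ∀ {d} (a : Fin d → Carrier) x → (∀ i → a i ≈ 0#) → eval a x ≈ 0#
  eval-zero {d} a x a≈0 = trans (sum-cong-≋ {d} λ i → trans (*-congʳ (a≈0 i)) (zeroˡ (x ^ toℕ i))) (sum-replicate-zero d)

  eval-suc : ∀ {d} (a : Fin (suc d) → Carrier) x → eval a x ≈ a zero + x * eval (a ∘ suc) x
  eval-suc {d} a x = +-cong (*-identityʳ (a zero)) (begin
    sum (λ i → a (suc i) * (x * x ^ toℕ i))      ≈⟨ sum-cong-≋ {d} (λ i → solve 3 (λ a x y → a :* (x :* y) := x :* (a :* y)) refl (a (suc i)) x (x ^ toℕ i)) ⟩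
    sum (λ i → x * (a (suc i) * x ^ toℕ i))      ≈⟨ *-distribˡ-sum x (λ i → a (suc i) * x ^ toℕ i) ⟨
    x * sum (λ i → a (suc i) * x ^ toℕ i)        ∎)

  eval-sub : ∀ {d} (a b : Fin d → Carrier) x → eval (λ i → a i - b i) x ≈ eval a x - eval b x
  eval-sub {zero}  a b x = sym (-‿inverseʳ 0#)
  eval-sub {suc d} a b x = begin
    eval (λ i → a i - b i) x
      ≈⟨ eval-suc (λ i → a i - b i) x ⟩
    (a zero - b zero) + x * eval (λ i → a (suc i) - b (suc i)) x
      ≈⟨ +-congˡ (*-congˡ (eval-sub (a ∘ suc) (b ∘ suc) x)) ⟩
    (a zero - b zero) + x * (eval (a ∘ suc) x - eval (b ∘ suc) x)
      ≈⟨ solve 5 (λ a b x u v → (a :- b) :+ x :* (u :- v) := (a :+ x :* u) :- (b :+ x :* v)) refl (a zero) (b zero) x (eval (a ∘ suc) x) (eval (b ∘ suc) x) ⟩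
    (a zero + x * eval (a ∘ suc) x) - (b zero + x * eval (b ∘ suc) x)
      ≈⟨ +-cong (eval-suc a x) (-‿cong (eval-suc b x)) ⟨
    eval a x - eval b x ∎

  -- Synthetic division by X - r: coefficient i of the quotient is the value at r of the polynomial
  -- with coefficients aᵢ₊₁, aᵢ₊₂, ....
  quotient : ∀ {d} → Carrier → (Fin (suc d) → Carrier) → Fin d → Carrier
  quotient {suc d} r a zero    = eval (a ∘ suc) r
  quotient {suc d} r a (suc i) = quotient r (a ∘ suc) i

  eval-quotient : ∀ {d} r (a : Fin (suc d) → Carrier) x → eval a x ≈ eval a r + (x - r) * eval (quotient r a) x
  eval-quotient {zero}  r a x = sym (trans (+-congˡ (zeroʳ (x - r))) (+-identityʳ (eval a r)))
  eval-quotient {suc d} r a x = begin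
    eval a x
      ≈⟨ eval-suc a x ⟩
    a zero + x * eval (a ∘ suc) x
      ≈⟨ +-congˡ (*-congˡ (eval-quotient r (a ∘ suc) x)) ⟩
    a zero + x * (e + (x - r) * q)
      ≈⟨ solve 5 (λ a x r e q → a :+ x :* (e :+ (x :- r) :* q) := (a :+ r :* e) :+ (x :- r) :* (e :+ x :* q)) refl (a zero) x r e q ⟩
    (a zero + r * e) + (x - r) * (e + x * q)
      ≈⟨ +-cong (eval-suc a r) (*-congˡ (eval-suc (quotient r a) x)) ⟨
    eval a r + (x - r) * eval (quotient r a) x ∎
    where
    e = eval (a ∘ suc) r
    q = eval (quotient r (a ∘ suc)) x

  quotient-zero : ∀ {d} r (a : Fin (suc d) → Carrier) → eval a r ≈ 0# → (∀ i → quotient r a i ≈ 0#) → ∀ i → a i ≈ 0#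
  quotient-zero {zero}  r a ar≈0 q≈0 zero    = trans (sym (trans (+-identityʳ (a zero * 1#)) (*-identityʳ (a zero)))) ar≈0
  quotient-zero {suc d} r a ar≈0 q≈0 zero    = begin
    a zero                          ≈⟨ +-identityʳ (a zero) ⟨
    a zero + 0#                     ≈⟨ +-congˡ (trans (*-congˡ (q≈0 zero)) (zeroʳ r)) ⟨
    a zero + r * eval (a ∘ suc) r   ≈⟨ eval-suc a r ⟨
    eval a r                        ≈⟨ ar≈0 ⟩
    0#                              ∎
  quotient-zero {suc d} r a ar≈0 q≈0 (suc i) = quotient-zero r (a ∘ suc) (q≈0 zero) (q≈0 ∘ suc) i

  Distinct : ∀ {d} → (Fin d → Carrier) → Set
  Distinct xs = ∀ i j → xs i ≈ xs j → i ≡ j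

  distinct-tail : ∀ {d} {xs : Fin (suc d) → Carrier} → Distinct xs → Distinct (xs ∘ suc)
  distinct-tail distinct i j eq = Fin.suc-injective (distinct (suc i) (suc j) eq)

  distinct-head : ∀ {d} {xs : Fin (suc d) → Carrier} → Distinct xs → ∀ i → ¬ (xs (suc i) - xs zero ≈ 0#)
  distinct-head distinct i eq = Fin.0≢1+n (≡.sym (distinct (suc i) zero (x∙y⁻¹≈ε⇒x≈y _ _ eq)))

  -- Dividing by X minus the first root leaves a polynomial with one coefficient fewer that vanishes
  -- at the remaining roots, because their differences from the first are nonzero.
  vanishing : ∀ {d} (a xs : Fin d → Carrier) → Distinct xs → (∀ j → eval a (xs j) ≈ 0#) → ∀ i → a i ≈ 0#
  vanishing {suc d} a xs distinct a≈0 = quotient-zero (xs zero) a (a≈0 zero)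
    (vanishing (quotient (xs zero) a) (xs ∘ suc) (distinct-tail distinct) λ j →
      *-cancelˡ (distinct-head distinct j) (begin
        (xs (suc j) - xs zero) * eval (quotient (xs zero) a) (xs (suc j))
          ≈⟨ +-identityˡ _ ⟨
        0# + (xs (suc j) - xs zero) * eval (quotient (xs zero) a) (xs (suc j))
          ≈⟨ +-congʳ (a≈0 zero) ⟨
        eval a (xs zero) + (xs (suc j) - xs zero) * eval (quotient (xs zero) a) (xs (suc j))
          ≈⟨ eval-quotient (xs zero) a (xs (suc j)) ⟨
        eval a (xs (suc j))
          ≈⟨ a≈0 (suc j) ⟩
        0#
          ≈⟨ zeroʳ _ ⟨
        (xs (suc j) - xs zero) * 0# ∎))

  -- The coefficients of v + (X - r) b(X).
  newton : ∀ {d} → Carrier → Carrier → (Fin d → Carrier) → Fin (suc d) → Carrier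
  newton {zero}  r v b i       = v
  newton {suc d} r v b zero    = v - r * b zero
  newton {suc d} r v b (suc i) = newton r (b zero) (b ∘ suc) i

  eval-newton : ∀ {d} r v (b : Fin d → Carrier) x → eval (newton r v b) x ≈ v + (x - r) * eval b x
  eval-newton {zero}  r v b x = +-cong (*-identityʳ v) (sym (zeroʳ (x - r)))
  eval-newton {suc d} r v b x = begin
    eval (newton r v b) x
      ≈⟨ eval-suc (newton r v b) x ⟩
    (v - r * b zero) + x * eval (newton r (b zero) (b ∘ suc)) x
      ≈⟨ +-congˡ (*-congˡ (eval-newton r (b zero) (b ∘ suc) x)) ⟩
    (v - r * b zero) + x * (b zero + (x - r) * eval (b ∘ suc) x)
      ≈⟨ solve 5 (λ v r b x e → (v :- r :* b) :+ x :* (b :+ (x :- r) :* e) := v :+ (x :- r) :* (b :+ x :* e)) refl v r (b zero) x (eval (b ∘ suc) x) ⟩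
    v + (x - r) * (b zero + x * eval (b ∘ suc) x)
      ≈⟨ +-congˡ (*-congˡ (eval-suc b x)) ⟨
    v + (x - r) * eval b x ∎

  -- Newton interpolation: after the value v at the first node r, the remaining factor interpolates
  -- the divided differences (vⱼ - v)/(xⱼ - r).
  interpolate : ∀ {d} (xs vs : Fin d → Carrier) → Distinct xs → Σ[ a ∈ (Fin d → Carrier) ] ∀ j → eval a (xs j) ≈ vs j
  interpolate {zero}  xs vs distinct = (λ ()) , λ ()
  interpolate {suc d} xs vs distinct = newton r v b , values
    where
    r = xs zero
    v = vs zero
    slope : ∀ j → ∃[ y ] (xs (suc j) - r) * y ≈ 1#
    slope j = inverse (distinct-head distinct j)

    recursive = interpolate (xs ∘ suc) (λ j → proj₁ (slope j) * (vs (suc j) - v)) (distinct-tail distinct)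
    b = proj₁ recursive

    values : ∀ j → eval (newton r v b) (xs j) ≈ vs j
    values zero    = begin
      eval (newton r v b) r     ≈⟨ eval-newton r v b r ⟩
      v + (r - r) * eval b r    ≈⟨ +-congˡ (trans (*-congʳ (-‿inverseʳ r)) (zeroˡ _)) ⟩
      v + 0#                    ≈⟨ +-identityʳ v ⟩
      v                         ∎
    values (suc j) = begin
      eval (newton r v b) (xs (suc j))
        ≈⟨ eval-newton r v b (xs (suc j)) ⟩
      v + (xs (suc j) - r) * eval b (xs (suc j))
        ≈⟨ +-congˡ (*-congˡ (proj₂ recursive j)) ⟩
      v + (xs (suc j) - r) * (proj₁ (slope j) * (vs (suc j) - v))
        ≈⟨ +-congˡ (trans (sym (*-assoc _ _ _)) (trans (*-congʳ (proj₂ (slope j))) (*-identityˡ _))) ⟩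
      v + (vs (suc j) - v)
        ≈⟨ solve 2 (λ v w → v :+ (w :- v) := w) refl v (vs (suc j)) ⟩
      vs (suc j) ∎

  snoc : ∀ {d} → (Fin d → Carrier) → Carrier → Fin (suc d) → Carrier
  snoc {zero}  a v i       = v
  snoc {suc d} a v zero    = a zero
  snoc {suc d} a v (suc i) = snoc (a ∘ suc) v i

  eval-snoc : ∀ {d} (a : Fin d → Carrier) v x → eval (snoc a v) x ≈ eval a x + v * x ^ d
  eval-snoc {zero}  a v x = +-comm (v * 1#) 0#
  eval-snoc {suc d} a v x = begin
    eval (snoc a v) x                               ≈⟨ eval-suc (snoc a v) x ⟩
    a zero + x * eval (snoc (a ∘ suc) v) x          ≈⟨ +-congˡ (*-congˡ (eval-snoc (a ∘ suc) v x)) ⟩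
    a zero + x * (eval (a ∘ suc) x + v * x ^ d)     ≈⟨ solve 5 (λ a x e v y → a :+ x :* (e :+ v :* y) := (a :+ x :* e) :+ v :* (x :* y)) refl (a zero) x (eval (a ∘ suc) x) v (x ^ d) ⟩
    (a zero + x * eval (a ∘ suc) x) + v * (x * x ^ d)  ≈⟨ +-congʳ (eval-suc a x) ⟨
    eval a x + v * (x * x ^ d)                      ∎

  snoc-last : ∀ {d} (a : Fin d → Carrier) v → snoc a v (fromℕ d) ≡ v
  snoc-last {zero}  a v = ≡.refl
  snoc-last {suc d} a v = snoc-last (a ∘ suc) v

-- Orbits, fixed fields and automorphisms

module Homomorphisms (R : CommutativeRing 0ℓ 0ℓ) where
  open CommutativeRing R hiding (zero)

  Endomorphism : (Carrier → Carrier) → Set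
  Endomorphism = IsRingHomomorphism rawRing rawRing

  module _ {τ : Carrier → Carrier} (τ-hom : Endomorphism τ) where
    open IsRingHomomorphism τ-hom
    open Algebra.Properties.Semiring.Exp semiring
    open Algebra.Properties.Semiring.Sum semiring

    ^-homo : ∀ x n → τ (x ^ n) ≈ τ x ^ n
    ^-homo x zero    = 1#-homo
    ^-homo x (suc n) = trans (*-homo x (x ^ n)) (*-congˡ (^-homo x n))

    sum-homo : ∀ {d} (f : Fin d → Carrier) → τ (sum f) ≈ sum (τ ∘ f)
    sum-homo {zero}  f = 0#-homo
    sum-homo {suc d} f = trans (+-homo _ _) (+-congˡ (sum-homo (f ∘ suc)))

    private
      ∘-isRingHomomorphism : ∀ {α β} → Endomorphism α → Endomorphism β → Endomorphism (β ∘ α)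
      ∘-isRingHomomorphism = Composition.isRingHomomorphism trans

    iterate-isRingHomomorphism : ∀ m → Endomorphism (λ x → fold x τ m)
    iterate-isRingHomomorphism zero    = Identity.isRingHomomorphism rawRing refl
    iterate-isRingHomomorphism (suc m) = ∘-isRingHomomorphism (iterate-isRingHomomorphism m) τ-hom

-- Only the orbit of θ has length d; τ itself may have larger order. One use takes τ = σ and a
-- generator of K_s, which gives the degree of K_s; the other takes τ = σ^(pˢ) and a generator of K,
-- which gives the Galois group over K_s.
record FreeOrbit (K : DiscreteField) (d : ℕ) : Set where
  open CommutativeRing (DiscreteField.commutativeRing K) using (Carrier; _≈_; rawRing)
  field
    τ        : Carrier → Carrier
    τ-hom    : IsRingHomomorphism rawRing rawRing τ
    θ        : Carrier
    τᵈθ≈θ    : fold θ τ d ≈ θ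
    distinct : ∀ {i j} → i ℕ.< d → j ℕ.< d → fold θ τ i ≈ fold θ τ j → i ≡ j

module Orbit (K : DiscreteField) {d : ℕ} .{{d≢0 : ℕ.NonZero d}} (orbit : FreeOrbit K d) where
  open FreeOrbit orbit
  open DiscreteField K
  open CommutativeRing commutativeRing hiding (zero)
  open IntegralDomain domain using (x∙y⁻¹≈ε⇒x≈y; _≟_)
  open Homomorphisms commutativeRing
  open Polynomials K
  open Algebra.Properties.Semiring.Exp semiring
  open Algebra.Properties.Semiring.Sum semiring
  open import Relation.Binary.Reasoning.Setoid setoid
  private module τ = IsRingHomomorphism τ-hom

  eval-homo : ∀ {α} → Endomorphism α → ∀ {d} (a : Fin d → Carrier) x → α (eval a x) ≈ eval (α ∘ a) (α x)
  eval-homo α-hom {d} a x = trans (sum-homo α-hom (λ i → a i * x ^ toℕ i))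
    (sum-cong-≋ {d} λ i → trans (*-homo (a i) (x ^ toℕ i)) (*-congˡ (^-homo α-hom x (toℕ i))))
    where open IsRingHomomorphism α-hom

  conjugates : Fin d → Carrier
  conjugates j = fold θ τ (toℕ j)

  conjugates-distinct : Distinct conjugates
  conjugates-distinct i j eq = Fin.toℕ-injective (distinct (Fin.toℕ<n i) (Fin.toℕ<n j) eq)

  iterate-homo : ∀ m → Endomorphism (λ x → fold x τ m)
  iterate-homo = iterate-isRingHomomorphism τ-hom

  iterate-fixed : ∀ m {x} → τ x ≈ x → fold x τ m ≈ x
  iterate-fixed zero    τx≈x = refl
  iterate-fixed (suc m) τx≈x = trans (τ.⟦⟧-cong (iterate-fixed m τx≈x)) τx≈x

  -- Over K the coefficients exist by interpolation; τ permutes the conditions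
  -- cyclically, so it fixes the coefficients.
  expand : ∀ x → fold x τ d ≈ x → Σ[ a ∈ (Fin d → Carrier) ] (∀ i → τ (a i) ≈ a i) × eval a θ ≈ x
  expand x τᵈx≈x = a , fixed , a-values 0 (ℕ.>-nonZero⁻¹ d)
    where
    interpolation = interpolate conjugates (λ j → fold x τ (toℕ j)) conjugates-distinct
    a = proj₁ interpolation

    a-values : ∀ j → j ℕ.< d → eval a (fold θ τ j) ≈ fold x τ j
    a-values j j<d = ≡.subst (λ j → eval a (fold θ τ j) ≈ fold x τ j) (Fin.toℕ-fromℕ< j<d)
      (proj₂ interpolation (Fin.fromℕ< j<d))

    τa-values : ∀ j → j ℕ.< d → eval (τ ∘ a) (fold θ τ (suc j)) ≈ fold x τ (suc j)
    τa-values j j<d = trans (sym (eval-homo τ-hom a (fold θ τ j))) (τ.⟦⟧-cong (a-values j j<d))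

    -- The wrap-around: position 0 is position d, since τᵈ fixes both θ and x, and d = m + 1 makes
    -- it the image of position m.
    τa-value-0 : ∀ m → m ≡ d → eval (τ ∘ a) θ ≈ x
    τa-value-0 zero    eq = contradiction (≡.sym eq) (ℕ.≢-nonZero⁻¹ d)
    τa-value-0 (suc m) eq = trans (eval-cong {d} {τ ∘ a} (λ _ → refl) (sym (≡.subst (λ d → fold θ τ d ≈ θ) (≡.sym eq) τᵈθ≈θ)))
      (trans (τa-values m (≡.subst (m ℕ.<_) eq ℕ.≤-refl)) (≡.subst (λ d → fold x τ d ≈ x) (≡.sym eq) τᵈx≈x))

    agree : ∀ j → j ℕ.< d → eval (τ ∘ a) (fold θ τ j) ≈ fold x τ j
    agree zero    _     = τa-value-0 d ≡.refl
    agree (suc j) 1+j<d = τa-values j (ℕ.<⇒≤ 1+j<d)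

    fixed : ∀ i → τ (a i) ≈ a i
    fixed i = x∙y⁻¹≈ε⇒x≈y _ _ (vanishing (λ i → τ (a i) - a i) conjugates conjugates-distinct (λ j → begin
      eval (λ i → τ (a i) - a i) (conjugates j)
        ≈⟨ eval-sub (τ ∘ a) a (conjugates j) ⟩
      eval (τ ∘ a) (conjugates j) - eval a (conjugates j)
        ≈⟨ +-cong (agree (toℕ j) (Fin.toℕ<n j)) (-‿cong (a-values (toℕ j) (Fin.toℕ<n j))) ⟩
      fold x τ (toℕ j) - fold x τ (toℕ j)
        ≈⟨ -‿inverseʳ _ ⟩
      0# ∎) i)

  -- Powers of τ fix the coefficients, so a relation at θ holds at all d conjugates, and `vanishing`
  -- applies.
  independent : ∀ (a : Fin d → Carrier) → (∀ i → τ (a i) ≈ a i) → eval a θ ≈ 0# → ∀ i → a i ≈ 0#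
  independent a fixed aθ≈0 = vanishing a conjugates conjugates-distinct λ j → begin
    eval a (conjugates j)
      ≈⟨ eval-cong (λ i → iterate-fixed (toℕ j) (fixed i)) refl ⟨
    eval (λ i → fold (a i) τ (toℕ j)) (conjugates j)
      ≈⟨ eval-homo (iterate-homo (toℕ j)) a θ ⟨
    fold (eval a θ) τ (toℕ j)
      ≈⟨ IsRingHomomorphism.⟦⟧-cong (iterate-homo (toℕ j)) aθ≈0 ⟩
    fold 0# τ (toℕ j)
      ≈⟨ IsRingHomomorphism.0#-homo (iterate-homo (toℕ j)) ⟩
    0# ∎

  module _ {α : Carrier → Carrier} (α-hom : Endomorphism α) (α-fixes : ∀ {x} → τ x ≈ x → α x ≈ x) where

    private
      module α = IsRingHomomorphism α-hom

      -- θ and hence αθ are roots of a monic polynomial of degree d over the fixed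
      -- field of τ; its d conjugate roots are all of its roots.
      θᵈ = expand (θ ^ d) (trans (^-homo (iterate-homo d) θ d) (^-congˡ d τᵈθ≈θ))
      a  = proj₁ θᵈ

      minimal : Fin (suc d) → Carrier
      minimal = snoc (λ i → - a i) 1#

      eval-neg : ∀ {d} (a : Fin d → Carrier) x → eval (λ i → - a i) x ≈ - eval a x
      eval-neg {d} a x = begin
        eval (λ i → - a i) x             ≈⟨ eval-cong (λ i → +-identityˡ (- a i)) refl ⟨
        eval (λ i → 0# - a i) x          ≈⟨ eval-sub (const 0#) a x ⟩
        eval {d} (const 0#) x - eval a x ≈⟨ +-congʳ (eval-zero {d} (const 0#) x (λ _ → refl)) ⟩
        0# - eval a x                    ≈⟨ +-identityˡ _ ⟩
        - eval a x                       ∎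

      root : ∀ {β} → Endomorphism β → (∀ {x} → τ x ≈ x → β x ≈ x) → eval minimal (β θ) ≈ 0#
      root {β} β-hom β-fixes = begin
        eval minimal (β θ)                           ≈⟨ eval-snoc (λ i → - a i) 1# (β θ) ⟩
        eval (λ i → - a i) (β θ) + 1# * β θ ^ d      ≈⟨ +-cong (eval-neg a (β θ)) (trans (*-identityˡ _) (sym (^-homo β-hom θ d))) ⟩
        - eval a (β θ) + β (θ ^ d)                   ≈⟨ +-congˡ (β.⟦⟧-cong (proj₂ (proj₂ θᵈ))) ⟨
        - eval a (β θ) + β (eval a θ)                ≈⟨ +-congˡ (eval-homo β-hom a θ) ⟩
        - eval a (β θ) + eval (β ∘ a) (β θ)          ≈⟨ +-congˡ (eval-cong (λ i → β-fixes (proj₁ (proj₂ θᵈ) i)) refl) ⟩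
        - eval a (β θ) + eval a (β θ)                ≈⟨ -‿inverseˡ _ ⟩
        0#                                           ∎
        where module β = IsRingHomomorphism β-hom

      roots : Fin (suc d) → Carrier
      roots zero    = α θ
      roots (suc j) = conjugates j

      roots-distinct : ¬ (∃[ j ] α θ ≈ conjugates j) → Distinct roots
      roots-distinct αθ∉ zero    zero    eq = ≡.refl
      roots-distinct αθ∉ zero    (suc j) eq = contradiction (j , eq) αθ∉
      roots-distinct αθ∉ (suc i) zero    eq = contradiction (i , sym eq) αθ∉
      roots-distinct αθ∉ (suc i) (suc j) eq = ≡.cong suc (conjugates-distinct i j eq)

      roots-vanish : ∀ j → eval minimal (roots j) ≈ 0#
      roots-vanish zero    = root α-hom α-fixes
      roots-vanish (suc j) = root (iterate-homo (toℕ j)) (iterate-fixed (toℕ j))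

    conjugate : ∃[ j ] α θ ≈ conjugates j
    -- Otherwise `minimal` would have d + 1 distinct roots, and its leading coefficient 1 would be
    -- 0.
    conjugate = decidable-stable (Fin.any? λ j → α θ ≟ conjugates j) λ αθ∉ → 1≉0
      (trans (reflexive (≡.sym (snoc-last (λ i → - a i) 1#)))
        (vanishing minimal roots (roots-distinct αθ∉) roots-vanish (fromℕ d)))

    -- x is a polynomial in θ with coefficients fixed by τ, and α agrees with τʲ both on θ and on
    -- the coefficients.
    determined : ∀ {j} → α θ ≈ conjugates j → ∀ x → fold x τ d ≈ x → α x ≈ fold x τ (toℕ j)
    determined {j} αθ≈ x τᵈx≈x = begin
      α x                                              ≈⟨ α.⟦⟧-cong (proj₂ (proj₂ b)) ⟨
      α (eval (proj₁ b) θ)                             ≈⟨ eval-homo α-hom (proj₁ b) θ ⟩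
      eval (α ∘ proj₁ b) (α θ)                         ≈⟨ eval-cong (λ i → trans (α-fixes (proj₁ (proj₂ b) i)) (sym (iterate-fixed (toℕ j) (proj₁ (proj₂ b) i)))) αθ≈ ⟩
      eval (λ i → fold (proj₁ b i) τ (toℕ j)) (conjugates j) ≈⟨ eval-homo (iterate-homo (toℕ j)) (proj₁ b) θ ⟨
      fold (eval (proj₁ b) θ) τ (toℕ j)                ≈⟨ IsRingHomomorphism.⟦⟧-cong (iterate-homo (toℕ j)) (proj₂ (proj₂ b)) ⟩
      fold x τ (toℕ j)                                 ∎
      where b = expand x τᵈx≈x

-- Divisors of prime powers and minimal periods

-- If p did not divide q, then q would be coprime to p, and removing the factors p from pᵐ one by
-- one would leave q ∣ 1.
prime∣divisor : ∀ {p q} → Prime p → ∀ m → q ∣ p ℕ.^ m → ¬ (q ≡ 1) → p ∣ q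
prime∣divisor         pr zero    q∣1   q≢1 = contradiction (∣1⇒≡1 q∣1) q≢1
prime∣divisor {p} {q} pr (suc m) q∣p^m q≢1 = decidable-stable (p ∣? q) λ p∤q →
  p∤q (prime∣divisor pr m (coprime-divisor (coprime p∤q) q∣p^m) q≢1)
  where
  coprime : ¬ (p ∣ q) → Coprime q p
  coprime p∤q {d} (d∣q , d∣p) = Sum.[ (λ d≡1 → d≡1) , (λ { ≡.refl → contradiction d∣q p∤q }) ]′ (prime⇒irreducible pr d∣p)

-- The cofactor of g is not 1, so it contains a factor p, which can be cancelled.
proper-divisor : ∀ {p g} → Prime p → ∀ s → g ∣ p ℕ.^ suc s → g ℕ.< p ℕ.^ suc s → g ∣ p ℕ.^ s
proper-divisor {p} {g} pr s (divides q eq) g<p^s+1 = factor (prime∣divisor pr (suc s) (divides g (≡.trans eq (ℕ.*-comm q g))) q≢1)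
  where
  q≢1 : ¬ (q ≡ 1)
  q≢1 ≡.refl = ℕ.<-irrefl (≡.sym (≡.trans eq (ℕ.*-identityˡ g))) g<p^s+1

  factor : p ∣ q → g ∣ p ℕ.^ s
  factor (divides r ≡.refl) = divides r (ℕ.*-cancelˡ-≡ (p ℕ.^ s) (r ℕ.* g) p {{prime⇒nonZero pr}}
    (≡.trans eq (≡.trans (≡.cong (ℕ._* g) (ℕ.*-comm r p)) (ℕ.*-assoc p r g))))

-- P behaves like the nonnegative part of a subgroup of ℤ. It is used for the m such that σᵐ fixes
-- an element, and for the m such that ξᵐ = 1.
module Periods (P : ℕ → Set) (P-0 : P 0)
  (P-+ : ∀ {a b} → P a → P b → P (a ℕ.+ b)) (P-∸ : ∀ {a b} → P (a ℕ.+ b) → P b → P a) where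

  P-* : ∀ k {a} → P a → P (k ℕ.* a)
  P-* zero    Pa = P-0
  P-* (suc k) Pa = P-+ Pa (P-* k Pa)

  P-∣ : ∀ {a b} → a ∣ b → P a → P b
  P-∣ (divides q eq) Pa = ≡.subst P (≡.sym eq) (P-* q Pa)

  P-gcd : ∀ a b → P a → P b → P (gcd a b)
  P-gcd a b Pa Pb = fromIdentity (Bézout.identity (gcd-GCD a b))
    where
    fromIdentity : Bézout.Identity (gcd a b) a b → P (gcd a b)
    fromIdentity (Bézout.+- x y eq) = P-∸ (≡.subst P (≡.sym eq) (P-* x Pa)) (P-* y Pb)
    fromIdentity (Bézout.-+ x y eq) = P-∸ (≡.subst P (≡.sym eq) (P-* y Pb)) (P-* x Pa)

  -- A smaller period i would make gcd(i, pˢ⁺¹) a period; that is a proper divisor of pˢ⁺¹, hence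
  -- divides pˢ, which would then be a period.
  minimal-period : ∀ {p} → Prime p → ∀ s → P (p ℕ.^ suc s) → ¬ P (p ℕ.^ s) →
    ∀ i → 0 ℕ.< i → i ℕ.< p ℕ.^ suc s → ¬ P i
  minimal-period {p} pr s Pp^s+1 ¬Pp^s i 0<i i<p^s+1 Pi = ¬Pp^s (P-∣
    (proper-divisor pr s (gcd[m,n]∣n i (p ℕ.^ suc s)) (ℕ.≤-<-trans (∣⇒≤ {{ℕ.>-nonZero 0<i}} (gcd[m,n]∣m i (p ℕ.^ suc s))) i<p^s+1))
    (P-gcd i (p ℕ.^ suc s) Pi Pp^s+1))

fold-iterated : ∀ {A : Set} (f : A → A) q x j → fold x (λ y → fold y f q) j ≡ fold x f (j ℕ.* q)
fold-iterated f q x zero    = ≡.refl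
fold-iterated f q x (suc j) = ≡.trans (≡.cong (λ y → fold y f q) (fold-iterated f q x j)) (≡.sym (fold-+ x f q))

-- The cyclic extension, its tower and its Galois groups

-- A faithful action of ℤ/pⁿ on K.  The element θ s is fixed by the subgroup of
-- index pˢ⁺¹ but not by that of index pˢ, so its orbit has pˢ⁺¹ elements.
record CyclicAction (K : DiscreteField) (p n : ℕ) : Set where
  open CommutativeRing (DiscreteField.commutativeRing K) using (Carrier; _≈_; rawRing)
  field
    σ       : Carrier → Carrier
    σ-hom   : IsRingHomomorphism rawRing rawRing σ
    σ-order : ∀ x → fold x σ (p ℕ.^ n) ≈ x
    θ       : ℕ → Carrier
    θ-fixed : ∀ {s} → s ℕ.< n → fold (θ s) σ (p ℕ.^ suc s) ≈ θ s
    θ-moved : ∀ {s} → s ℕ.< n → ¬ (fold (θ s) σ (p ℕ.^ s) ≈ θ s)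

module CyclicExtension (𝕂 : DiscreteField) {p : ℕ} (pr : Prime p) {n : ℕ} (action : CyclicAction 𝕂 p n) where
  open CyclicAction action
  open DiscreteField 𝕂
  open CommutativeRing commutativeRing hiding (zero)
  open Homomorphisms commutativeRing using (iterate-isRingHomomorphism)
  open Algebra.Properties.Semiring.Exp semiring
  open import Relation.Binary.Reasoning.Setoid setoid
  private
    module σ = IsRingHomomorphism σ-hom
    module σ^ m = IsRingHomomorphism (iterate-isRingHomomorphism σ-hom m)

    p≢0 : ℕ.NonZero p
    p≢0 = prime⇒nonZero pr

    p^≢0 : ∀ s → ℕ.NonZero (p ℕ.^ s)
    p^≢0 s = ℕ.m^n≢0 p s {{p≢0}}

  fold-+-σ : ∀ a b x → fold x σ (a ℕ.+ b) ≈ fold (fold x σ b) σ a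
  fold-+-σ a b x = reflexive (fold-+ x σ a)

  module Period (x : Carrier) = Periods (λ m → fold x σ m ≈ x) refl
    (λ {a} {b} σᵃ σᵇ → trans (fold-+-σ a b x) (trans (σ^.⟦⟧-cong a σᵇ) σᵃ))
    (λ {a} {b} σᵃ⁺ᵇ σᵇ → trans (sym (trans (fold-+-σ a b x) (σ^.⟦⟧-cong a σᵇ))) σᵃ⁺ᵇ)

  σ-fixed⇒ : ∀ m {x} → σ x ≈ x → fold x σ m ≈ x
  σ-fixed⇒ m {x} σx≈x = ≡.subst (λ k → fold x σ k ≈ x) (ℕ.*-identityʳ m) (Period.P-* x m σx≈x)

  -- m + m (pⁿ - 1) is a multiple of pⁿ, so the inverse of a power of σ is again a nonnegative
  -- power.
  inverse-power : ∀ m y → fold (fold y σ (m ℕ.* ℕ.pred (p ℕ.^ n))) σ m ≈ y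
  inverse-power m y = trans (sym (fold-+-σ m (m ℕ.* ℕ.pred (p ℕ.^ n)) y))
    (≡.subst (λ k → fold y σ k ≈ y)
      (≡.trans (≡.cong (m ℕ.*_) (≡.sym (ℕ.suc-pred (p ℕ.^ n) {{p^≢0 n}}))) (ℕ.*-suc m (ℕ.pred (p ℕ.^ n))))
      (Period.P-* y m (σ-order y)))

  power-injective : ∀ m {x y} → fold x σ m ≈ fold y σ m → x ≈ y
  power-injective m {x} {y} eq = begin
    x                               ≈⟨ inverse-power m x ⟨
    fold (fold x σ m′) σ m          ≈⟨ commute x ⟩
    fold (fold x σ m) σ m′          ≈⟨ σ^.⟦⟧-cong m′ eq ⟩
    fold (fold y σ m) σ m′          ≈⟨ commute y ⟨
    fold (fold y σ m′) σ m          ≈⟨ inverse-power m y ⟩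
    y                               ∎
    where
    m′ = m ℕ.* ℕ.pred (p ℕ.^ n)
    commute : ∀ x → fold (fold x σ m′) σ m ≈ fold (fold x σ m) σ m′
    commute x = trans (sym (fold-+-σ m m′ x)) (trans (reflexive (≡.cong (fold x σ) (ℕ.+-comm m m′))) (fold-+-σ m′ m x))

  -- `θ s` generates K_{s+1}, whence the shift of index; 1 generates K₀ = F over itself.
  generator : ℕ → Carrier
  generator zero    = 1#
  generator (suc s) = θ s

  generator-fixed : ∀ s → s ℕ.≤ n → fold (generator s) σ (p ℕ.^ s) ≈ generator s
  generator-fixed zero    _   = σ.1#-homo
  generator-fixed (suc s) s<n = θ-fixed s<n

  private
    free : ∀ s → s ℕ.≤ n → ∀ k → 0 ℕ.< k → k ℕ.< p ℕ.^ s → ¬ (fold (generator s) σ k ≈ generator s)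
    free zero    _   k 0<k k<1 = contradiction k<1 (ℕ.≤⇒≯ 0<k)
    free (suc s) s<n = Period.minimal-period (θ s) pr s (θ-fixed s<n) (θ-moved s<n)

    not-earlier : ∀ s → s ℕ.≤ n → ∀ {i j} → i ℕ.< j → j ℕ.< p ℕ.^ s → ¬ (fold (generator s) σ i ≈ fold (generator s) σ j)
    not-earlier s s≤n {i} {j} i<j j<p^s eq = free s s≤n (j ∸ i) (ℕ.m<n⇒0<n∸m i<j) (ℕ.≤-<-trans (ℕ.m∸n≤m j i) j<p^s)
      (power-injective i (begin
        fold (fold (generator s) σ (j ∸ i)) σ i   ≈⟨ fold-+-σ i (j ∸ i) (generator s) ⟨
        fold (generator s) σ (i ℕ.+ (j ∸ i))      ≡⟨ ≡.cong (fold (generator s) σ) (ℕ.m+[n∸m]≡n (ℕ.<⇒≤ i<j)) ⟩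
        fold (generator s) σ j                    ≈⟨ eq ⟨
        fold (generator s) σ i                    ∎))

  generator-distinct : ∀ s → s ℕ.≤ n → ∀ {i j} → i ℕ.< p ℕ.^ s → j ℕ.< p ℕ.^ s →
    fold (generator s) σ i ≈ fold (generator s) σ j → i ≡ j
  generator-distinct s s≤n {i} {j} i< j< eq = trichotomy (ℕ.<-cmp i j)
    where
    trichotomy : Tri (i ℕ.< j) (i ≡ j) (j ℕ.< i) → i ≡ j
    trichotomy (tri< i<j _ _) = contradiction eq (not-earlier s s≤n i<j j<)
    trichotomy (tri≈ _ i≡j _) = i≡j
    trichotomy (tri> _ _ j<i) = contradiction (sym eq) (not-earlier s s≤n j<i i<)

  fixedRing : CommutativeRing 0ℓ 0ℓ
  fixedRing = record
    { Carrier = Σ[ x ∈ Carrier ] σ x ≈ x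
    ; _≈_ = λ x y → proj₁ x ≈ proj₁ y
    ; _+_ = λ (x , σx) (y , σy) → x + y , trans (σ.+-homo x y) (+-cong σx σy)
    ; _*_ = λ (x , σx) (y , σy) → x * y , trans (σ.*-homo x y) (*-cong σx σy)
    ; -_  = λ (x , σx) → - x , trans (σ.-‿homo x) (-‿cong σx)
    ; 0#  = 0# , σ.0#-homo
    ; 1#  = 1# , σ.1#-homo
    ; isCommutativeRing = record
      { isRing = record
        { +-isAbelianGroup = record
          { isGroup = record
            { isMonoid = record
              { isSemigroup = record
                { isMagma = record
                  { isEquivalence = record { refl = refl ; sym = sym ; trans = trans }
                  ; ∙-cong = +-cong
                  }
                ; assoc = λ x y z → +-assoc (proj₁ x) (proj₁ y) (proj₁ z)
                }
              ; identity = (λ x → +-identityˡ (proj₁ x)) , (λ x → +-identityʳ (proj₁ x))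
              }
            ; inverse = (λ x → -‿inverseˡ (proj₁ x)) , (λ x → -‿inverseʳ (proj₁ x))
            ; ⁻¹-cong = -‿cong
            }
          ; comm = λ x y → +-comm (proj₁ x) (proj₁ y)
          }
        ; *-cong = *-cong
        ; *-assoc = λ x y z → *-assoc (proj₁ x) (proj₁ y) (proj₁ z)
        ; *-identity = (λ x → *-identityˡ (proj₁ x)) , (λ x → *-identityʳ (proj₁ x))
        ; distrib = (λ x y z → distribˡ (proj₁ x) (proj₁ y) (proj₁ z)) , (λ x y z → distribʳ (proj₁ x) (proj₁ y) (proj₁ z))
        }
      ; *-comm = λ x y → *-comm (proj₁ x) (proj₁ y)
      }
    }

  inverse-fixed : ∀ m {x y} → fold x σ m ≈ x → x * y ≈ 1# → fold y σ m ≈ y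
  inverse-fixed m {x} {y} τx≈x xy≈1 = begin
    fold y σ m                       ≈⟨ *-identityʳ _ ⟨
    fold y σ m * 1#                  ≈⟨ *-congˡ xy≈1 ⟨
    fold y σ m * (x * y)             ≈⟨ *-assoc _ _ _ ⟨
    fold y σ m * x * y               ≈⟨ *-congʳ (*-comm _ _) ⟩
    x * fold y σ m * y               ≈⟨ *-congʳ (*-congʳ τx≈x) ⟨
    fold x σ m * fold y σ m * y      ≈⟨ *-congʳ (σ^.*-homo m x y) ⟨
    fold (x * y) σ m * y             ≈⟨ *-congʳ (σ^.⟦⟧-cong m xy≈1) ⟩
    fold 1# σ m * y                  ≈⟨ *-congʳ (σ^.1#-homo m) ⟩
    1# * y                           ≈⟨ *-identityˡ y ⟩
    y                                ∎

  fixedField : DiscreteField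
  fixedField = record
    { commutativeRing = fixedRing
    ; zero?           = λ (x , _) → zero? x
    ; 1≉0             = 1≉0
    ; inverse         = λ {(x , σx)} x≉0 → (proj₁ (inverse x≉0) , inverse-fixed 1 σx (proj₂ (inverse x≉0))) , proj₂ (inverse x≉0)
    }

  F K : Field
  F = DiscreteField.asField fixedField
  K = asField

  extension : Extension F
  extension = record
    { K = K
    ; ι = proj₁
    ; isRingHomomorphism = record
      { isSemiringHomomorphism = record
        { isNearSemiringHomomorphism = record
          { +-isMonoidHomomorphism = record
            { isMagmaHomomorphism = record
              { isRelHomomorphism = record { cong = λ x≈y → x≈y }
              ; homo = λ _ _ → refl
              }
            ; ε-homo = refl
            }
          ; *-homo = λ _ _ → refl
          }
        ; 1#-homo = refl
        }
      ; -‿homo = λ _ → refl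
      }
    }

  power : ∀ {L : Pred Carrier 0ℓ} m → (∀ x → x ∈ L → fold x σ m ≈ x) → Automorphism K L
  power m fixes = record
    { to = λ x → fold x σ m
    ; isRingIsomorphism = record
      { isRingMonomorphism = record
        { isRingHomomorphism = iterate-isRingHomomorphism σ-hom m
        ; injective          = power-injective m
        }
      ; surjective = λ y → fold y σ (m ℕ.* ℕ.pred (p ℕ.^ n)) ,
          λ x≈ → trans (σ^.⟦⟧-cong m x≈) (inverse-power m y)
      }
    ; fixes = fixes
    }

  Fixed : ℕ → Pred Carrier 0ℓ
  Fixed s x = fold x σ (p ℕ.^ s) ≈ x

  module AtLevel (s : ℕ) (s≤n : s ℕ.≤ n) where
    private
      q d : ℕ
      q = p ℕ.^ s
      d = p ℕ.^ (n ∸ s)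

      dq≡pⁿ : d ℕ.* q ≡ p ℕ.^ n
      dq≡pⁿ = ≡.trans (≡.sym (ℕ.^-distribˡ-+-* p (n ∸ s) s)) (≡.cong (p ℕ.^_) (ℕ.m∸n+n≡m s≤n))

      τ : Carrier → Carrier
      τ x = fold x σ q

      τʲ≡ : ∀ x j → fold x τ j ≡ fold x σ (j ℕ.* q)
      τʲ≡ = fold-iterated σ q

      τ-order : ∀ x → fold x τ d ≈ x
      τ-order x = trans (reflexive (≡.trans (τʲ≡ x d) (≡.cong (fold x σ) dq≡pⁿ))) (σ-order x)

      jq< : ∀ {j} → j ℕ.< d → j ℕ.* q ℕ.< p ℕ.^ n
      jq< {j} j<d = ≡.subst (j ℕ.* q ℕ.<_) dq≡pⁿ (ℕ.*-monoˡ-< q {{p^≢0 s}} j<d)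

      τ-distinct : ∀ {i j} → i ℕ.< d → j ℕ.< d → fold (generator n) τ i ≈ fold (generator n) τ j → i ≡ j
      τ-distinct {i} {j} i<d j<d eq = ℕ.*-cancelʳ-≡ i j q {{p^≢0 s}}
        (generator-distinct n ℕ.≤-refl (jq< i<d) (jq< j<d)
          (trans (reflexive (≡.sym (τʲ≡ (generator n) i))) (trans eq (reflexive (τʲ≡ (generator n) j)))))

      orbit : FreeOrbit 𝕂 d
      orbit = record
        { τ        = τ
        ; τ-hom    = iterate-isRingHomomorphism σ-hom q
        ; θ        = generator n
        ; τᵈθ≈θ    = τ-order (generator n)
        ; distinct = τ-distinct
        }

      module O = Orbit 𝕂 {{p^≢0 (n ∸ s)}} orbit

    -- L is specified only up to mutual inclusion because `Base extension` and `Fixed 0`, like the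
    -- whole field and `Fixed n`, are different predicates with the same elements.
    module _ {L : Pred Carrier 0ℓ} (L⊆Fixed : ∀ {x} → x ∈ L → x ∈ Fixed s) (Fixed⊆L : ∀ {x} → x ∈ Fixed s → x ∈ L) where

      τ-power : Fin d → Automorphism K L
      τ-power j = power (toℕ j ℕ.* q) λ x x∈L → Period.P-* x (toℕ j) (L⊆Fixed x∈L)

      private
        module _ (α : Automorphism K L) where
          open Automorphism α using (to; isRingHomomorphism; fixes)

          index : ∃[ j ] to (generator n) ≈ O.conjugates j
          index = O.conjugate isRingHomomorphism λ {x} x∈Fixed → fixes x (Fixed⊆L x∈Fixed)

          is-τ-power : ∀ x → to x ≈ fold x σ (toℕ (proj₁ index) ℕ.* q)
          is-τ-power x = trans
            (O.determined isRingHomomorphism (λ {x} x∈Fixed → fixes x (Fixed⊆L x∈Fixed)) {proj₁ index} (proj₂ index) x (τ-order x))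
            (reflexive (τʲ≡ x (toℕ (proj₁ index))))

        index-unique : ∀ (α : Automorphism K L) j → (∀ x → Automorphism.to α x ≈ fold x σ (toℕ j ℕ.* q)) → proj₁ (index α) ≡ j
        index-unique α j α≈ = O.conjugates-distinct _ j
          (trans (sym (proj₂ (index α))) (trans (α≈ (generator n)) (reflexive (≡.sym (τʲ≡ (generator n) (toℕ j))))))

      -- An automorphism over K_s is determined by the image of the generator of K, which is one of
      -- its d conjugates under τ = σ^q; so the group consists of the τʲ with j < d.
      galoisGroup-finite : Finite (Group.setoid (Gal K L))
      galoisGroup-finite = record
        { size = d
        ; enumeration = record
          { to        = τ-power
          ; from      = λ α → proj₁ (index α)
          ; to-cong   = λ { ≡.refl x → refl }
          ; from-cong = λ {α} {β} α≈β → index-unique α _ λ x → trans (α≈β x) (is-τ-power β x)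
          ; inverse   = (λ { {α} ≡.refl x → sym (is-τ-power α x) }) ,
                        (λ {j} {α} α≈ → index-unique α j α≈)
          }
        }

    -- The basis consists of the powers gⁱ, i < pˢ, of the generator g of K_s, whose orbit under σ
    -- has exactly pˢ elements.
    degree : ∀ {L : Pred Carrier 0ℓ} → (∀ {x} → x ∈ L → x ∈ Fixed s) → (∀ {x} → x ∈ Fixed s → x ∈ L) → HasDegree extension L q
    degree L⊆Fixed Fixed⊆L =
      (λ i → generator s ^ toℕ i) ,
      (λ i → Fixed⊆L (trans (σ-^ (toℕ i)) (^-congˡ (toℕ i) (generator-fixed s s≤n)))) ,
      (λ x x∈L → let a , fixed , aθ≈x = B.expand x (L⊆Fixed x∈L) in (λ i → a i , fixed i) , aθ≈x) ,
      (λ a aθ≈0 → B.independent (proj₁ ∘ a) (proj₂ ∘ a) aθ≈0)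
      where
      orbit′ : FreeOrbit 𝕂 q
      orbit′ = record
        { τ        = σ
        ; τ-hom    = σ-hom
        ; θ        = generator s
        ; τᵈθ≈θ    = generator-fixed s s≤n
        ; distinct = generator-distinct s s≤n
        }

      module B = Orbit 𝕂 {{p^≢0 s}} orbit′
      σ-^ : ∀ i → fold (generator s ^ i) σ q ≈ fold (generator s) σ q ^ i
      σ-^ = Homomorphisms.^-homo commutativeRing (iterate-isRingHomomorphism σ-hom q) (generator s)

  Base⊆Fixed : ∀ {x} → x ∈ Base extension → x ∈ Fixed 0
  Base⊆Fixed ((a , σa≈a) , a≈x) = trans (σ.⟦⟧-cong (sym a≈x)) (trans σa≈a a≈x)

  Fixed⊆Base : ∀ {x} → x ∈ Fixed 0 → x ∈ Base extension
  Fixed⊆Base {x} σx≈x = (x , σx≈x) , refl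

  isCyclicGalois : IsCyclicGalois extension (p ℕ.^ n)
  isCyclicGalois = record
    { degree     = AtLevel.degree n ℕ.≤-refl (λ {x} _ → σ-order x) (λ _ → tt)
    ; fixedField = λ x τx≈x → Fixed⊆Base (τx≈x σ-automorphism)
    ; finite     = finite
    -- The factor 1 is p⁰: the group over the base is enumerated by powers of σ^(p⁰).
    ; cyclic     = σ-automorphism , λ α → + (toℕ (from α) ℕ.* 1) , λ x →
        trans (is-power α x) (reflexive (≡.sym (multiple (toℕ (from α) ℕ.* 1) x)))
    }
    where
    finite : Finite (Group.setoid (Gal K (Base extension)))
    finite = AtLevel.galoisGroup-finite 0 ℕ.z≤n Base⊆Fixed Fixed⊆Base

    open Inverse (Finite.enumeration finite) using (from; strictlyInverseˡ)

    σ-automorphism : Automorphism K (Base extension)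
    σ-automorphism = power 1 λ x x∈ → Base⊆Fixed x∈

    is-power : ∀ α x → Automorphism.to α x ≈ fold x σ (toℕ (from α) ℕ.* 1)
    is-power α x = sym (strictlyInverseˡ α x)

    open Algebra.Properties.Monoid.Mult (Group.monoid (Gal K (Base extension))) using () renaming (_×_ to _∙×_)

    multiple : ∀ m x → Automorphism.to (m ∙× σ-automorphism) x ≡ fold x σ m
    multiple zero    x = ≡.refl
    multiple (suc m) x = ≡.cong σ (multiple m x)

  tower : Tower extension p n
  tower = record
    { intermediate = λ i → let m = p ℕ.^ toℕ i in record
      { L         = Fixed (toℕ i)
      ; resp      = λ x≈y x∈ → trans (σ^.⟦⟧-cong m (sym x≈y)) (trans x∈ x≈y)
      ; base⊆     = λ (a , σa≈a) → σ-fixed⇒ m σa≈a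
      ; +-closed  = λ {x} {y} x∈ y∈ → trans (σ^.+-homo m x y) (+-cong x∈ y∈)
      ; -‿closed  = λ {x} x∈ → trans (σ^.-‿homo m x) (-‿cong x∈)
      ; *-closed  = λ {x} {y} x∈ y∈ → trans (σ^.*-homo m x y) (*-cong x∈ y∈)
      ; ⁻¹-closed = λ x∈ xy≈1 → inverse-fixed m x∈ xy≈1
      }
    ; degree = λ i → AtLevel.degree (toℕ i) (Fin.toℕ≤pred[n] i) (λ x∈ → x∈) (λ x∈ → x∈)
    ; finite = λ i → AtLevel.galoisGroup-finite (toℕ i) (Fin.toℕ≤pred[n] i) (λ x∈ → x∈) (λ x∈ → x∈)
    }

-- Polynomial rings and the monomial action

-- Exponent vectors of length q, represented by functions of which only the
-- first q values matter.
module Exponents (q : ℕ) where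

  infix 4 _≈_ _<_

  _≈_ : (ℕ → ℕ) → (ℕ → ℕ) → Set
  d ≈ e = ∀ i → i ℕ.< q → d i ≡ e i

  exponents : CommutativeMonoid 0ℓ 0ℓ
  exponents = record
    { Carrier = ℕ → ℕ
    ; _≈_ = _≈_
    ; _∙_ = λ d e i → d i ℕ.+ e i
    ; ε   = const 0
    ; isCommutativeMonoid = record
      { isMonoid = record
        { isSemigroup = record
          { isMagma = record
            { isEquivalence = record
              { refl  = λ _ _ → ≡.refl
              ; sym   = λ d≈e i i<q → ≡.sym (d≈e i i<q)
              ; trans = λ d≈e e≈f i i<q → ≡.trans (d≈e i i<q) (e≈f i i<q)
              }
            ; ∙-cong = λ d≈e f≈g i i<q → ≡.cong₂ ℕ._+_ (d≈e i i<q) (f≈g i i<q)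
            }
          ; assoc = λ d e f i _ → ℕ.+-assoc (d i) (e i) (f i)
          }
        ; identity = (λ _ _ _ → ≡.refl) , (λ e i _ → ℕ.+-identityʳ (e i))
        }
      ; comm = λ d e i _ → ℕ.+-comm (d i) (e i)
      }
    }

  -- The highest index is compared first.
  Lexicographic : ℕ → (ℕ → ℕ) → (ℕ → ℕ) → Set
  Lexicographic zero    d e = ⊥
  Lexicographic (suc n) d e = d n ℕ.< e n ⊎ d n ≡ e n × Lexicographic n d e

  record _<_ (d e : ℕ → ℕ) : Set where
    constructor mk<
    field
      lexicographic : Lexicographic q d e

  private
    lex-trans : ∀ n → Transitive (Lexicographic n)
    lex-trans (suc n) (inj₁ d<e)       (inj₁ e<f)       = inj₁ (ℕ.<-trans d<e e<f)
    lex-trans (suc n) (inj₁ d<e)       (inj₂ (e≡f , _)) = inj₁ (≡.subst (_ ℕ.<_) e≡f d<e)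
    lex-trans (suc n) (inj₂ (d≡e , _)) (inj₁ e<f)       = inj₁ (≡.subst (ℕ._< _) (≡.sym d≡e) e<f)
    lex-trans (suc n) (inj₂ (d≡e , p)) (inj₂ (e≡f , p′)) = inj₂ (≡.trans d≡e e≡f , lex-trans n p p′)

    lex-compare : ∀ n → Trichotomous (λ (d e : ℕ → ℕ) → ∀ i → i ℕ.< n → d i ≡ e i) (Lexicographic n)
    lex-compare zero    d e = tri≈ (λ ()) (λ _ ()) (λ ())
    lex-compare (suc n) d e with ℕ.<-cmp (d n) (e n)
    ... | tri< d<e d≢e d≯e = tri< (inj₁ d<e) (λ d≈e → d≢e (d≈e n ℕ.≤-refl))
      Sum.[ d≯e , (λ (e≡d , _) → d≢e (≡.sym e≡d)) ]
    ... | tri> d≮e d≢e d>e = tri> Sum.[ d≮e , (λ (d≡e , _) → d≢e d≡e) ]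
      (λ d≈e → d≢e (d≈e n ℕ.≤-refl)) (inj₁ d>e)
    ... | tri≈ d≮e d≡e d≯e with lex-compare n d e
    ...   | tri< l d≉e g = tri< (inj₂ (d≡e , l)) (λ d≈e → d≉e λ i i<n → d≈e i (ℕ.m<n⇒m<1+n i<n))
      Sum.[ d≯e , (λ (_ , p) → g p) ]
    ...   | tri> l d≉e g = tri> Sum.[ d≮e , (λ (_ , p) → l p) ]
      (λ d≈e → d≉e λ i i<n → d≈e i (ℕ.m<n⇒m<1+n i<n)) (inj₂ (≡.sym d≡e , g))
    ...   | tri≈ l d≈e g = tri≈ Sum.[ d≮e , (λ (_ , p) → l p) ]
      (λ i i<1+n → Sum.[ d≈e i , (λ { ≡.refl → d≡e }) ] (ℕ.m≤n⇒m<n∨m≡n (ℕ.≤-pred i<1+n)))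
      Sum.[ d≯e , (λ (_ , p) → g p) ]

    lex-mono : ∀ n (d : ℕ → ℕ) {e f} → Lexicographic n e f → Lexicographic n (λ i → d i ℕ.+ e i) (λ i → d i ℕ.+ f i)
    lex-mono (suc n) d (inj₁ e<f)       = inj₁ (ℕ.+-monoʳ-< (d n) e<f)
    lex-mono (suc n) d (inj₂ (e≡f , p)) = inj₂ (≡.cong (d n ℕ.+_) e≡f , lex-mono n d p)

  <-isStrictTotalOrder : IsStrictTotalOrder _≈_ _<_
  <-isStrictTotalOrder = isStrictTotalOrderᶜ record
    { isEquivalence = CommutativeMonoid.isEquivalence exponents
    ; trans         = λ (mk< p) (mk< p′) → mk< (lex-trans q p p′)
    ; compare       = λ d e → wrap (lex-compare q d e)
    }
    where
    wrap : ∀ {d e} → Tri (Lexicographic q d e) (d ≈ e) (Lexicographic q e d) → Tri (d < e) (d ≈ e) (e < d)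
    wrap (tri< l d≉e g) = tri< (mk< l) d≉e (λ (mk< p) → g p)
    wrap (tri≈ l d≈e g) = tri≈ (λ (mk< p) → l p) d≈e (λ (mk< p) → g p)
    wrap (tri> l d≉e g) = tri> (λ (mk< p) → l p) d≉e (mk< g)

  +-monoʳ-< : ∀ (d : ℕ → ℕ) {e f} → e < f → (λ i → d i ℕ.+ e i) < (λ i → d i ℕ.+ f i)
  +-monoʳ-< d (mk< p) = mk< (lex-mono q d p)

module Twist (R : CommutativeRing 0ℓ 0ℓ) (G : CommutativeMonoid 0ℓ 0ℓ) where
  open CommutativeRing R hiding (zero)
  private module G = CommutativeMonoid G
  open MonoidAlgebra R G
  open import Relation.Binary.Reasoning.Setoid setoid

  module _ (χ : G.Carrier → Carrier) (s : G.Carrier → G.Carrier) where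

    twist : FormalSum → FormalSum
    twist = List.map λ (c , g) → c * χ g , s g

    -- The adjoint action on functionals, through which all properties of `twist` are checked.
    pairing-twist : ∀ f {φ} → ⟨ twist f , φ ⟩ ≈ ⟨ f , (λ g → χ g * φ (s g)) ⟩
    pairing-twist []            = refl
    pairing-twist ((c , g) ∷ f) = +-cong (*-assoc _ _ _) (pairing-twist f)

    module _ (χ-cong : Respects χ) (s-cong : ∀ {g h} → g G.≈ h → s g G.≈ s h) where

      twist-functional : ∀ {φ} → Respects φ → Respects (λ g → χ g * φ (s g))
      twist-functional resp g≈h = *-cong (χ-cong g≈h) (resp (s-cong g≈h))

      twist-cong : ∀ {f g} → f ≋ g → twist f ≋ twist g
      twist-cong {f} {g} f≋g = mk≋ λ φ resp →
        trans (pairing-twist f) (trans (pairing f≋g _ (twist-functional resp)) (sym (pairing-twist g)))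

      module _ (χ-ε : χ G.ε ≈ 1#) (χ-∙ : ∀ g h → χ (g G.∙ h) ≈ χ g * χ h)
               (s-ε : s G.ε G.≈ G.ε) (s-∙ : ∀ g h → s (g G.∙ h) G.≈ s g G.∙ s h) where

        twist-isRingHomomorphism : IsRingHomomorphism (CommutativeRing.rawRing algebra) (CommutativeRing.rawRing algebra) twist
        twist-isRingHomomorphism = record
          { isSemiringHomomorphism = record
            { isNearSemiringHomomorphism = record
              { +-isMonoidHomomorphism = record
                { isMagmaHomomorphism = record
                  { isRelHomomorphism = record { cong = twist-cong }
                  ; homo = λ f g → mk≋ λ φ _ → begin
                      ⟨ twist (f ++ g) , φ ⟩                ≈⟨ trans (pairing-twist (f ++ g)) (pairing-++ f g) ⟩
                      ⟨ f , _ ⟩ + ⟨ g , _ ⟩                 ≈⟨ +-cong (pairing-twist f) (pairing-twist g) ⟨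
                      ⟨ twist f , φ ⟩ + ⟨ twist g , φ ⟩     ≈⟨ pairing-++ (twist f) (twist g) ⟨
                      ⟨ twist f ++ twist g , φ ⟩            ∎
                  }
                ; ε-homo = ≋-refl
                }
              ; *-homo = λ f g → mk≋ λ φ resp → begin
                  ⟨ twist (f ⊛ g) , φ ⟩
                    ≈⟨ trans (pairing-twist (f ⊛ g)) (pairing-⊛ f g) ⟩
                  ⟨ f , (λ x → ⟨ g , (λ y → χ (x G.∙ y) * φ (s (x G.∙ y))) ⟩) ⟩
                    ≈⟨ pairing-cong f (λ x → pairing-cong g λ y → trans (*-cong (χ-∙ x y) (resp (s-∙ x y))) (*-assoc _ _ _)) ⟩
                  ⟨ f , (λ x → ⟨ g , (λ y → χ x * (χ y * φ (s x G.∙ s y))) ⟩) ⟩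
                    ≈⟨ pairing-cong f (λ x → pairing-* g (χ x)) ⟩
                  ⟨ f , (λ x → χ x * ⟨ g , (λ y → χ y * φ (s x G.∙ s y)) ⟩) ⟩
                    ≈⟨ pairing-cong f (λ x → *-congˡ (pairing-twist g)) ⟨
                  ⟨ f , (λ x → χ x * ⟨ twist g , (λ y → φ (s x G.∙ y)) ⟩) ⟩
                    ≈⟨ pairing-twist f ⟨
                  ⟨ twist f , (λ x → ⟨ twist g , (λ y → φ (x G.∙ y)) ⟩) ⟩
                    ≈⟨ pairing-⊛ (twist f) (twist g) ⟨
                  ⟨ twist f ⊛ twist g , φ ⟩ ∎
              }
            ; 1#-homo = mk≋ λ φ resp → +-congʳ (*-cong (trans (*-identityˡ _) χ-ε) (resp s-ε))
            }
          ; -‿homo = λ f → mk≋ λ φ _ → trans (pairing-twist (negate f))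
              (trans (pairing-negate f) (trans (-‿cong (sym (pairing-twist f))) (sym (pairing-negate (twist f)))))
          }

-- σ is the substitution Yᵢ₊₁ ↦ Yᵢ, Y₀ ↦ ζ Y_{q−1} on R[Y₀, …, Y_{q−1}], so
-- that σ^q is multiplication by ζ in degree 1.
module MonomialAction (D : IntegralDomain) (ζ : IntegralDomain.Carrier D)
  (ζ≉0 : ¬ (IntegralDomain._≈_ D ζ (IntegralDomain.0# D))) (q : ℕ) .{{q≢0 : ℕ.NonZero q}} where

  open IntegralDomain D hiding (zero)

  module E = Exponents q
  open MonoidAlgebra commutativeRing E.exponents public
  open Twist commutativeRing E.exponents
  open LeadingTerms D E.exponents E._<_ E.<-isStrictTotalOrder public
  open Ordered E.+-monoʳ-< public
  open Algebra.Properties.Semiring.Exp semiring using (^-homo-*; ^-congʳ; ^-congˡ; ^-assocʳ)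
  open import Relation.Binary.Reasoning.Setoid setoid

  shift : ℕ → (ℕ → ℕ) → ℕ → ℕ
  shift m e i = e ((m ℕ.+ i) % q)

  -- The exponent of ζ that m applications of σ put on the monomial e: at step i the variable in
  -- position 0 carries the exponent `e (i % q)`.
  weight : ℕ → (ℕ → ℕ) → ℕ
  weight zero    e = 0
  weight (suc m) e = weight m e ℕ.+ e (m % q)

  0<q : 0 ℕ.< q
  0<q = ℕ.>-nonZero⁻¹ q

  weight-cong : ∀ m {d e} → d E.≈ e → weight m d ≡ weight m e
  weight-cong zero    d≈e = ≡.refl
  weight-cong (suc m) d≈e = ≡.cong₂ ℕ._+_ (weight-cong m d≈e) (d≈e (m % q) (m%n<n m q))

  weight-periodic : ∀ c m e → weight (m ℕ.+ c ℕ.* q) e ≡ weight (c ℕ.* q) e ℕ.+ weight m e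
  weight-periodic c zero    e = ≡.sym (ℕ.+-identityʳ _)
  weight-periodic c (suc m) e = ≡.trans
    (≡.cong₂ ℕ._+_ (weight-periodic c m e) (≡.cong e ([m+kn]%n≡m%n m c q)))
    (ℕ.+-assoc (weight (c ℕ.* q) e) (weight m e) (e (m % q)))

  weight-multiple : ∀ c e → weight (c ℕ.* q) e ≡ c ℕ.* weight q e
  weight-multiple zero    e = ≡.refl
  weight-multiple (suc c) e = ≡.trans (weight-periodic c q e)
    (≡.trans (≡.cong (ℕ._+ weight q e) (weight-multiple c e)) (ℕ.+-comm (c ℕ.* weight q e) (weight q e)))

  shift-multiple : ∀ c e → shift (c ℕ.* q) e E.≈ e
  shift-multiple c e i i<q = ≡.cong e (≡.trans (≡.cong (_% q) (ℕ.+-comm (c ℕ.* q) i))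
    (≡.trans ([m+kn]%n≡m%n i c q) (m<n⇒m%n≡m i<q)))

  character : ℕ → (ℕ → ℕ) → Carrier
  character m e = ζ ^ weight m e

  character-cong : ∀ m → Respects (character m)
  character-cong m d≈e = ^-congʳ ζ (weight-cong m d≈e)

  shift-cong : ∀ m {d e} → d E.≈ e → shift m d E.≈ shift m e
  shift-cong m d≈e i i<q = d≈e ((m ℕ.+ i) % q) (m%n<n (m ℕ.+ i) q)

  σ : FormalSum → FormalSum
  σ = twist (character 1) (shift 1)

  weight-+ : ∀ m d e → weight m (λ i → d i ℕ.+ e i) ≡ weight m d ℕ.+ weight m e
  weight-+ zero    d e = ≡.refl
  weight-+ (suc m) d e = ≡.trans (≡.cong (ℕ._+ (d (m % q) ℕ.+ e (m % q))) (weight-+ m d e))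
    (interchange (weight m d) (weight m e) (d (m % q)) (e (m % q)))
    where open import Algebra.Properties.CommutativeSemigroup ℕ.+-commutativeSemigroup using (interchange)

  σ-isRingHomomorphism : IsRingHomomorphism (CommutativeRing.rawRing algebra) (CommutativeRing.rawRing algebra) σ
  σ-isRingHomomorphism = twist-isRingHomomorphism (character 1) (shift 1)
    (λ {d} {e} → character-cong 1 {d} {e}) (λ {d} {e} → shift-cong 1 {d} {e}) refl
    (λ d e → trans (^-congʳ ζ (weight-+ 1 d e)) (^-homo-* ζ (weight 1 d) (weight 1 e)))
    (λ _ _ → ≡.refl) (λ _ _ _ _ → ≡.refl)

  pairing-σ^ : ∀ m f {φ} → Respects φ → ⟨ fold f σ m , φ ⟩ ≈ ⟨ f , (λ e → character m e * φ (shift m e)) ⟩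
  pairing-σ^ zero    f {φ} resp = pairing-cong f λ e → trans
    (resp λ i i<q → ≡.cong e (≡.sym (m<n⇒m%n≡m i<q))) (sym (*-identityˡ _))
  pairing-σ^ (suc m) f {φ} resp = begin
    ⟨ fold f σ (suc m) , φ ⟩
      ≈⟨ pairing-twist (character 1) (shift 1) (fold f σ m) ⟩
    ⟨ fold f σ m , (λ e → character 1 e * φ (shift 1 e)) ⟩
      ≈⟨ pairing-σ^ m f (λ {d} {e} d≈e → twist-functional (character 1) (shift 1) (λ {d} {e} → character-cong 1 {d} {e}) (λ {d} {e} → shift-cong 1 {d} {e}) (λ {d} {e} → resp {d} {e}) {d} {e} d≈e) ⟩
    ⟨ f , (λ e → character m e * (character 1 (shift m e) * φ (shift 1 (shift m e)))) ⟩
      ≈⟨ pairing-cong f (λ e → trans (sym (*-assoc _ _ _)) (*-cong (step e) (resp λ i _ → ≡.cong e (shift-shift i)))) ⟩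
    ⟨ f , (λ e → character (suc m) e * φ (shift (suc m) e)) ⟩ ∎
    where
    shift-shift : ∀ i → (m ℕ.+ (1 ℕ.+ i) % q) % q ≡ (suc m ℕ.+ i) % q
    shift-shift i = ≡.trans (%-distribˡ-+ m ((1 ℕ.+ i) % q) q)
      (≡.trans (≡.cong (λ u → (m % q ℕ.+ u) % q) (m%n%n≡m%n (1 ℕ.+ i) q))
      (≡.trans (≡.sym (%-distribˡ-+ m (1 ℕ.+ i) q)) (≡.cong (_% q) (ℕ.+-suc m i))))

    -- After m steps Y₀ carries the exponent `e (m % q)`, and this is what the next step
    -- contributes. `weight 1` reads position `0 % q`, which has to be evaluated to 0.
    step : ∀ e → character m e * character 1 (shift m e) ≈ character (suc m) e
    step e = trans (sym (^-homo-* ζ (weight m e) (weight 1 (shift m e))))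
      (^-congʳ ζ (≡.cong (λ j → weight m e ℕ.+ e (j % q))
        (≡.trans (≡.cong (m ℕ.+_) (ℕ.n<1⇒n≡0 (0%q<1))) (ℕ.+-identityʳ m))))
      where
      0%q<1 : 0 % q ℕ.< 1
      0%q<1 = ≡.subst (ℕ._< 1) (≡.sym (m<n⇒m%n≡m 0<q)) ℕ.z<s

  σ^≋twist : ∀ m f → fold f σ m ≋ twist (character m) (shift m) f
  σ^≋twist m f = mk≋ λ φ resp → trans (pairing-σ^ m f resp) (sym (pairing-twist (character m) (shift m) f))

  -- A full turn restores the positions, and `weight q e` is the total degree of e, so these powers
  -- of σ act diagonally on monomials.
  σ^cq≋ : ∀ c f → fold f σ (c ℕ.* q) ≋ twist (λ e → ζ ^ (c ℕ.* weight q e)) id f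
  σ^cq≋ c f = ≋-trans (σ^≋twist (c ℕ.* q) f) (mk≋ λ φ resp → trans (pairing-twist (character (c ℕ.* q)) (shift (c ℕ.* q)) f)
    (trans (pairing-cong f λ e → *-cong (^-congʳ ζ (weight-multiple c e)) (resp (shift-multiple c e)))
      (sym (pairing-twist (λ e → ζ ^ (c ℕ.* weight q e)) id f))))

  σ-periodic : ∀ c → ζ ^ c ≈ 1# → ∀ f → fold f σ (c ℕ.* q) ≋ f
  σ-periodic c ζᶜ≈1 f = ≋-trans (σ^cq≋ c f) (mk≋ λ φ resp → trans (pairing-twist (λ e → ζ ^ (c ℕ.* weight q e)) id f)
    (pairing-cong f λ e → trans (*-congʳ (begin
      ζ ^ (c ℕ.* weight q e)    ≈⟨ ^-assocʳ ζ c (weight q e) ⟨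
      (ζ ^ c) ^ weight q e      ≈⟨ ^-congˡ (weight q e) ζᶜ≈1 ⟩
      1# ^ weight q e           ≈⟨ 1^n≈1 commutativeRing (weight q e) ⟩
      1#                        ∎)) (*-identityˡ _)))

  -- A diagonal action keeps the leading exponent, whereas other powers of σ may move monomials past
  -- each other. This makes leading terms suited to the norm to K_t, whose conjugates are given by
  -- powers of σ^q.
  leading-σ^cq : ∀ c {f e a} → Leading f e a → Leading (fold f σ (c ℕ.* q)) e (a * ζ ^ (c ℕ.* weight q e))
  leading-σ^cq c {f} {e} {a} ℓ = leading-resp (≋-sym (σ^cq≋ c f)) (record
    { rest    = twist χ id (Leading.rest ℓ)
    ; expand  = twist-cong χ id (λ {d} {e} d≈e → ^-congʳ ζ (≡.cong (c ℕ.*_) (weight-cong q {d} {e} d≈e))) id (Leading.expand ℓ)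
    ; below   = All.map⁺ (Leading.below ℓ)
    ; nonzero = *-nonzero (Leading.nonzero ℓ) (^-nonzero (c ℕ.* weight q e) ζ≉0)
    })
    where
    χ : (ℕ → ℕ) → Carrier
    χ e = ζ ^ (c ℕ.* weight q e)

  monomial : (ℕ → ℕ) → FormalSum
  monomial e = (1# , e) ∷ []

  σ^-monomial-fixed⁺ : ∀ m e → ζ ^ weight m e ≈ 1# → shift m e E.≈ e → fold (monomial e) σ m ≋ monomial e
  σ^-monomial-fixed⁺ m e χ≈1 shift≈ = ≋-trans (σ^≋twist m (monomial e))
    (mk≋ λ φ resp → +-congʳ (*-cong (trans (*-identityˡ _) χ≈1) (resp shift≈)))

  σ^-monomial-fixed⁻ : ∀ m e → fold (monomial e) σ m ≋ monomial e → shift m e E.≈ e × ζ ^ weight m e ≈ 1#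
  σ^-monomial-fixed⁻ m e fixed = proj₁ unique , trans (sym (*-identityˡ _)) (proj₂ unique)
    where
    unique = leading-unique
      (leading-singleton {1# * ζ ^ weight m e} {shift m e} (*-nonzero 1≉0 (^-nonzero (weight m e) ζ≉0)))
      (leading-singleton {1#} {e} 1≉0)
      (≋-trans (≋-sym (σ^≋twist m (monomial e))) fixed)

-- The field K, generators of its tower, and the obstruction to ξ being a norm

module Construction {p : ℕ} (pr : Prime p) {k : ℕ} (C : CyclotomicRing p k) (t : ℕ) where
  open CyclotomicRingProperties pr C using (domain; no-root; ζ≉0; ξ≉1; ξ≉0)
  open CyclotomicRing C using (ζ; ξ; ζ^pᵏ⁺¹≈1; p≉0)
  open IntegralDomain domain using (Carrier; _≈_; _*_; 0#; 1#; 1≉0; refl; sym; trans; *-identityʳ; *-assoc; *-congˡ; *-congʳ; *-cong; +-identityʳ; *-cancelʳ; *-nonzero; ^-nonzero; _^_; semiring; *-commutativeMonoid)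
  open Algebra.Properties.Semiring.Exp semiring using (^-assocʳ; ^-congʳ; ^-congˡ)
  open Algebra.Properties.Semiring.Mult semiring using () renaming (_×_ to _·_)
  open Algebra.Properties.CommutativeMonoid.Sum *-commutativeMonoid using ()
    renaming (sum to product; ∑-distrib-+ to ∏-distrib-*; sum-replicate to product-replicate; sum-cong-≋ to product-cong)

  private
    q L P n : ℕ
    q = p ℕ.^ t
    L = p ℕ.^ suc k
    P = p ℕ.^ k
    n = suc k ℕ.+ t

    instance
      p≢0 : ℕ.NonZero p
      p≢0 = prime⇒nonZero pr

      q≢0 : ℕ.NonZero q
      q≢0 = ℕ.m^n≢0 p t

      L≢0 : ℕ.NonZero L
      L≢0 = ℕ.m^n≢0 p (suc k)

      1<p : ℕ.NonTrivial p
      1<p = prime⇒nonTrivial pr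

    Lq≡pⁿ : L ℕ.* q ≡ p ℕ.^ n
    Lq≡pⁿ = ≡.sym (ℕ.^-distribˡ-+-* p (suc k) t)

    p^-mono-< : ∀ {i j} → i ℕ.< j → p ℕ.^ i ℕ.< p ℕ.^ j
    p^-mono-< = ℕ.^-monoʳ-< p (ℕ.nonTrivial⇒n>1 p)

  open MonomialAction domain ζ ζ≉0 q
  private
    module A = IntegralDomain algebraDomain
    module A∏ = Algebra.Properties.CommutativeMonoid.Sum A.*-commutativeMonoid
  open Fractions algebraDomain using (Fraction; numerator; denominator; embed; embed-cong; embed-injective; embed-^; embed-×; mapFraction; mapFraction-isRingHomomorphism; _≃_; mk≃; cross; ≃0⁺; fractionRing; fractionField) public
  private
    module K = CommutativeRing fractionRing
    module K^ = Algebra.Properties.Semiring.Exp K.semiring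
    module K× = Algebra.Properties.Semiring.Mult K.semiring
    module K∏ = Algebra.Properties.CommutativeMonoid.Sum K.*-commutativeMonoid
    module σ = IsRingHomomorphism σ-isRingHomomorphism

  ζᴸ≈1 : ∀ c → L ∣ c → ζ ^ c ≈ 1#
  ζᴸ≈1 c (divides r eq) = trans (^-congʳ ζ (≡.trans eq (ℕ.*-comm r L)))
    (trans (sym (^-assocʳ ζ L r)) (trans (^-congˡ r ζ^pᵏ⁺¹≈1) (1^n≈1 (IntegralDomain.commutativeRing domain) r)))

  σ-order : ∀ f → fold f σ (p ℕ.^ n) ≋ f
  σ-order f = ≡.subst (λ m → fold f σ m ≋ f) Lq≡pⁿ (σ-periodic L ζ^pᵏ⁺¹≈1 f)

  -- f = σ^(pⁿ - 1) (σ f). This keeps denominators nonzero when σ is extended to fractions.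
  σ-injective : ∀ {f} → σ f ≋ [] → f ≋ []
  σ-injective {f} σf≈0 = ≋-trans (≋-sym (σ-order f)) (≡.subst (λ m → fold f σ m ≋ [])
    (≡.trans (ℕ.+-comm (ℕ.pred (p ℕ.^ n)) 1) (ℕ.suc-pred (p ℕ.^ n) {{ℕ.m^n≢0 p n}})) (kills (ℕ.pred (p ℕ.^ n))))
    where
    kills : ∀ m → fold f σ (m ℕ.+ 1) ≋ []
    kills zero    = σf≈0
    kills (suc m) = σ.⟦⟧-cong (kills m)

  σᶠ : Fraction → Fraction
  σᶠ = mapFraction σ-isRingHomomorphism σ-injective

  σᶠ-isRingHomomorphism : IsRingHomomorphism K.rawRing K.rawRing σᶠ
  σᶠ-isRingHomomorphism = mapFraction-isRingHomomorphism σ-isRingHomomorphism σ-injective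

  numerator-σᶠ^ : ∀ m x → numerator (fold x σᶠ m) ≡ fold (numerator x) σ m
  numerator-σᶠ^ zero    x = ≡.refl
  numerator-σᶠ^ (suc m) x = ≡.cong σ (numerator-σᶠ^ m x)

  denominator-σᶠ^ : ∀ m x → denominator (fold x σᶠ m) ≡ fold (denominator x) σ m
  denominator-σᶠ^ zero    x = ≡.refl
  denominator-σᶠ^ (suc m) x = ≡.cong σ (denominator-σᶠ^ m x)

  embed-σ^ : ∀ m f → fold (embed f) σᶠ m ≃ embed (fold f σ m)
  embed-σ^ zero    f = K.refl
  embed-σ^ (suc m) f = K.trans (IsRingHomomorphism.⟦⟧-cong σᶠ-isRingHomomorphism (embed-σ^ m f))
    (mk≃ (A.*-congˡ {σ (fold f σ m)} (A.sym σ.1#-homo)))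

  σᶠ-order : ∀ x → fold x σᶠ (p ℕ.^ n) ≃ x
  σᶠ-order x = mk≃ (A.*-cong
    (A.trans (A.reflexive (numerator-σᶠ^ (p ℕ.^ n) x)) (σ-order (numerator x)))
    (A.sym (A.trans (A.reflexive (denominator-σᶠ^ (p ℕ.^ n) x)) (σ-order (denominator x)))))

  constant : Carrier → FormalSum
  constant c = (c , const 0) ∷ []

  constant-cong : ∀ {a b} → a ≈ b → constant a ≋ constant b
  constant-cong a≈b = mk≋ λ φ _ → IntegralDomain.+-congʳ domain (*-congʳ a≈b)

  constant-^ : ∀ a m → constant (a ^ m) ≋ constant a A.^ m
  constant-^ a zero    = ≋-refl
  constant-^ a (suc m) = A.*-congˡ {constant a} (constant-^ a m)

  constant-injective : ∀ {a b} → ¬ (a ≈ 0#) → ¬ (b ≈ 0#) → constant a ≋ constant b → a ≈ b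
  constant-injective {a} {b} a≉0 b≉0 eq = proj₂ (leading-unique (leading-singleton {a} {const 0} a≉0) (leading-singleton {b} {const 0} b≉0) eq)

  ζᶠ ξᶠ : Fraction
  ζᶠ = embed (constant ζ)
  ξᶠ = embed (constant ξ)

  ξᶠ≃ζᶠ^pᵏ : ξᶠ ≃ ζᶠ K^.^ P
  ξᶠ≃ζᶠ^pᵏ = K.trans (embed-cong (constant-^ ζ P)) (embed-^ (constant ζ) P)

  ζᶠ^pᵏ⁺¹≃1 : ζᶠ K^.^ L ≃ K.1#
  ζᶠ^pᵏ⁺¹≃1 = K.trans (K.sym (embed-^ (constant ζ) L))
    (embed-cong (A.trans (A.sym (constant-^ ζ L)) (constant-cong ζ^pᵏ⁺¹≈1)))

  ξᶠ^p≃1 : ξᶠ K^.^ p ≃ K.1#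
  ξᶠ^p≃1 = K.trans (K^.^-congˡ p ξᶠ≃ζᶠ^pᵏ) (K.trans (K^.^-assocʳ ζᶠ P p)
    (K.trans (K^.^-congʳ ζᶠ (ℕ.*-comm P p)) ζᶠ^pᵏ⁺¹≃1))

  ξᶠ≄1 : ¬ (ξᶠ ≃ K.1#)
  ξᶠ≄1 eq = ξ≉1 (constant-injective ξ≉0 1≉0 (embed-injective eq))

  ζᶠ≄0 : ¬ (ζᶠ ≃ K.0#)
  ζᶠ≄0 eq = leading-≉0 (leading-singleton {ζ} {const 0} ζ≉0) (embed-injective eq)

  ζᶠ-fixed : σᶠ ζᶠ ≃ ζᶠ
  ζᶠ-fixed = K.trans (embed-σ^ 1 (constant ζ)) (embed-cong
    (mk≋ λ φ resp → IntegralDomain.+-congʳ domain (*-cong (*-identityʳ ζ) (resp λ _ _ → ≡.refl))))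

  ξᶠ-fixed : σᶠ ξᶠ ≃ ξᶠ
  ξᶠ-fixed = K.trans (embed-σ^ 1 (constant ξ)) (embed-cong
    (mk≋ λ φ resp → IntegralDomain.+-congʳ domain (*-cong (*-identityʳ ξ) (resp λ _ _ → ≡.refl))))

  p·1≄0 : ¬ (p K×.× K.1# ≃ K.0#)
  p·1≄0 eq = leading-≉0 (leading-singleton {p · 1#} {const 0} p≉0)
    (A.trans (constant-· p) (embed-injective (K.trans (embed-× p) eq)))
    where
    module A× = Algebra.Properties.Semiring.Mult A.semiring
    constant-· : ∀ m → constant (m · 1#) ≋ m A×.× A.1#
    constant-· zero    = mk≋ λ φ _ → trans (+-identityʳ _) (IntegralDomain.zeroˡ domain _)
    constant-· (suc m) = A.trans
      (mk≋ λ φ _ → trans (+-identityʳ _) (trans (IntegralDomain.distribʳ domain _ _ _)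
        (IntegralDomain.+-congˡ domain (sym (+-identityʳ _)))))
      (A.+-congˡ {A.1#} (constant-· m))

  -- For s < t, the product of the Yᵢᴸ with pˢ⁺¹ ∣ i: its stabiliser is visible in the positions,
  -- and the exponent L hides the factors ζ. For s ≥ t, a power of Y₀ chosen so that σ^(pˢ), which
  -- is s - t times the p-th power of σ^q, multiplies it by ζ^(pᵏ) = ξ ≠ 1, while σ^(pˢ⁺¹)
  -- multiplies it by ξᵖ = 1.
  θᴱ : ℕ → ℕ → ℕ
  θᴱ s i with s ℕ.<? t
  ... | yes _ = if ⌊ p ℕ.^ suc s ∣? i ⌋ then L else 0
  ... | no  _ = if ⌊ i ℕ.≟ 0 ⌋ then p ℕ.^ (k ∸ (s ∸ t)) else 0

  θ : ℕ → Fraction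
  θ s = embed (monomial (θᴱ s))

  private
    θ-fixed⁺ : ∀ s m → L ∣ weight m (θᴱ s) → shift m (θᴱ s) E.≈ θᴱ s → fold (θ s) σᶠ m ≃ θ s
    θ-fixed⁺ s m L∣w shift≈ = K.trans (embed-σ^ m (monomial (θᴱ s)))
      (embed-cong (σ^-monomial-fixed⁺ m (θᴱ s) (ζᴸ≈1 _ L∣w) shift≈))

    θ-fixed⁻ : ∀ s m → fold (θ s) σᶠ m ≃ θ s → shift m (θᴱ s) E.≈ θᴱ s × ζ ^ weight m (θᴱ s) ≈ 1#
    θ-fixed⁻ s m fixed = σ^-monomial-fixed⁻ m (θᴱ s)
      (embed-injective (K.trans (K.sym (embed-σ^ m (monomial (θᴱ s)))) fixed))

    low-∣ : ∀ {s} → s ℕ.< t → ∀ {i} → p ℕ.^ suc s ∣ i → θᴱ s i ≡ L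
    low-∣ {s} s<t {i} ∣i with s ℕ.<? t
    ... | no s≮t = contradiction s<t s≮t
    ... | yes _ with p ℕ.^ suc s ∣? i
    ...   | yes _ = ≡.refl
    ...   | no ∤i = contradiction ∣i ∤i

    low-∤ : ∀ {s} → s ℕ.< t → ∀ {i} → ¬ (p ℕ.^ suc s ∣ i) → θᴱ s i ≡ 0
    low-∤ {s} s<t {i} ∤i with s ℕ.<? t
    ... | no s≮t = contradiction s<t s≮t
    ... | yes _ with p ℕ.^ suc s ∣? i
    ...   | yes ∣i = contradiction ∣i ∤i
    ...   | no _   = ≡.refl

    high-0 : ∀ {s} → ¬ (s ℕ.< t) → θᴱ s 0 ≡ p ℕ.^ (k ∸ (s ∸ t))
    high-0 {s} s≮t with s ℕ.<? t
    ... | yes s<t = contradiction s<t s≮t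
    ... | no _    = ≡.refl

    high-suc : ∀ {s} → ¬ (s ℕ.< t) → ∀ i → θᴱ s (suc i) ≡ 0
    high-suc {s} s≮t i with s ℕ.<? t
    ... | yes s<t = contradiction s<t s≮t
    ... | no _    = ≡.refl

    low-weight : ∀ {s} → s ℕ.< t → ∀ m → L ∣ weight m (θᴱ s)
    low-weight         s<t zero    = L ∣0
    low-weight {s} s<t (suc m) = ∣m∣n⇒∣m+n (low-weight s<t m) (value (p ℕ.^ suc s ∣? (m % q)))
      where
      value : Dec (p ℕ.^ suc s ∣ m % q) → L ∣ θᴱ s (m % q)
      value (yes ∣i) = ≡.subst (L ∣_) (≡.sym (low-∣ s<t ∣i)) ∣-refl
      value (no  ∤i) = ≡.subst (L ∣_) (≡.sym (low-∤ s<t ∤i)) (L ∣0)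

    p^∣q : ∀ {s} → s ℕ.≤ t → p ℕ.^ s ∣ q
    p^∣q {s} s≤t = ≡.subst (p ℕ.^ s ∣_)
      (≡.trans (≡.sym (ℕ.^-distribˡ-+-* p s (t ∸ s))) (≡.cong (p ℕ.^_) (ℕ.m+[n∸m]≡n s≤t)))
      (m∣m*n (p ℕ.^ (t ∸ s)))

    low-shift : ∀ {s} → s ℕ.< t → shift (p ℕ.^ suc s) (θᴱ s) E.≈ θᴱ s
    low-shift {s} s<t i _ = value (p ℕ.^ suc s ∣? i)
      where
      d = p ℕ.^ suc s
      value : Dec (d ∣ i) → θᴱ s ((d ℕ.+ i) % q) ≡ θᴱ s i
      value (yes ∣i) = ≡.trans (low-∣ s<t (%-presˡ-∣ (∣m∣n⇒∣m+n ∣-refl ∣i) (p^∣q s<t))) (≡.sym (low-∣ s<t ∣i))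
      value (no  ∤i) = ≡.trans
        (low-∤ s<t λ ∣[d+i]%q → ∤i (∣m+n∣m⇒∣n (∣n∣m%n⇒∣m (p^∣q s<t) ∣[d+i]%q) ∣-refl))
        (≡.sym (low-∤ s<t ∤i))

    low-moved : ∀ {s} → s ℕ.< t → ¬ (shift (p ℕ.^ s) (θᴱ s) E.≈ θᴱ s)
    low-moved {s} s<t shift≈ = ℕ.≢-nonZero⁻¹ L (≡.trans (≡.sym (low-∣ s<t {0} ((p ℕ.^ suc s) ∣0)))
      (≡.trans (≡.sym (shift≈ 0 0<q)) (low-∤ s<t ∤)))
      where
      [p^s+0]%q : (p ℕ.^ s ℕ.+ 0) % q ≡ p ℕ.^ s
      [p^s+0]%q = ≡.trans (≡.cong (_% q) (ℕ.+-identityʳ (p ℕ.^ s))) (m<n⇒m%n≡m (p^-mono-< s<t))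
      ∤ : ¬ (p ℕ.^ suc s ∣ (p ℕ.^ s ℕ.+ 0) % q)
      ∤ ∣ = ℕ.<⇒≱ (p^-mono-< {s} {suc s} ℕ.≤-refl)
        (∣⇒≤ {{ℕ.m^n≢0 p s}} (≡.subst (p ℕ.^ suc s ∣_) [p^s+0]%q ∣))

    high-weight-q : ∀ {s} → ¬ (s ℕ.< t) → weight q (θᴱ s) ≡ p ℕ.^ (k ∸ (s ∸ t))
    high-weight-q {s} s≮t = ≡.trans (≡.cong (λ m → weight m (θᴱ s)) (≡.sym (ℕ.suc-pred q))) (go (ℕ.pred q) (≡.subst (ℕ.pred q ℕ.<_) (ℕ.suc-pred q) ℕ.≤-refl))
      where
      go : ∀ m → m ℕ.< q → weight (suc m) (θᴱ s) ≡ p ℕ.^ (k ∸ (s ∸ t))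
      go zero    0<q = ≡.trans (≡.cong (θᴱ s) (m<n⇒m%n≡m 0<q)) (high-0 s≮t)
      go (suc m) m<q = ≡.trans (≡.cong₂ ℕ._+_ (go m (ℕ.<⇒≤ m<q))
        (≡.trans (≡.cong (θᴱ s) (m<n⇒m%n≡m m<q)) (high-suc s≮t m))) (ℕ.+-identityʳ _)

    high-weight : ∀ {s} → ¬ (s ℕ.< t) → ∀ c → weight (p ℕ.^ c ℕ.* q) (θᴱ s) ≡ p ℕ.^ (c ℕ.+ (k ∸ (s ∸ t)))
    high-weight {s} s≮t c = ≡.trans (weight-multiple (p ℕ.^ c) (θᴱ s))
      (≡.trans (≡.cong (p ℕ.^ c ℕ.*_) (high-weight-q s≮t)) (≡.sym (ℕ.^-distribˡ-+-* p c (k ∸ (s ∸ t)))))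

    split : ∀ {s} → ¬ (s ℕ.< t) → p ℕ.^ s ≡ p ℕ.^ (s ∸ t) ℕ.* q
    split {s} s≮t = ≡.trans (≡.cong (p ℕ.^_) (≡.sym (ℕ.m∸n+n≡m (ℕ.≮⇒≥ s≮t)))) (ℕ.^-distribˡ-+-* p (s ∸ t) t)

    s∸t≤k : ∀ {s} → s ℕ.< n → s ∸ t ℕ.≤ k
    s∸t≤k {s} s<n = ≡.subst (s ∸ t ℕ.≤_) (ℕ.m+n∸n≡m k t) (ℕ.∸-monoˡ-≤ t (ℕ.≤-pred s<n))

  θ-fixed : ∀ {s} → s ℕ.< n → fold (θ s) σᶠ (p ℕ.^ suc s) ≃ θ s
  θ-fixed {s} s<n = by (s ℕ.<? t)
    where
    by : Dec (s ℕ.< t) → fold (θ s) σᶠ (p ℕ.^ suc s) ≃ θ s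
    by (yes s<t) = θ-fixed⁺ s (p ℕ.^ suc s) (low-weight s<t (p ℕ.^ suc s)) (low-shift s<t)
    by (no  s≮t) = ≡.subst (λ m → fold (θ s) σᶠ m ≃ θ s) (≡.sym p^1+s)
      (θ-fixed⁺ s (p ℕ.^ suc (s ∸ t) ℕ.* q)
        (≡.subst (L ∣_) (≡.sym (≡.trans (high-weight s≮t (suc (s ∸ t))) (≡.cong (λ j → p ℕ.^ suc j) (ℕ.m+[n∸m]≡n (s∸t≤k s<n))))) ∣-refl)
        (shift-multiple (p ℕ.^ suc (s ∸ t)) (θᴱ s)))
      where
      p^1+s : p ℕ.^ suc s ≡ p ℕ.^ suc (s ∸ t) ℕ.* q
      p^1+s = ≡.trans (≡.cong (p ℕ.*_) (split s≮t)) (≡.sym (ℕ.*-assoc p (p ℕ.^ (s ∸ t)) q))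

  θ-moved : ∀ {s} → s ℕ.< n → ¬ (fold (θ s) σᶠ (p ℕ.^ s) ≃ θ s)
  θ-moved {s} s<n = by (s ℕ.<? t)
    where
    by : Dec (s ℕ.< t) → ¬ (fold (θ s) σᶠ (p ℕ.^ s) ≃ θ s)
    by (yes s<t) fixed = low-moved s<t (proj₁ (θ-fixed⁻ s (p ℕ.^ s) fixed))
    by (no  s≮t) fixed = ξ≉1 (trans
      (^-congʳ ζ (≡.sym (≡.trans (high-weight s≮t (s ∸ t)) (≡.cong (p ℕ.^_) (ℕ.m+[n∸m]≡n (s∸t≤k s<n))))))
      (proj₂ (θ-fixed⁻ s (p ℕ.^ (s ∸ t) ℕ.* q) (≡.subst (λ m → fold (θ s) σᶠ m ≃ θ s) (split s≮t) fixed))))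

  action : CyclicAction fractionField p n
  action = record
    { σ       = σᶠ
    ; σ-hom   = σᶠ-isRingHomomorphism
    ; σ-order = σᶠ-order
    ; θ       = θ
    ; θ-fixed = θ-fixed
    ; θ-moved = θ-moved
    }

  private
    leading-product : ∀ M {e} (f : Fin M → FormalSum) (c : Fin M → Carrier) →
      (∀ i → Leading (f i) e (c i)) → Leading (A∏.sum f) (λ i → M ℕ.* e i) (product c)
    leading-product zero    f c ℓ = leading-singleton 1≉0
    leading-product (suc M) f c ℓ = leading-* (ℓ zero) (leading-product M (f ∘ suc) (c ∘ suc) (ℓ ∘ suc))

    conjugate-product : ∀ M → FormalSum → FormalSum
    conjugate-product M f = A∏.sum {M} λ i → fold f σ (toℕ i ℕ.* q)

    leading-conjugate-product : ∀ M {f e c} → Leading f e c →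
      Leading (conjugate-product M f) (λ i → M ℕ.* e i) (product {M} λ i → c * ζ ^ (toℕ i ℕ.* weight q e))
    leading-conjugate-product M ℓ = leading-product M _ _ λ i → leading-σ^cq (toℕ i) ℓ

    product-≉0 : ∀ M (u : Fin M → Carrier) → (∀ i → ¬ (u i ≈ 0#)) → ¬ (product u ≈ 0#)
    product-≉0 zero    u u≉0 = 1≉0
    product-≉0 (suc M) u u≉0 = *-nonzero (u≉0 zero) (product-≉0 M (u ∘ suc) (u≉0 ∘ suc))

    -- Comparing leading coefficients, ∏ᵢ σ^(iq) f = ξ ∏ᵢ σ^(iq) g over i < L
    -- gives c^L = ξ c′^L for those of f and g.
    no-conjugate-product : ∀ f g → ¬ (f ≋ []) → ¬ (g ≋ []) → ¬ (conjugate-product L f ≋ constant ξ ⊛ conjugate-product L g)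
    no-conjugate-product f g f≉0 g≉0 eq = compare (zero-or-leading f) (zero-or-leading g)
      where
      compare : f ≋ [] ⊎ (∃[ e ] ∃[ c ] Leading f e c) → g ≋ [] ⊎ (∃[ e ] ∃[ c ] Leading g e c) → ⊥
      compare (inj₁ f≈0) _ = f≉0 f≈0
      compare (inj₂ _) (inj₁ g≈0) = g≉0 g≈0
      compare (inj₂ (e , c , ℓ)) (inj₂ (e′ , c′ , ℓ′)) = no-root (Leading.nonzero ℓ′)
        (*-cancelʳ (product-≉0 L u λ i → ^-nonzero (toℕ i ℕ.* weight q e) ζ≉0) (trans (sym (factor c))
          (trans (proj₂ unique) (trans (*-congˡ (trans
            (product-cong {L} λ i → *-congˡ (^-congʳ ζ (≡.cong (toℕ i ℕ.*_) (≡.sym weights)))) (factor c′)))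
            (sym (*-assoc _ _ _))))))
        where
        u : Fin L → Carrier
        u i = ζ ^ (toℕ i ℕ.* weight q e)

        unique = leading-unique (leading-conjugate-product L ℓ)
          (leading-* (leading-singleton {ξ} {const 0} ξ≉0) (leading-conjugate-product L ℓ′)) eq

        -- The leading exponents of the two sides are L e and L e′. Cancelling L gives equal total
        -- degrees, so both sides contain the same nonzero product of the `u i`.
        weights : weight q e ≡ weight q e′
        weights = weight-cong q λ i i<q → ℕ.*-cancelˡ-≡ (e i) (e′ i) L (proj₁ unique i i<q)

        factor : ∀ a → product {L} (λ i → a * u i) ≈ a ^ L * product u
        factor a = trans (∏-distrib-* {L} (const a) u) (*-congʳ (product-replicate L))

    numerator-∏ : ∀ M (x : Fin M → Fraction) → numerator (K∏.sum x) ≡ A∏.sum (numerator ∘ x)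
    numerator-∏ zero    x = ≡.refl
    numerator-∏ (suc M) x = ≡.cong (numerator (x zero) ⊛_) (numerator-∏ M (x ∘ suc))

    denominator-∏ : ∀ M (x : Fin M → Fraction) → denominator (K∏.sum x) ≡ A∏.sum (denominator ∘ x)
    denominator-∏ zero    x = ≡.refl
    denominator-∏ (suc M) x = ≡.cong (denominator (x zero) ⊛_) (denominator-∏ M (x ∘ suc))

  ξᶠ-not-norm : ∀ x → ¬ (x ≃ K.0#) → ¬ (K∏.sum {L} (λ i → fold x σᶠ (toℕ i ℕ.* q)) ≃ ξᶠ)
  ξᶠ-not-norm x x≄0 eq = no-conjugate-product (numerator x) (denominator x) (x≄0 ∘ ≃0⁺) (Fraction.nonzero x) (begin
    conjugate-product L (numerator x)
      ≈⟨ A∏.sum-cong-≋ {L} (λ i → A.reflexive (numerator-σᶠ^ (toℕ i ℕ.* q) x)) ⟨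
    A∏.sum {L} (λ i → numerator (y i))
      ≡⟨ numerator-∏ L y ⟨
    numerator (K∏.sum y)
      ≈⟨ A.*-identityʳ (numerator (K∏.sum y)) ⟨
    -- `A.1#` is the denominator of `ξᶠ`; cross-multiplication turns the norm of a fraction into
    -- N(f) = ξ N(g) in the polynomial ring.
    numerator (K∏.sum y) ⊛ A.1#
      ≈⟨ cross eq ⟩
    constant ξ ⊛ denominator (K∏.sum y)
      ≡⟨ ≡.cong (constant ξ ⊛_) (denominator-∏ L y) ⟩
    constant ξ ⊛ A∏.sum {L} (λ i → denominator (y i))
      ≈⟨ A.*-congˡ {constant ξ} (A∏.sum-cong-≋ {L} (λ i → A.reflexive (denominator-σᶠ^ (toℕ i ℕ.* q) x))) ⟩
    constant ξ ⊛ conjugate-product L (denominator x) ∎)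
    where
    open import Relation.Binary.Reasoning.Setoid A.setoid
    y : Fin L → Fraction
    y i = fold x σᶠ (toℕ i ℕ.* q)

-- Norms as products over powers of σ, and the invariant

module IndexedSums (M : CommutativeMonoid 0ℓ 0ℓ) where
  open CommutativeMonoid M
  open Algebra.Properties.CommutativeMonoid.Sum M

  -- With f defined on all naturals the length can be rewritten by an equation in ℕ without
  -- transporting f.
  sum< : ℕ → (ℕ → Carrier) → Carrier
  sum< d f = sum {d} (f ∘ toℕ)

  sum<-+ : ∀ m n f → sum< (m ℕ.+ n) f ≈ sum< m f ∙ sum< n (f ∘ (m ℕ.+_))
  sum<-+ zero    n f = sym (identityˡ _)
  sum<-+ (suc m) n f = trans (∙-congˡ (sum<-+ m n (f ∘ suc))) (sym (assoc _ _ _))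

  sum<-* : ∀ m n f → sum< (m ℕ.* n) f ≈ sum< m (λ i → sum< n (λ j → f (i ℕ.* n ℕ.+ j)))
  sum<-* zero    n f = refl
  sum<-* (suc m) n f = trans (sum<-+ n (m ℕ.* n) f) (∙-congˡ (trans (sum<-* m n (f ∘ (n ℕ.+_)))
    (sum-cong-≋ {m} λ i → sum-cong-≋ {n} λ j → reflexive (≡.cong f (≡.sym (ℕ.+-assoc n (toℕ i ℕ.* n) (toℕ j)))))))

open import Data.Nat.Base using (_≤_; _^_)

Realises : ℕ → ℕ → ℤ ₋ → Set₁
Realises p n v =
  Σ[ F ∈ Field ] (¬ HasCharacteristic F p) ×
  (Σ[ ξ ∈ FieldOps.Carrier F ] IsPrimitiveRootOfUnity F p ξ ×
  (Σ[ E ∈ Extension F ] Σ[ galois ∈ IsCyclicGalois E (p ^ n) ] Σ[ tower ∈ Tower E p n ]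
  InvariantIs E galois tower ξ v))

module CyclicNorms
  (𝕂 : DiscreteField) {p : ℕ} (pr : Prime p) {n : ℕ} (action : CyclicAction 𝕂 p n)
  (ξF : CommutativeRing.Carrier (CyclicExtension.fixedRing 𝕂 pr action))
  where

  open CyclicAction action
  open DiscreteField 𝕂
  open CommutativeRing commutativeRing hiding (zero)
  open CyclicExtension 𝕂 pr action
  open IntegralDomain domain using (*-nonzero)
  open Homomorphisms commutativeRing using (iterate-isRingHomomorphism)
  open Algebra.Properties.CommutativeMonoid.Sum *-commutativeMonoid using ()
    renaming (sum to product; sum-cong-≋ to product-cong; sum-replicate to product-replicate)
  open IndexedSums *-commutativeMonoid renaming (sum< to product<; sum<-* to product<-*)
  private
    module K^ = Algebra.Properties.Semiring.Exp semiring
    module K× = Algebra.Properties.Semiring.Mult semiring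
    module F^ = Algebra.Properties.Semiring.Exp (CommutativeRing.semiring fixedRing)
    module F× = Algebra.Properties.Semiring.Mult (CommutativeRing.semiring fixedRing)
    module σ^ m = IsRingHomomorphism (iterate-isRingHomomorphism σ-hom m)

  private
    ξ : Carrier
    ξ = proj₁ ξF

  ^-proj₁ : ∀ x m → proj₁ (x F^.^ m) ≡ proj₁ x K^.^ m
  ^-proj₁ x zero    = ≡.refl
  ^-proj₁ x (suc m) = ≡.cong (proj₁ x *_) (^-proj₁ x m)

  ×-proj₁ : ∀ m x → proj₁ (m F×.× x) ≡ m K×.× proj₁ x
  ×-proj₁ zero    x = ≡.refl
  ×-proj₁ (suc m) x = ≡.cong (λ u → proj₁ x + u) (×-proj₁ m x)

  ξF-primitive : ξ K^.^ p ≈ 1# → ¬ (ξ ≈ 1#) → IsPrimitiveRootOfUnity F p ξF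
  ξF-primitive ξᵖ≈1 ξ≉1 =
    trans (reflexive (^-proj₁ ξF p)) ξᵖ≈1 ,
    -- Exponents killing ξ are periods: p¹ is one and p⁰ is not, so no positive exponent below p is.
    λ i 0<i i<p ξⁱ≈1 → minimal-period pr 0
      (≡.subst (λ m → ξ K^.^ m ≈ 1#) (≡.sym (ℕ.*-identityʳ p)) ξᵖ≈1)
      (λ ξ¹≈1 → ξ≉1 (trans (sym (*-identityʳ ξ)) ξ¹≈1))
      i 0<i (≡.subst (i ℕ.<_) (≡.sym (ℕ.*-identityʳ p)) i<p)
      (trans (sym (reflexive (^-proj₁ ξF i))) ξⁱ≈1)
    where
    open Periods (λ m → ξ K^.^ m ≈ 1#) refl
      (λ {a} {b} ξᵃ ξᵇ → trans (K^.^-homo-* ξ a b) (trans (*-cong ξᵃ ξᵇ) (*-identityˡ 1#)))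
      (λ {a} {b} ξᵃ⁺ᵇ ξᵇ → trans (sym (*-identityʳ _)) (trans (*-congˡ (sym ξᵇ)) (trans (sym (K^.^-homo-* ξ a b)) ξᵃ⁺ᵇ)))

  ¬characteristic : ¬ (p K×.× 1# ≈ 0#) → ¬ HasCharacteristic F p
  ¬characteristic p≉0 char = p≉0 (trans (sym (reflexive (×-proj₁ p (CommutativeRing.1# fixedRing))))
    (Equivalence.from (char p) ∣-refl))

  -- By the enumeration of the Galois group as powers of σ^(pˢ), this unfolds to the same type as
  -- `IsNormTo` at level s, and for s = 0 as `NormToBase`.
  IsNormFrom : ℕ → Set
  IsNormFrom s = ∃[ x ] ¬ (x ≈ 0#) × product {p ℕ.^ (n ∸ s)} (λ i → fold x σ (toℕ i ℕ.* p ℕ.^ s)) ≈ ξ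

  private
    fold-≉0 : ∀ m {x} → ¬ (x ≈ 0#) → ¬ (fold x σ m ≈ 0#)
    fold-≉0 m x≉0 σᵐx≈0 = x≉0 (power-injective m (trans σᵐx≈0 (sym (σ^.0#-homo m))))

    product-≉0 : ∀ d (f : Fin d → Carrier) → (∀ i → ¬ (f i ≈ 0#)) → ¬ (product f ≈ 0#)
    product-≉0 zero    f f≉0 = 1≉0
    product-≉0 (suc d) f f≉0 = *-nonzero (f≉0 zero) (product-≉0 d (f ∘ suc) (f≉0 ∘ suc))

    product-homo : ∀ m d (f : Fin d → Carrier) → fold (product f) σ m ≈ product (λ i → fold (f i) σ m)
    product-homo m zero    f = σ^.1#-homo m
    product-homo m (suc d) f = trans (σ^.*-homo m _ _) (*-congˡ (product-homo m d (f ∘ suc)))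

  -- The σ^(jq) with j < b represent the cosets of the subgroup generated by σ^(pᵗ) in that
  -- generated by σ^(pˢ). The partial product y over them has the same norm to K_t as x has to K_s.
  -- So the levels at which ξ is a norm are upward closed.
  norm-transitive : ∀ {s t} → s ℕ.≤ t → t ℕ.≤ n → IsNormFrom s → IsNormFrom t
  norm-transitive {s} {t} s≤t t≤n (x , x≉0 , Nx≈ξ) =
    y , product-≉0 b _ (λ j → fold-≉0 (toℕ j ℕ.* q) x≉0) , trans Ny≈Nx Nx≈ξ
    where
    a = p ℕ.^ (n ∸ t)
    b = p ℕ.^ (t ∸ s)
    q = p ℕ.^ s

    y : Carrier
    y = product< b λ j → fold x σ (j ℕ.* q)

    ab≡ : a ℕ.* b ≡ p ℕ.^ (n ∸ s)
    ab≡ = ≡.trans (≡.sym (ℕ.^-distribˡ-+-* p (n ∸ t) (t ∸ s))) (≡.cong (p ℕ.^_)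
      (≡.trans (≡.sym (ℕ.+-∸-assoc (n ∸ t) s≤t)) (≡.cong (_∸ s) (ℕ.m∸n+n≡m t≤n))))

    bq≡ : b ℕ.* q ≡ p ℕ.^ t
    bq≡ = ≡.trans (≡.sym (ℕ.^-distribˡ-+-* p (t ∸ s) s)) (≡.cong (p ℕ.^_) (ℕ.m∸n+n≡m s≤t))

    index : ∀ i j → i ℕ.* p ℕ.^ t ℕ.+ j ℕ.* q ≡ (i ℕ.* b ℕ.+ j) ℕ.* q
    index i j = ≡.trans (≡.cong (λ m → i ℕ.* m ℕ.+ j ℕ.* q) (≡.sym bq≡))
      (≡.trans (≡.cong (ℕ._+ j ℕ.* q) (≡.sym (ℕ.*-assoc i b q))) (≡.sym (ℕ.*-distribʳ-+ q (i ℕ.* b) j)))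

    Ny≈Nx : product {a} (λ i → fold y σ (toℕ i ℕ.* p ℕ.^ t)) ≈ product {p ℕ.^ (n ∸ s)} (λ i → fold x σ (toℕ i ℕ.* q))
    Ny≈Nx = trans
      (product-cong {a} λ i → trans (product-homo (toℕ i ℕ.* p ℕ.^ t) b _) (product-cong {b} λ j → trans
        (sym (fold-+-σ (toℕ i ℕ.* p ℕ.^ t) (toℕ j ℕ.* q) x)) (reflexive (≡.cong (fold x σ) (index (toℕ i) (toℕ j))))))
      (trans (sym (product<-* a b λ i → fold x σ (i ℕ.* q)))
        (reflexive (≡.cong (λ d → product< d λ i → fold x σ (i ℕ.* q)) ab≡)))

  norm-of-fixed : ∀ s {x} → σ x ≈ x → ¬ (x ≈ 0#) → x K^.^ (p ℕ.^ (n ∸ s)) ≈ ξ → IsNormFrom s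
  norm-of-fixed s {x} σx≈x x≉0 x^≈ξ = x , x≉0 ,
    trans (product-cong {p ℕ.^ (n ∸ s)} λ i → σ-fixed⇒ (toℕ i ℕ.* p ℕ.^ s) σx≈x)
      (trans (product-replicate (p ℕ.^ (n ∸ s))) x^≈ξ)

  invariant-⊥ : IsNormFrom 0 → InvariantIs extension isCyclicGalois tower ξF ⊥₋
  invariant-⊥ norm = norm

  -- By upward closure the two neighbouring levels t and t + 1 determine the minimum, and failure at
  -- t also excludes the base.
  invariant : ∀ {t} → t ℕ.< n → IsNormFrom (suc t) → ¬ IsNormFrom t →
    InvariantIs extension isCyclicGalois tower ξF [ + t ]
  invariant {t} t<n norm ¬norm =
    (λ normToBase → ¬norm (norm-transitive ℕ.z≤n t≤n normToBase)) ,
    s , (≡.subst IsNormFrom (≡.sym s≡1+t) norm , minimal) , ≡.cong (λ m → + m ℤ.- + 1) (≡.sym s≡1+t)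
    where
    t≤n = ℕ.<⇒≤ t<n

    s : Fin (suc n)
    s = Fin.fromℕ< (ℕ.s≤s t<n)

    s≡1+t : toℕ s ≡ suc t
    s≡1+t = Fin.toℕ-fromℕ< (ℕ.s≤s t<n)

    minimal : ∀ s′ → IsNormFrom (toℕ s′) → toℕ s ℕ.≤ toℕ s′
    minimal s′ norm′ = ≡.subst (ℕ._≤ toℕ s′) (≡.sym s≡1+t)
      (ℕ.≰⇒> λ s′≤t → ¬norm (norm-transitive s′≤t t≤n norm′))

-- Realisation of every value

module _ {p : ℕ} (pr : Prime p) {k : ℕ} (C : CyclotomicRing p k) where

  realises-level : ∀ t → Realises p (suc k ℕ.+ t) [ + t ]
  realises-level t =
    F , ¬characteristic p·1≄0 , (_ , _) , ξF-primitive ξᶠ^p≃1 ξᶠ≄1 ,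
    extension , isCyclicGalois , tower , invariant (ℕ.s≤s (ℕ.m≤n+m t k)) ξ-norm ξ-not-norm
    where
    open Construction pr C t
    open CyclicExtension fractionField pr action
    open CyclicNorms fractionField pr action (ξᶠ , ξᶠ-fixed)
    open CommutativeRing fractionRing using (*-commutativeMonoid; semiring; sym)
    open Algebra.Properties.Semiring.Exp semiring using () renaming (_^_ to _^ᶠ_)
    open Algebra.Properties.CommutativeMonoid.Sum *-commutativeMonoid using () renaming (sum to product)

    ξ-norm : IsNormFrom (suc t)
    ξ-norm = norm-of-fixed (suc t) ζᶠ-fixed ζᶠ≄0
      (≡.subst (λ m → ζᶠ ^ᶠ (p ^ m) ≃ ξᶠ) (≡.sym (ℕ.m+n∸n≡m k t)) (sym ξᶠ≃ζᶠ^pᵏ))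

    ξ-not-norm : ¬ IsNormFrom t
    ξ-not-norm (x , x≄0 , Nx≃ξ) = ξᶠ-not-norm x x≄0
      (≡.subst (λ m → product {p ^ m} (λ i → fold x σᶠ (toℕ i ℕ.* p ^ t)) ≃ ξᶠ) (ℕ.m+n∸n≡m (suc k) t) Nx≃ξ)

  -- For −∞ take the field of degree pᵏ⁺¹ realising t = 0 and replace σ by σᵖ:
  -- the base becomes its intermediate field of degree p, from which ξ is a norm.
  realises-⊥ : Realises p k ⊥₋
  realises-⊥ =
    F , ¬characteristic p·1≄0 , (_ , _) , ξF-primitive ξᶠ^p≃1 ξᶠ≄1 ,
    extension , isCyclicGalois , tower , invariant-⊥ (norm-of-fixed 0 τζ≃ζ ζᶠ≄0 (sym ξᶠ≃ζᶠ^pᵏ))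
    where
    open Construction pr C 0
    open CommutativeRing fractionRing using (sym; trans; reflexive)
    τ : Fraction → Fraction
    τ x = fold x σᶠ p

    fixed-by-τ : ∀ {x} → σᶠ x ≃ x → τ x ≃ x
    fixed-by-τ σx≃x = go p
      where
      go : ∀ m → fold _ σᶠ m ≃ _
      go zero    = CommutativeRing.refl fractionRing
      go (suc m) = trans (IsRingHomomorphism.⟦⟧-cong σᶠ-isRingHomomorphism (go m)) σx≃x

    τ^≡ : ∀ x s → fold x τ (p ^ s) ≡ fold x σᶠ (p ^ suc s)
    τ^≡ x s = ≡.trans (fold-iterated σᶠ p x (p ^ s)) (≡.cong (fold x σᶠ) (ℕ.*-comm (p ^ s) p))

    τ-order : ∀ x → fold x τ (p ^ k) ≃ x
    τ-order x = trans (reflexive (≡.trans (τ^≡ x k) (≡.cong (λ m → fold x σᶠ (p ^ suc m)) (≡.sym (ℕ.+-identityʳ k))))) (σᶠ-order x)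

    1+s< : ∀ {s} → s ℕ.< k → suc s ℕ.< suc k ℕ.+ 0
    1+s< s<k = ℕ.s≤s (≡.subst (_ ℕ.≤_) (≡.sym (ℕ.+-identityʳ k)) s<k)

    τ-fixed : ∀ {s} → s ℕ.< k → fold (θ (suc s)) τ (p ^ suc s) ≃ θ (suc s)
    τ-fixed {s} s<k = trans (reflexive (τ^≡ (θ (suc s)) (suc s))) (θ-fixed (1+s< s<k))

    τ-moved : ∀ {s} → s ℕ.< k → ¬ (fold (θ (suc s)) τ (p ^ s) ≃ θ (suc s))
    τ-moved {s} s<k fixed = θ-moved (1+s< s<k) (trans (reflexive (≡.sym (τ^≡ (θ (suc s)) s))) fixed)

    τζ≃ζ : τ ζᶠ ≃ ζᶠ
    τζ≃ζ = fixed-by-τ ζᶠ-fixed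

    τ-action : CyclicAction fractionField p k
    τ-action = record
      { σ       = τ
      ; σ-hom   = Homomorphisms.iterate-isRingHomomorphism fractionRing σᶠ-isRingHomomorphism p
      ; σ-order = τ-order
      -- The orbits under τ = σᵖ are p times shorter than those under σ, which lowers the level by
      -- one.
      ; θ       = θ ∘ suc
      ; θ-fixed = τ-fixed
      ; θ-moved = τ-moved
      }

    open CyclicExtension fractionField pr τ-action
    open CyclicNorms fractionField pr τ-action (ξᶠ , fixed-by-τ ξᶠ-fixed)

theorem2 : (p : ℕ) → Prime p → (n : ℕ) → 1 ≤ n → (t : (Fin n) ₋) →
    Σ[ F ∈ Field ] (¬ HasCharacteristic F p) ×
    (Σ[ ξ ∈ FieldOps.Carrier F ] IsPrimitiveRootOfUnity F p ξ ×
    (Σ[ E ∈ Extension F ] Σ[ galois ∈ IsCyclicGalois E (p ^ n) ] Σ[ tower ∈ Tower E p n ]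
    InvariantIs E galois tower ξ (map (λ i → + toℕ i) t)))
-- Here k = n: the auxiliary extension has degree pⁿ⁺¹, and its part above K₁ has degree pⁿ.
theorem2 p pr n 1≤n ⊥₋    = realises-⊥ pr (CyclicGroupRing.cyclotomicRing pr n)
theorem2 p pr n 1≤n [ t ] = ≡.subst (λ m → Realises p m [ + toℕ t ]) n≡
  (realises-level pr (CyclicGroupRing.cyclotomicRing pr (n ∸ suc (toℕ t))) (toℕ t))
  where
  n≡ : suc (n ∸ suc (toℕ t)) ℕ.+ toℕ t ≡ n
  n≡ = ≡.trans (≡.sym (ℕ.+-suc (n ∸ suc (toℕ t)) (toℕ t))) (ℕ.m∸n+n≡m (Fin.toℕ<n t))
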